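{- Let $n\ge 3$ be an integer. (Extremal families.) Let $p\in(0,1/2]$ and let $\mathcal{F}$ be an odd-cycle-intersecting family of subgraphs of $K_n$. Then $\mu_p(\mathcal{F})\le p^3$, with equality if and only if $\mathcal{F}$ is a $\triangle$umvirate. Furthermore, in the case $p=1/2$, if $\mathcal{F}$ is odd-cycle-agreeing then $\mu_{1/2}(\mathcal{F})\le 1/8$, with equality if and only if $\mathcal{F}$ is a triangle junta. (Stability.) For each $p\in(0,1/2]$ there exists a constant $c_p$, not depending on $n$, such that $\sup_{p\in[\delta,1/2]}c_p<\infty$ for every fixed $\delta>0$, and such that for any $\epsilon\ge 0$: if $\mathcal{F}$ is an odd-cycle-intersecting family of subgraphs of $K_n$ with $\mu_p(\mathcal{F})\ge p^3-\epsilon$, then there exists a $\triangle$umvirate $\mathcal{T}$ with $\mu_p(\mathcal{T}\,\Delta\,\mathcal{F})\le c_p\epsilon$. For $p=1/2$, the corresponding statement holds for odd-cycle-agreeing families: if $\mathcal{F}$ is odd-cycle-agreeing with $\mu_{1/2}(\mathcal{F})\ge 1/8-\epsilon$, then there is a triangle junta $\mathcal{T}$ with $\mu_{1/2}(\mathcal{T}\,\Delta\,\mathcal{F})\le c_{1/2}\epsilon$.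
   Context: Subgraphs of $K_n$ are identified with their edge sets, subsets of $[n]^{(2)}$; $\oplus$ (or $\Delta$) denotes symmetric difference and $\overline{G}$ the complement $K_n\setminus G$. For $p\in[0,1]$ and a graph $G\subseteq K_n$, $\mu_p(G)=p^{|G|}(1-p)^{\binom n2-|G|}$ (the probability that $G(n,p)=G$), and for a family $\mathcal{F}$, $\mu_p(\mathcal{F})=\sum_{G\in\mathcal{F}}\mu_p(G)$. A family $\mathcal{F}$ is odd-cycle-intersecting if for all $G,H\in\mathcal{F}$, $G\cap H$ contains an odd cycle; it is odd-cycle-agreeing if for all $G,H\in\mathcal{F}$, $\overline{G\oplus H}$ contains an odd cycle. A triangle junta is the family of all subgraphs of $K_n$ having a prescribed intersection with a given triangle $T$ (i.e. $\{G: G\cap T=S\}$ for some fixed triangle $T$ and $S\subseteq T$). A $\triangle$umvirate is the family of all subgraphs of $K_n$ containing a given triangle.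
   Formalization: The probability p, the error ε and the threshold δ range over rational numbers instead of real numbers (the constants c_p and the bound on their supremum are likewise rational). -}

module Defs where

open import Data.Bool using (Bool; true; false; _∧_; _∨_; not; _xor_; if_then_else_)
open import Data.Nat as ℕ using (ℕ; zero; suc; _∸_; _%_)
open import Data.Fin as Fin using (Fin; _<?_; _≟_)
open import Data.List as List using (List; []; _∷_; _++_; [_]; length; concatMap; filter; allFin)
open import Data.Vec as Vec using (Vec; lookup; tabulate; zipWith; countᵇ)
open import Data.Product using (_×_; _,_; ∃; Σ)
open import Data.Unit using (⊤)
open import Data.Empty using (⊥)
open import Data.List.Relation.Unary.Unique.Propositional using (Unique)
open import Relation.Nullary.Decidable using (⌊_⌋)
open import Relation.Binary.PropositionalEquality using (_≡_; _≢_)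
open import Data.Rational using (ℚ; 0ℚ; 1ℚ; _+_; _*_; _-_)

edgeList : (n : ℕ) → List (Fin n × Fin n)
edgeList n = concatMap (λ i → List.map (λ j → (i , j)) (filter (λ j → i <? j) (allFin n))) (allFin n)

N : ℕ → ℕ
N n = length (edgeList n)

-- A subgraph of K_n, identified with its edge set (indicator vector over edgeList n).
record Graph (n : ℕ) : Set where
  constructor mkGraph
  field edgeVec : Vec Bool (N n)
open Graph public

Family : ℕ → Set
Family n = Graph n → Bool

edgeB : {n : ℕ} → Graph n → Fin n → Fin n → Bool
edgeB {n} G u v = Vec.foldr _ _∨_ false (tabulate λ k → lookup (edgeVec G) k ∧ matches (List.lookup (edgeList n) k))
  where
  matches : Fin n × Fin n → Bool
  matches (i , j) = (⌊ i ≟ u ⌋ ∧ ⌊ j ≟ v ⌋) ∨ (⌊ i ≟ v ⌋ ∧ ⌊ j ≟ u ⌋)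

HasEdge : {n : ℕ} → Graph n → Fin n → Fin n → Set
HasEdge G u v = edgeB G u v ≡ true

_∩G_ : {n : ℕ} → Graph n → Graph n → Graph n
G ∩G H = mkGraph (zipWith _∧_ (edgeVec G) (edgeVec H))

_⊕G_ : {n : ℕ} → Graph n → Graph n → Graph n
G ⊕G H = mkGraph (zipWith _xor_ (edgeVec G) (edgeVec H))

complement : {n : ℕ} → Graph n → Graph n
complement G = mkGraph (Vec.map not (edgeVec G))

size : {n : ℕ} → Graph n → ℕ
size G = countᵇ (λ b → b) (edgeVec G)

Path : {n : ℕ} → Graph n → List (Fin n) → Set
Path G (x ∷ y ∷ r) = HasEdge G x y × Path G (y ∷ r)
Path G _ = ⊤

CycleEdges : {n : ℕ} → Graph n → List (Fin n) → Set
CycleEdges G [] = ⊥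
CycleEdges G (v ∷ vs) = Path G ((v ∷ vs) ++ [ v ])

HasOddCycle : {n : ℕ} → Graph n → Set
HasOddCycle {n} G = ∃ λ (vs : List (Fin n)) →
  Unique vs × 3 ℕ.≤ length vs × length vs % 2 ≡ 1 × CycleEdges G vs

OddCycleIntersecting : {n : ℕ} → Family n → Set
OddCycleIntersecting {n} F = (G H : Graph n) → F G ≡ true → F H ≡ true → HasOddCycle (G ∩G H)

OddCycleAgreeing : {n : ℕ} → Family n → Set
OddCycleAgreeing {n} F = (G H : Graph n) → F G ≡ true → F H ≡ true → HasOddCycle (complement (G ⊕G H))

_^_ : ℚ → ℕ → ℚ
x ^ zero = 1ℚ
x ^ suc k = x * (x ^ k)

allVecs : (k : ℕ) → List (Vec Bool k)
allVecs zero = Vec.[] ∷ []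
allVecs (suc k) = List.map (true Vec.∷_) (allVecs k) ++ List.map (false Vec.∷_) (allVecs k)

sumℚ : List ℚ → ℚ
sumℚ = List.foldr _+_ 0ℚ

μ : {n : ℕ} → ℚ → Graph n → ℚ
μ {n} p G = (p ^ size G) * ((1ℚ - p) ^ (N n ∸ size G))

μF : {n : ℕ} → ℚ → Family n → ℚ
μF {n} p F = sumℚ (List.map (λ G → if F G then μ p G else 0ℚ) (List.map mkGraph (allVecs (N n))))

_ΔF_ : {n : ℕ} → Family n → Family n → Family n
(F ΔF H) G = F G xor H G

IsTriangle : {n : ℕ} → Fin n → Fin n → Fin n → Set
IsTriangle a b c = a ≢ b × b ≢ c × a ≢ c

umvirate : {n : ℕ} → Fin n → Fin n → Fin n → Family n
umvirate a b c G = edgeB G a b ∧ edgeB G b c ∧ edgeB G a c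

-- the triangle junta {G : G ∩ T = S}, S ⊆ T = abc given by (sab , sbc , sac)
junta : {n : ℕ} → Fin n → Fin n → Fin n → Bool → Bool → Bool → Family n
junta a b c sab sbc sac G =
  not (edgeB G a b xor sab) ∧ not (edgeB G b c xor sbc) ∧ not (edgeB G a c xor sac)

IsUmvirate : {n : ℕ} → Family n → Set
IsUmvirate {n} F = Σ (Fin n) λ a → Σ (Fin n) λ b → Σ (Fin n) λ c →
  IsTriangle a b c × ((G : Graph n) → F G ≡ umvirate a b c G)

IsTriangleJunta : {n : ℕ} → Family n → Set
IsTriangleJunta {n} F = Σ (Fin n) λ a → Σ (Fin n) λ b → Σ (Fin n) λ c →
  Σ Bool λ sab → Σ Bool λ sbc → Σ Bool λ sac →
  IsTriangle a b c × ((G : Graph n) → F G ≡ junta a b c sab sbc sac G)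

⅛ : ℚ
⅛ = Data.Rational.½ * Data.Rational.½ * Data.Rational.½

{-# OPTIONS --safe #-}

-- Everything reduces to agreeing families at p = ½.
--
-- If f is the indicator of an odd-cycle-agreeing family and B is contained in a cut of K_n,
-- then f(x) f(x ⊕ B̄) = 0.  In terms of the Fourier weights w(S) = f̂(S)² this says
-- Σ_S w(S) (-1)^|S| 𝔼_K ψ(S ∩ K) = 0 for every function ψ, where K is a uniformly random cut.
-- A suitable ψ turns this into a Hoffman bound: the coefficient of w(S) is 1792 at S = ∅ and
-- at least -256 elsewhere, whence the bound 256 / (1792 + 256) = ⅛, and it exceeds -256 by a
-- fixed gap unless S is good, i.e. |S| ≤ 2 or S is a triangle.  To compute the coefficient,
-- take a maximal forest of S: its intersection with K is uniform and determines S ∩ K.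
--
-- For a family of measure at least ⅛ - ε the weight of the bad S is therefore O(ε).  Averaging
-- f(x) f(x ⊕ K̄) = 0 over K gives f · Af = 0, where A keeps only the Fourier coefficients in the
-- cycle space.  Restricted to the good part g of f, the product g · Ag is a polynomial of degree 6
-- that is small in L¹, hence in L² by hypercontractivity; its coefficient at T ⊕ e, for a triangle
-- T and an edge e ∉ T, is -f̂(T) f̂(e).  So Σ_{e ∉ T} w(T) w(e) = O(ε), and since the triangles
-- carry weight about 1/64 and the edges about 3/64, the three edges of one triangle T carry
-- weight 1/64 - O(ε) each.  This forces f to be O(ε)-close to a junta on T.
--
-- For p < ½ pass to the up-closure A of an intersecting family, which is agreeing.  A two-point
-- inequality for a piecewise linear function gives μ_p(A) ≤ 8p³ μ_½(A) when μ_½(A) ≤ ⅛, so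
-- extremality and stability descend from ½ to p.  Uniqueness is stability with ε = 0.

module Submission where

open import Defs
open import Data.Bool using (Bool; true; false; _∧_; _∨_; not; _xor_; if_then_else_)
open import Data.Bool.Properties using (∧-comm; ∧-assoc; ∧-idem; ∧-zeroʳ; ∧-identityʳ; ∨-zeroʳ; xor-comm; xor-assoc; xor-same; xor-identityʳ; not-involutive; T-≡)
open import Data.Empty using (⊥; ⊥-elim)
open import Data.Fin as Fin using (Fin; zero; suc)
import Data.Fin.Properties as Finₚ
open import Data.Integer using (+_)
open import Data.List as List using (List; []; _∷_; _++_; [_]; length; filter; allFin)
open import Data.List.Membership.Propositional using (_∈_)
open import Data.List.Membership.Propositional.Properties using (∈-concatMap⁺; ∈-concatMap⁻; ∈-filter⁺; ∈-filter⁻; ∈-map⁺; ∈-map⁻; ∈-lookup; ∈-allFin)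
open import Data.List.Properties using (map-∘; map-++; map-cong)
import Data.List.Relation.Unary.All as All
import Data.List.Relation.Unary.All.Properties as Allₚ
open import Data.List.Relation.Unary.AllPairs as AllPairs using (_∷_)
import Data.List.Relation.Unary.AllPairs.Properties as AllPairsₚ
import Data.List.Relation.Unary.Any as Any
open import Data.List.Relation.Unary.Any.Properties using (lookup-index)
open import Data.List.Relation.Unary.Unique.Propositional using (Unique)
import Data.List.Relation.Unary.Unique.Propositional.Properties as Uniqueₚ
open import Data.Nat as ℕ using (ℕ; zero; suc; s≤s; z≤n; _≤ᵇ_; _≡ᵇ_; _∸_; _%_)
open import Data.Nat.DivMod using ([m+n]%n≡m%n)
import Data.Nat.Properties as ℕₚ
open import Data.Product using (_×_; _,_; ∃; Σ; proj₁; proj₂)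
open import Data.Rational using (ℚ; 0ℚ; 1ℚ; ½; _+_; _*_; _-_; -_; _≤_; _<_; _/_; ∣_∣; 1/_; nonNegative; positive; ≢-nonZero)
open import Data.Rational.Properties
open import Data.Sum using (_⊎_; inj₁; inj₂)
open import Data.Unit using (tt)
open import Data.Vec as Vec using (Vec; []; _∷_; lookup; tabulate; zipWith; replicate; countᵇ; _[_]≔_)
open import Data.Vec.Properties using (lookup-zipWith; lookup-map; lookup∘tabulate; lookup∘update′)
open import Function using (_∘_)
open import Function.Bundles using (_⇔_; mk⇔; Equivalence)
open import Level using (0ℓ)
open import Relation.Binary.Definitions using (tri<; tri≈; tri>)
open import Relation.Binary.PropositionalEquality using (_≡_; _≢_; refl; sym; trans; cong; cong₂; subst; subst₂; module ≡-Reasoning)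
open import Relation.Nullary using (Dec; yes; no)
open import Relation.Nullary.Decidable using (⌊_⌋; True; dec⇒maybe; from-yes; fromWitness; toWitness)
open import Tactic.RingSolver using (solve-∀)
open import Tactic.RingSolver.Core.AlmostCommutativeRing using (AlmostCommutativeRing; fromCommutativeRing)

-- Ordered-field lemmas for ℚ

-- Two obstacles shape the argument. One is the choice of ψ. Once edges, pairs and triangles are
-- tight, a function of |S ∩ K| alone with values v₃, v₄ at sizes three and four needs 4v₃ + v₄ ≥
-- 768 for forests with four edges and 4v₃ + v₄ ≤ 768 for K₄ minus an edge, so both stay tight and
-- there is no gap. A second random cut, which tells a four-edge forest from a four-cycle, breaks
-- the tie. The other is that the spectral bound does not exclude Fourier weight spread over many
-- triangles. What ties it to one triangle is the quadratic equation f · Af = 0 together with the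
-- cap |f̂(e)| ≤ 𝔼 f, which makes three edges just enough to carry the weight of all edges. The
-- spectral analysis concerns simple binary matroids instead of graphs: the coefficient of w(S)
-- depends only on the coordinates of S in a basis, so small ranks are finitely many cases and large
-- ranks yield to crude bounds. Norm inequalities are stated between powers, which keeps all
-- constants rational.

ℚ-ring : AlmostCommutativeRing 0ℓ 0ℓ
ℚ-ring = fromCommutativeRing +-*-commutativeRing (λ x → dec⇒maybe (0ℚ ≟ x))

0≤1 : 0ℚ ≤ 1ℚ
0≤1 = from-yes (0ℚ ≤? 1ℚ)

0≤½ : 0ℚ ≤ ½
0≤½ = from-yes (0ℚ ≤? ½)

≤-by : ∀ {a b} r → 0ℚ ≤ r → a + r ≡ b → a ≤ b
≤-by {a} r 0≤r eq = subst₂ _≤_ (+-identityʳ a) eq (+-monoʳ-≤ a 0≤r)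

0≤+ : ∀ {a b} → 0ℚ ≤ a → 0ℚ ≤ b → 0ℚ ≤ a + b
0≤+ = +-mono-≤

*-monoˡ : ∀ {c a b} → 0ℚ ≤ c → a ≤ b → c * a ≤ c * b
*-monoˡ {c} 0≤c a≤b = *-monoˡ-≤-nonNeg c {{nonNegative 0≤c}} a≤b

*-monoʳ : ∀ {c a b} → 0ℚ ≤ c → a ≤ b → a * c ≤ b * c
*-monoʳ {c} 0≤c a≤b = *-monoʳ-≤-nonNeg c {{nonNegative 0≤c}} a≤b

0≤* : ∀ {a b} → 0ℚ ≤ a → 0ℚ ≤ b → 0ℚ ≤ a * b
0≤* {a} {b} 0≤a 0≤b = subst (_≤ a * b) (*-zeroʳ a) (*-monoˡ 0≤a 0≤b)

*-mono₂ : ∀ {a b c d} → 0ℚ ≤ a → 0ℚ ≤ d → a ≤ b → c ≤ d → a * c ≤ b * d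
*-mono₂ 0≤a 0≤d a≤b c≤d = ≤-trans (*-monoˡ 0≤a c≤d) (*-monoʳ 0≤d a≤b)

0<* : ∀ {a b} → 0ℚ < a → 0ℚ < b → 0ℚ < a * b
0<* {a} {b} 0<a 0<b = subst (_< a * b) (*-zeroʳ a) (*-monoʳ-<-pos a {{positive 0<a}} 0<b)

private
  sub-add : ∀ a b → (b - a) + a ≡ b
  sub-add = solve-∀ ℚ-ring

0≤- : ∀ {a b} → a ≤ b → 0ℚ ≤ b - a
0≤- {a} {b} a≤b = subst (_≤ b - a) (+-inverseʳ a) (+-monoˡ-≤ (- a) a≤b)

0<- : ∀ {a b} → a < b → 0ℚ < b - a
0<- {a} {b} a<b = subst (_< b - a) (+-inverseʳ a) (+-monoˡ-< (- a) a<b)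

-‿0< : ∀ {a b} → 0ℚ < b - a → a < b
-‿0< {a} {b} h = subst₂ _<_ (+-identityˡ a) (sub-add a b) (+-monoˡ-< a h)

∣∣²≡² : ∀ x → ∣ x ∣ * ∣ x ∣ ≡ x * x
∣∣²≡² x with ∣p∣≡p∨∣p∣≡-p x
... | inj₁ e rewrite e = refl
... | inj₂ e rewrite e = lem x
  where
  lem : ∀ x → (- x) * (- x) ≡ x * x
  lem = solve-∀ ℚ-ring

0≤² : ∀ x → 0ℚ ≤ x * x
0≤² x = subst (0ℚ ≤_) (∣∣²≡² x) (0≤* (0≤∣p∣ x) (0≤∣p∣ x))

²-cancel-≤ : ∀ {a b} → 0ℚ ≤ b → a * a ≤ b * b → a ≤ b
²-cancel-≤ {a} {b} 0≤b h with a ≤? b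
... | yes a≤b = a≤b
... | no a≰b = ⊥-elim (<-irrefl refl (≤-<-trans h lt))
  where
  b<a = ≰⇒> a≰b
  0<a = ≤-<-trans 0≤b b<a
  lt : b * b < a * a
  lt = ≤-<-trans (*-monoˡ 0≤b (<⇒≤ b<a)) (*-monoˡ-<-pos a {{positive 0<a}} b<a)

*-cancelˡ-≤ : ∀ {c a b} → 0ℚ < c → c * a ≤ c * b → a ≤ b
*-cancelˡ-≤ {c} 0<c = *-cancelˡ-≤-pos c {{positive 0<c}}

⟦_⟧ : Bool → ℚ
⟦ true ⟧ = 1ℚ
⟦ false ⟧ = 0ℚ

t≢f : true ≢ false
t≢f ()

∧-true : ∀ {a b} → a ∧ b ≡ true → a ≡ true × b ≡ true
∧-true {true} {true} _ = refl , refl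

0≤⟦⟧ : ∀ b → 0ℚ ≤ ⟦ b ⟧
0≤⟦⟧ true = 0≤1
0≤⟦⟧ false = ≤-refl

⟦⟧≤1 : ∀ b → ⟦ b ⟧ ≤ 1ℚ
⟦⟧≤1 true = ≤-refl
⟦⟧≤1 false = 0≤1

decide≤ : ∀ {p q} {_ : True (p ≤? q)} → p ≤ q
decide≤ {_} {_} {w} = toWitness w

-- Walsh–Fourier analysis on the discrete cube

-- One recursion serves three functionals: weights 1, 1 give the sum over the cube, ½, ½ the uniform
-- mean, and p, 1 - p the biased measure. Linearity, monotonicity and Fubini are proved once for all
-- of them.
∫ : ℚ → ℚ → ∀ k → (Vec Bool k → ℚ) → ℚ
∫ a b zero F = F []
∫ a b (suc k) F = a * ∫ a b k (F ∘ (true ∷_)) + b * ∫ a b k (F ∘ (false ∷_))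

module _ {a b : ℚ} where

  ∫-cong : ∀ k {F G} → (∀ x → F x ≡ G x) → ∫ a b k F ≡ ∫ a b k G
  ∫-cong zero h = h []
  ∫-cong (suc k) h = cong₂ (λ u v → a * u + b * v) (∫-cong k (λ x → h (true ∷ x))) (∫-cong k (λ x → h (false ∷ x)))

  ∫-+ : ∀ k F G → ∫ a b k (λ x → F x + G x) ≡ ∫ a b k F + ∫ a b k G
  ∫-+ zero F G = refl
  ∫-+ (suc k) F G = trans
    (cong₂ (λ u v → a * u + b * v) (∫-+ k (F ∘ (true ∷_)) (G ∘ (true ∷_))) (∫-+ k (F ∘ (false ∷_)) (G ∘ (false ∷_))))
    (lem a b _ _ _ _)
    where
    lem : ∀ a b u v w z → a * (u + v) + b * (w + z) ≡ (a * u + b * w) + (a * v + b * z)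
    lem = solve-∀ ℚ-ring

  ∫-*ˡ : ∀ k c F → ∫ a b k (λ x → c * F x) ≡ c * ∫ a b k F
  ∫-*ˡ zero c F = refl
  ∫-*ˡ (suc k) c F = trans
    (cong₂ (λ u v → a * u + b * v) (∫-*ˡ k c (F ∘ (true ∷_))) (∫-*ˡ k c (F ∘ (false ∷_))))
    (lem a b c _ _)
    where
    lem : ∀ a b c u v → a * (c * u) + b * (c * v) ≡ c * (a * u + b * v)
    lem = solve-∀ ℚ-ring

  ∫-*ʳ : ∀ k c F → ∫ a b k (λ x → F x * c) ≡ ∫ a b k F * c
  ∫-*ʳ k c F = trans (∫-cong k (λ x → *-comm (F x) c)) (trans (∫-*ˡ k c F) (*-comm c _))

  ∫-- : ∀ k F G → ∫ a b k (λ x → F x - G x) ≡ ∫ a b k F - ∫ a b k G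
  ∫-- k F G = trans (∫-cong k (λ x → cong (λ u → F x + u) (lem (G x))))
    (trans (∫-+ k F (λ x → - 1ℚ * G x)) (cong (λ u → ∫ a b k F + u) (trans (∫-*ˡ k (- 1ℚ) G) (sym (lem _)))))
    where
    lem : ∀ u → - u ≡ - 1ℚ * u
    lem = solve-∀ ℚ-ring

  ∫-0 : ∀ k → ∫ a b k (λ _ → 0ℚ) ≡ 0ℚ
  ∫-0 k = trans (∫-*ˡ k 0ℚ (λ _ → 0ℚ)) (*-zeroˡ (∫ a b k (λ _ → 0ℚ)))

  ∫-const : a + b ≡ 1ℚ → ∀ k c → ∫ a b k (λ _ → c) ≡ c
  ∫-const h zero c = refl
  ∫-const h (suc k) c = trans (cong (λ u → a * u + b * u) (∫-const h k c))
    (trans (sym (*-distribʳ-+ c a b)) (trans (cong (_* c) h) (*-identityˡ c)))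

  ∫-mono : 0ℚ ≤ a → 0ℚ ≤ b → ∀ k {F G} → (∀ x → F x ≤ G x) → ∫ a b k F ≤ ∫ a b k G
  ∫-mono 0≤a 0≤b zero h = h []
  ∫-mono 0≤a 0≤b (suc k) h = +-mono-≤
    (*-monoˡ 0≤a (∫-mono 0≤a 0≤b k (λ x → h (true ∷ x))))
    (*-monoˡ 0≤b (∫-mono 0≤a 0≤b k (λ x → h (false ∷ x))))

  ∫-nonneg : 0ℚ ≤ a → 0ℚ ≤ b → ∀ k {F} → (∀ x → 0ℚ ≤ F x) → 0ℚ ≤ ∫ a b k F
  ∫-nonneg 0≤a 0≤b k {F} h = subst (_≤ ∫ a b k F) (∫-0 k) (∫-mono 0≤a 0≤b k h)

∫-swap : ∀ {a b c d} k l (F : Vec Bool k → Vec Bool l → ℚ) →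
  ∫ a b k (λ x → ∫ c d l (F x)) ≡ ∫ c d l (λ y → ∫ a b k (λ x → F x y))
∫-swap zero l F = refl
∫-swap {a} {b} {c} {d} (suc k) l F = begin
  a * ∫ a b k (λ x → ∫ c d l (F (true ∷ x))) + b * ∫ a b k (λ x → ∫ c d l (F (false ∷ x)))
    ≡⟨ cong₂ (λ u v → a * u + b * v) (∫-swap k l (F ∘ (true ∷_))) (∫-swap k l (F ∘ (false ∷_))) ⟩
  a * ∫ c d l Ft + b * ∫ c d l Ff
    ≡⟨ cong₂ _+_ (sym (∫-*ˡ l a Ft)) (sym (∫-*ˡ l b Ff)) ⟩
  ∫ c d l (λ y → a * Ft y) + ∫ c d l (λ y → b * Ff y)
    ≡⟨ sym (∫-+ l _ _) ⟩
  ∫ c d l (λ y → a * Ft y + b * Ff y) ∎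
  where
  open ≡-Reasoning
  Ft Ff : Vec Bool l → ℚ
  Ft y = ∫ a b k (λ x → F (true ∷ x) y)
  Ff y = ∫ a b k (λ x → F (false ∷ x) y)

infixl 6 _⊕_
infixl 7 _∩_

_⊕_ _∩_ : ∀ {k} → Vec Bool k → Vec Bool k → Vec Bool k
_⊕_ = zipWith _xor_
_∩_ = zipWith _∧_

∼_ : ∀ {k} → Vec Bool k → Vec Bool k
∼_ = Vec.map not

𝟘 : ∀ {k} → Vec Bool k
𝟘 = replicate _ false

∫-shift : ∀ {a} k (s : Vec Bool k) F → ∫ a a k (λ x → F (s ⊕ x)) ≡ ∫ a a k F
∫-shift zero [] F = refl
∫-shift {a} (suc k) (true ∷ s) F = trans
  (cong₂ (λ u v → a * u + a * v) (∫-shift k s (F ∘ (false ∷_))) (∫-shift k s (F ∘ (true ∷_))))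
  (+-comm (a * ∫ a a k (F ∘ (false ∷_))) (a * ∫ a a k (F ∘ (true ∷_))))
∫-shift {a} (suc k) (false ∷ s) F =
  cong₂ (λ u v → a * u + a * v) (∫-shift k s (F ∘ (true ∷_))) (∫-shift k s (F ∘ (false ∷_)))

⊕-comm : ∀ {k} (x y : Vec Bool k) → x ⊕ y ≡ y ⊕ x
⊕-comm [] [] = refl
⊕-comm (a ∷ x) (b ∷ y) = cong₂ _∷_ (xor-comm a b) (⊕-comm x y)

⊕-assoc : ∀ {k} (x y z : Vec Bool k) → (x ⊕ y) ⊕ z ≡ x ⊕ (y ⊕ z)
⊕-assoc [] [] [] = refl
⊕-assoc (a ∷ x) (b ∷ y) (c ∷ z) = cong₂ _∷_ (xor-assoc a b c) (⊕-assoc x y z)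

⊕-self : ∀ {k} (x : Vec Bool k) → x ⊕ x ≡ 𝟘
⊕-self [] = refl
⊕-self (a ∷ x) = cong₂ _∷_ (xor-same a) (⊕-self x)

⊕-identityˡ : ∀ {k} (x : Vec Bool k) → 𝟘 ⊕ x ≡ x
⊕-identityˡ [] = refl
⊕-identityˡ (a ∷ x) = cong (a ∷_) (⊕-identityˡ x)

⊕-identityʳ : ∀ {k} (x : Vec Bool k) → x ⊕ 𝟘 ≡ x
⊕-identityʳ x = trans (⊕-comm x 𝟘) (⊕-identityˡ x)

⊕-cancel : ∀ {k} (x y : Vec Bool k) → x ⊕ (x ⊕ y) ≡ y
⊕-cancel x y = trans (sym (⊕-assoc x x y)) (trans (cong (_⊕ y) (⊕-self x)) (⊕-identityˡ y))

⊕-zero⇒≡ : ∀ {k} {x y : Vec Bool k} → x ⊕ y ≡ 𝟘 → x ≡ y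
⊕-zero⇒≡ {x = x} {y} h = sym (trans (sym (⊕-cancel x y)) (trans (cong (x ⊕_) h) (⊕-identityʳ x)))

∩-comm : ∀ {k} (x y : Vec Bool k) → x ∩ y ≡ y ∩ x
∩-comm [] [] = refl
∩-comm (a ∷ x) (b ∷ y) = cong₂ _∷_ (∧-comm a b) (∩-comm x y)

sg : Bool → ℚ
sg true = - 1ℚ
sg false = 1ℚ

sg-xor : ∀ a b → sg (a xor b) ≡ sg a * sg b
sg-xor true true = refl
sg-xor true false = refl
sg-xor false true = refl
sg-xor false false = refl

sg² : ∀ b → sg b * sg b ≡ 1ℚ
sg² true = refl
sg² false = refl

-- The Walsh character: χ S x = (-1)^|S ∩ x|.
χ : ∀ {k} → Vec Bool k → Vec Bool k → ℚ
χ [] [] = 1ℚ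
χ (s ∷ S) (b ∷ x) = sg (s ∧ b) * χ S x

sgn : ∀ {k} → Vec Bool k → ℚ
sgn [] = 1ℚ
sgn (s ∷ S) = sg s * sgn S

private
  interchange : ∀ a b c d → (a * b) * (c * d) ≡ (a * c) * (b * d)
  interchange = solve-∀ ℚ-ring

χ-comm : ∀ {k} (S x : Vec Bool k) → χ S x ≡ χ x S
χ-comm [] [] = refl
χ-comm (s ∷ S) (b ∷ x) = cong₂ _*_ (cong sg (∧-comm s b)) (χ-comm S x)

χ-⊕ʳ : ∀ {k} (S x y : Vec Bool k) → χ S (x ⊕ y) ≡ χ S x * χ S y
χ-⊕ʳ [] [] [] = refl
χ-⊕ʳ (s ∷ S) (a ∷ x) (b ∷ y) = trans (cong₂ _*_ (bit s a b) (χ-⊕ʳ S x y)) (interchange (sg (s ∧ a)) (sg (s ∧ b)) (χ S x) (χ S y))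
  where
  bit : ∀ s a b → sg (s ∧ (a xor b)) ≡ sg (s ∧ a) * sg (s ∧ b)
  bit true a b = sg-xor a b
  bit false a b = refl

χ-⊕ˡ : ∀ {k} (S T x : Vec Bool k) → χ (S ⊕ T) x ≡ χ S x * χ T x
χ-⊕ˡ S T x = trans (χ-comm (S ⊕ T) x) (trans (χ-⊕ʳ x S T) (cong₂ _*_ (χ-comm x S) (χ-comm x T)))

χ-∩ : ∀ {k} (S K B : Vec Bool k) → χ B (S ∩ K) ≡ χ S (B ∩ K)
χ-∩ [] [] [] = refl
χ-∩ (s ∷ S) (a ∷ K) (b ∷ B) = cong₂ _*_ (bit s a b) (χ-∩ S K B)
  where
  bit : ∀ s a b → sg (b ∧ (s ∧ a)) ≡ sg (s ∧ (b ∧ a))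
  bit true true b = refl
  bit true false true = refl
  bit true false false = refl
  bit false a true = refl
  bit false a false = refl

χ-∼ : ∀ {k} (S x : Vec Bool k) → χ S (∼ x) ≡ sgn S * χ S x
χ-∼ [] [] = refl
χ-∼ (s ∷ S) (b ∷ x) = trans (cong₂ _*_ (bit s b) (χ-∼ S x)) (interchange (sg s) (sg (s ∧ b)) (sgn S) (χ S x))
  where
  bit : ∀ s b → sg (s ∧ not b) ≡ sg s * sg (s ∧ b)
  bit true true = refl
  bit true false = refl
  bit false true = refl
  bit false false = refl

χ-sgn : ∀ {k} (S x : Vec Bool k) → χ S x ≡ sgn (S ∩ x)
χ-sgn [] [] = refl
χ-sgn (s ∷ S) (b ∷ x) = cong (sg (s ∧ b) *_) (χ-sgn S x)

χ-𝟘ˡ : ∀ {k} (x : Vec Bool k) → χ 𝟘 x ≡ 1ℚ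
χ-𝟘ˡ [] = refl
χ-𝟘ˡ (b ∷ x) = trans (*-identityˡ _) (χ-𝟘ˡ x)

χ² : ∀ {k} (S x : Vec Bool k) → χ S x * χ S x ≡ 1ℚ
χ² [] [] = refl
χ² (s ∷ S) (b ∷ x) = trans (interchange (sg (s ∧ b)) (χ S x) (sg (s ∧ b)) (χ S x)) (cong₂ _*_ (sg² (s ∧ b)) (χ² S x))

sgn² : ∀ {k} (S : Vec Bool k) → sgn S * sgn S ≡ 1ℚ
sgn² [] = refl
sgn² (s ∷ S) = trans (interchange (sg s) (sgn S) (sg s) (sgn S)) (cong₂ _*_ (sg² s) (sgn² S))

isZero : ∀ {k} → Vec Bool k → Bool
isZero [] = true
isZero (true ∷ x) = false
isZero (false ∷ x) = isZero x

isZero-𝟘 : ∀ k → isZero (𝟘 {k}) ≡ true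
isZero-𝟘 zero = refl
isZero-𝟘 (suc k) = isZero-𝟘 k

isZero⇒≡ : ∀ {k} (x : Vec Bool k) → isZero x ≡ true → x ≡ 𝟘
isZero⇒≡ [] h = refl
isZero⇒≡ (false ∷ x) h = cong (false ∷_) (isZero⇒≡ x h)

Sum 𝔼 : ∀ {k} → (Vec Bool k → ℚ) → ℚ
Sum {k} = ∫ 1ℚ 1ℚ k
𝔼 {k} = ∫ ½ ½ k

𝔼-χ : ∀ {k} (v : Vec Bool k) → 𝔼 (χ v) ≡ ⟦ isZero v ⟧
𝔼-χ [] = refl
𝔼-χ {suc k} (true ∷ v) = trans
  (cong₂ (λ u w → ½ * u + ½ * w) (∫-*ˡ k (- 1ℚ) (χ v)) (∫-*ˡ k 1ℚ (χ v))) (lem (𝔼 (χ v)))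
  where
  lem : ∀ u → ½ * (- 1ℚ * u) + ½ * (1ℚ * u) ≡ 0ℚ
  lem = solve-∀ ℚ-ring
𝔼-χ {suc k} (false ∷ v) = trans
  (cong₂ (λ u w → ½ * u + ½ * w) (∫-*ˡ k 1ℚ (χ v)) (∫-*ˡ k 1ℚ (χ v))) (trans (lem (𝔼 (χ v))) (𝔼-χ v))
  where
  lem : ∀ u → ½ * (1ℚ * u) + ½ * (1ℚ * u) ≡ u
  lem = solve-∀ ℚ-ring

hat : ∀ {k} → (Vec Bool k → ℚ) → Vec Bool k → ℚ
hat f S = 𝔼 (λ x → f x * χ S x)

private
  hat-true : ∀ {k} (f : Vec Bool (suc k) → ℚ) S →
    hat f (true ∷ S) ≡ ½ * (hat (f ∘ (false ∷_)) S - hat (f ∘ (true ∷_)) S)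
  hat-true {k} f S = trans
    (cong₂ (λ u w → ½ * u + ½ * w)
      (trans (∫-cong k (λ x → mv (f (true ∷ x)) (- 1ℚ) (χ S x))) (∫-*ˡ k (- 1ℚ) (λ x → f (true ∷ x) * χ S x)))
      (trans (∫-cong k (λ x → mv (f (false ∷ x)) 1ℚ (χ S x))) (∫-*ˡ k 1ℚ (λ x → f (false ∷ x) * χ S x))))
    (lem (hat (f ∘ (true ∷_)) S) (hat (f ∘ (false ∷_)) S))
    where
    mv : ∀ a b c → a * (b * c) ≡ b * (a * c)
    mv = solve-∀ ℚ-ring
    lem : ∀ u w → ½ * (- 1ℚ * u) + ½ * (1ℚ * w) ≡ ½ * (w - u)
    lem = solve-∀ ℚ-ring

  hat-false : ∀ {k} (f : Vec Bool (suc k) → ℚ) S →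
    hat f (false ∷ S) ≡ ½ * (hat (f ∘ (false ∷_)) S + hat (f ∘ (true ∷_)) S)
  hat-false {k} f S = trans
    (cong₂ (λ u w → ½ * u + ½ * w)
      (∫-cong k (λ x → mv (f (true ∷ x)) (χ S x)))
      (∫-cong k (λ x → mv (f (false ∷ x)) (χ S x))))
    (lem (hat (f ∘ (true ∷_)) S) (hat (f ∘ (false ∷_)) S))
    where
    mv : ∀ a c → a * (1ℚ * c) ≡ a * c
    mv = solve-∀ ℚ-ring
    lem : ∀ u w → ½ * u + ½ * w ≡ ½ * (w + u)
    lem = solve-∀ ℚ-ring

poly : ∀ {k} → (Vec Bool k → ℚ) → Vec Bool k → ℚ
poly a x = Sum (λ S → a S * χ S x)

poly-∷ : ∀ {k} (a : Vec Bool (suc k) → ℚ) b x →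
  poly a (b ∷ x) ≡ sg b * poly (a ∘ (true ∷_)) x + poly (a ∘ (false ∷_)) x
poly-∷ {k} a b x = cong₂ _+_
  (trans (*-identityˡ _) (trans (∫-cong k (λ S → mv (a (true ∷ S)) (sg b) (χ S x))) (∫-*ˡ k (sg b) _)))
  (trans (*-identityˡ _) (∫-cong k (λ S → cong (a (false ∷ S) *_) (*-identityˡ (χ S x)))))
  where
  mv : ∀ a b c → a * (b * c) ≡ b * (a * c)
  mv = solve-∀ ℚ-ring

poly-cong : ∀ {k} {a b : Vec Bool k → ℚ} → (∀ S → a S ≡ b S) → ∀ x → poly a x ≡ poly b x
poly-cong {k} h x = ∫-cong k (λ S → cong (_* χ S x) (h S))

poly-+ : ∀ {k} (a b : Vec Bool k → ℚ) x → poly (λ S → a S + b S) x ≡ poly a x + poly b x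
poly-+ {k} a b x = trans (∫-cong k (λ S → *-distribʳ-+ (χ S x) (a S) (b S))) (∫-+ k _ _)

poly-*ˡ : ∀ {k} c (a : Vec Bool k → ℚ) x → poly (λ S → c * a S) x ≡ c * poly a x
poly-*ˡ {k} c a x = trans (∫-cong k (λ S → *-assoc c (a S) (χ S x))) (∫-*ˡ k c _)

poly-hat : ∀ {k} (f : Vec Bool k → ℚ) x → poly (hat f) x ≡ f x
poly-hat f [] = trans (*-identityʳ _) (*-identityʳ _)
poly-hat {suc k} f (b ∷ x) = begin
  poly (hat f) (b ∷ x)
    ≡⟨ poly-∷ (hat f) b x ⟩
  sg b * poly (hat f ∘ (true ∷_)) x + poly (hat f ∘ (false ∷_)) x
    ≡⟨ cong₂ (λ u v → sg b * u + v)
         (trans (poly-cong (λ S → trans (hat-true f S) (re (hat f0 S) (hat f1 S))) x)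
           (trans (poly-+ (λ S → ½ * hat f0 S) (λ S → (- ½) * hat f1 S) x)
             (cong₂ _+_ (trans (poly-*ˡ ½ (hat f0) x) (cong (½ *_) (poly-hat f0 x)))
                        (trans (poly-*ˡ (- ½) (hat f1) x) (cong ((- ½) *_) (poly-hat f1 x))))))
         (trans (poly-cong (λ S → trans (hat-false f S) (*-distribˡ-+ ½ (hat f0 S) (hat f1 S))) x)
           (trans (poly-+ (λ S → ½ * hat f0 S) (λ S → ½ * hat f1 S) x)
             (cong₂ _+_ (trans (poly-*ˡ ½ (hat f0) x) (cong (½ *_) (poly-hat f0 x)))
                        (trans (poly-*ˡ ½ (hat f1) x) (cong (½ *_) (poly-hat f1 x)))))) ⟩
  sg b * (½ * f (false ∷ x) + (- ½) * f (true ∷ x)) + (½ * f (false ∷ x) + ½ * f (true ∷ x))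
    ≡⟨ fin b ⟩
  f (b ∷ x) ∎
  where
  open ≡-Reasoning
  f0 f1 : Vec Bool k → ℚ
  f0 = f ∘ (false ∷_)
  f1 = f ∘ (true ∷_)
  re : ∀ u v → ½ * (u - v) ≡ ½ * u + (- ½) * v
  re = solve-∀ ℚ-ring
  l1 : ∀ u v → - 1ℚ * (½ * u + (- ½) * v) + (½ * u + ½ * v) ≡ v
  l1 = solve-∀ ℚ-ring
  l2 : ∀ u v → 1ℚ * (½ * u + (- ½) * v) + (½ * u + ½ * v) ≡ u
  l2 = solve-∀ ℚ-ring
  fin : ∀ b → sg b * (½ * f (false ∷ x) + (- ½) * f (true ∷ x)) + (½ * f (false ∷ x) + ½ * f (true ∷ x)) ≡ f (b ∷ x)
  fin true = l1 (f (false ∷ x)) (f (true ∷ x))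
  fin false = l2 (f (false ∷ x)) (f (true ∷ x))

parseval : ∀ {k} (a b : Vec Bool k → ℚ) → 𝔼 (λ x → poly a x * poly b x) ≡ Sum (λ S → a S * b S)
parseval {zero} a b = lem (a []) (b [])
  where
  lem : ∀ u v → (u * 1ℚ) * (v * 1ℚ) ≡ u * v
  lem = solve-∀ ℚ-ring
parseval {suc k} a b = begin
  ½ * 𝔼 (λ x → poly a (true ∷ x) * poly b (true ∷ x)) + ½ * 𝔼 (λ x → poly a (false ∷ x) * poly b (false ∷ x))
    ≡⟨ cong₂ (λ u v → ½ * u + ½ * v)
        (∫-cong k (λ x → cong₂ _*_ (poly-∷ a true x) (poly-∷ b true x)))
        (∫-cong k (λ x → cong₂ _*_ (poly-∷ a false x) (poly-∷ b false x))) ⟩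
  ½ * 𝔼 U + ½ * 𝔼 V
    ≡⟨ sym (trans (∫-+ k (λ x → ½ * U x) (λ x → ½ * V x)) (cong₂ _+_ (∫-*ˡ k ½ U) (∫-*ˡ k ½ V))) ⟩
  𝔼 (λ x → ½ * U x + ½ * V x)
    ≡⟨ ∫-cong k (λ x → lem (poly a1 x) (poly a0 x) (poly b1 x) (poly b0 x)) ⟩
  𝔼 (λ x → poly a1 x * poly b1 x + poly a0 x * poly b0 x)
    ≡⟨ ∫-+ k _ _ ⟩
  𝔼 (λ x → poly a1 x * poly b1 x) + 𝔼 (λ x → poly a0 x * poly b0 x)
    ≡⟨ cong₂ _+_ (trans (parseval a1 b1) (sym (*-identityˡ _))) (trans (parseval a0 b0) (sym (*-identityˡ _))) ⟩
  Sum (λ S → a S * b S) ∎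
  where
  open ≡-Reasoning
  a0 a1 b0 b1 U V : Vec Bool k → ℚ
  a0 = a ∘ (false ∷_)
  a1 = a ∘ (true ∷_)
  b0 = b ∘ (false ∷_)
  b1 = b ∘ (true ∷_)
  U x = (sg true * poly a1 x + poly a0 x) * (sg true * poly b1 x + poly b0 x)
  V x = (sg false * poly a1 x + poly a0 x) * (sg false * poly b1 x + poly b0 x)
  lem : ∀ p q r s → ½ * ((- 1ℚ * p + q) * (- 1ℚ * r + s)) + ½ * ((1ℚ * p + q) * (1ℚ * r + s)) ≡ p * r + q * s
  lem = solve-∀ ℚ-ring

-- Convolution over the group of sets under `⊕`: the characters of S and S ⊕ R multiply to that of
-- R.
conv : ∀ {k} → (Vec Bool k → ℚ) → (Vec Bool k → ℚ) → Vec Bool k → ℚ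
conv a b R = Sum (λ S → a S * b (S ⊕ R))

poly-* : ∀ {k} (a b : Vec Bool k → ℚ) x → poly a x * poly b x ≡ poly (conv a b) x
poly-* {k} a b x = begin
  poly a x * poly b x
    ≡⟨ sym (∫-*ʳ k (poly b x) _) ⟩
  Sum (λ S → (a S * χ S x) * poly b x)
    ≡⟨ ∫-cong k (λ S → trans (cong ((a S * χ S x) *_) (sym (∫-shift k S (λ S′ → b S′ * χ S′ x))))
         (trans (sym (∫-*ˡ k (a S * χ S x) (λ R → b (S ⊕ R) * χ (S ⊕ R) x))) (∫-cong k (λ R → trans (cong (λ u → (a S * χ S x) * (b (S ⊕ R) * u)) (χ-⊕ˡ S R x))
           (lem (a S) (χ S x) (b (S ⊕ R)) (χ R x) (χ² S x)))))) ⟩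
  Sum (λ S → Sum (λ R → (a S * b (S ⊕ R)) * χ R x))
    ≡⟨ ∫-swap k k _ ⟩
  Sum (λ R → Sum (λ S → (a S * b (S ⊕ R)) * χ R x))
    ≡⟨ ∫-cong k (λ R → ∫-*ʳ k (χ R x) _) ⟩
  poly (conv a b) x ∎
  where
  open ≡-Reasoning
  re : ∀ u c v d → (u * c) * (v * (c * d)) ≡ (c * c) * ((u * v) * d)
  re = solve-∀ ℚ-ring
  lem : ∀ u c v d → c * c ≡ 1ℚ → (u * c) * (v * (c * d)) ≡ (u * v) * d
  lem u c v d h = trans (re u c v d) (trans (cong (_* ((u * v) * d)) h) (*-identityˡ _))

-- Hypercontractivity

module _ {a b : ℚ} where

  ∫-lin₃ : ∀ k c₁ c₂ c₃ F₁ F₂ F₃ → ∫ a b k (λ x → c₁ * F₁ x + c₂ * F₂ x + c₃ * F₃ x)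
    ≡ c₁ * ∫ a b k F₁ + c₂ * ∫ a b k F₂ + c₃ * ∫ a b k F₃
  ∫-lin₃ k c₁ c₂ c₃ F₁ F₂ F₃ = trans (∫-+ k (λ x → c₁ * F₁ x + c₂ * F₂ x) (λ x → c₃ * F₃ x))
    (cong₂ _+_ (trans (∫-+ k (λ x → c₁ * F₁ x) (λ x → c₂ * F₂ x)) (cong₂ _+_ (∫-*ˡ k c₁ F₁) (∫-*ˡ k c₂ F₂))) (∫-*ˡ k c₃ F₃))

  -- Lagrange's identity: the defect is the double integral of ½ w(x)w(y)(u(x)v(y) - u(y)v(x))².
  cauchy-schwarz : 0ℚ ≤ a → 0ℚ ≤ b → ∀ k (w u v : Vec Bool k → ℚ) → (∀ x → 0ℚ ≤ w x) →
    ∫ a b k (λ x → w x * (u x * v x)) * ∫ a b k (λ x → w x * (u x * v x))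
    ≤ ∫ a b k (λ x → w x * (u x * u x)) * ∫ a b k (λ x → w x * (v x * v x))
  cauchy-schwarz 0≤a 0≤b k w u v 0≤w = *-cancelˡ-≤ {+ 2 / 1} (from-yes (0ℚ <? (+ 2 / 1)))
    (≤-by (∫ a b k (λ x → ∫ a b k (λ y → D x y)))
      (∫-nonneg 0≤a 0≤b k (λ x → ∫-nonneg 0≤a 0≤b k (λ y → 0≤* (0≤* (0≤w x) (0≤w y)) (0≤² (u x * v y - u y * v x)))))
      (trans (cong (λ z → (+ 2 / 1) * (B * B) + z) eq) (fin A B C)))
    where
    fA fB fC : Vec Bool k → ℚ
    fA x = w x * (u x * u x)
    fB x = w x * (u x * v x)
    fC x = w x * (v x * v x)
    A B C : ℚ
    A = ∫ a b k fA
    B = ∫ a b k fB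
    C = ∫ a b k fC
    D : Vec Bool k → Vec Bool k → ℚ
    D x y = (w x * w y) * ((u x * v y - u y * v x) * (u x * v y - u y * v x))
    expand : ∀ w u v w′ u′ v′ → (w * w′) * ((u * v′ - u′ * v) * (u * v′ - u′ * v))
      ≡ (w * (u * u)) * (w′ * (v′ * v′)) + ((- (+ 2 / 1)) * (w * (u * v))) * (w′ * (u′ * v′)) + (w * (v * v)) * (w′ * (u′ * u′))
    expand = solve-∀ ℚ-ring
    outer : ∀ p q r A B C → p * C + ((- (+ 2 / 1)) * q) * B + r * A ≡ C * p + ((- (+ 2 / 1)) * B) * q + A * r
    outer = solve-∀ ℚ-ring
    fin : ∀ A B C → (+ 2 / 1) * (B * B) + (C * A + ((- (+ 2 / 1)) * B) * B + A * C) ≡ (+ 2 / 1) * (A * C)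
    fin = solve-∀ ℚ-ring
    eq : ∫ a b k (λ x → ∫ a b k (λ y → D x y)) ≡ C * A + ((- (+ 2 / 1)) * B) * B + A * C
    eq = trans (∫-cong k (λ x → trans (∫-cong k (λ y → expand (w x) (u x) (v x) (w y) (u y) (v y)))
           (trans (∫-lin₃ k (fA x) ((- (+ 2 / 1)) * fB x) (fC x) fC fB fA) (outer (fA x) (fB x) (fC x) A B C))))
         (∫-lin₃ k C ((- (+ 2 / 1)) * B) A fA fB fC)

wt : ∀ {k} → Vec Bool k → ℕ
wt [] = 0
wt (true ∷ S) = suc (wt S)
wt (false ∷ S) = wt S

wt-⊕ : ∀ {k} (S T : Vec Bool k) → wt (S ⊕ T) ℕ.≤ wt S ℕ.+ wt T
wt-⊕ [] [] = z≤n
wt-⊕ (true ∷ S) (true ∷ T) = ℕₚ.≤-trans (wt-⊕ S T) (ℕₚ.+-mono-≤ (ℕₚ.n≤1+n (wt S)) (ℕₚ.n≤1+n (wt T)))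
wt-⊕ (true ∷ S) (false ∷ T) = s≤s (wt-⊕ S T)
wt-⊕ (false ∷ S) (true ∷ T) = subst (suc (wt (S ⊕ T)) ℕ.≤_) (sym (ℕₚ.+-suc (wt S) (wt T))) (s≤s (wt-⊕ S T))
wt-⊕ (false ∷ S) (false ∷ T) = wt-⊕ S T

Degree≤ : ∀ {k} → ℕ → (Vec Bool k → ℚ) → Set
Degree≤ d a = ∀ S → d ℕ.< wt S → a S ≡ 0ℚ

9ℚ : ℚ
9ℚ = + 9 / 1

0≤9^ : ∀ d → 0ℚ ≤ 9ℚ ^ d
0≤9^ zero = 0≤1
0≤9^ (suc d) = 0≤* (from-yes (0ℚ ≤? 9ℚ)) (0≤9^ d)

sq : ℚ → ℚ
sq x = x * x

normsq : ∀ {k} → (Vec Bool k → ℚ) → ℚ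
normsq a = Sum (λ S → a S * a S)

0≤normsq : ∀ {k} (a : Vec Bool k → ℚ) → 0ℚ ≤ normsq a
0≤normsq {k} a = ∫-nonneg 0≤1 0≤1 k (λ S → 0≤² (a S))

𝔼-nonneg : ∀ {k} {F : Vec Bool k → ℚ} → (∀ x → 0ℚ ≤ F x) → 0ℚ ≤ 𝔼 F
𝔼-nonneg {k} = ∫-nonneg 0≤½ 0≤½ k

𝔼-mono : ∀ {k} {F G : Vec Bool k → ℚ} → (∀ x → F x ≤ G x) → 𝔼 F ≤ 𝔼 G
𝔼-mono {k} = ∫-mono 0≤½ 0≤½ k

-- Split off one coordinate: the polynomial is P₀ ± P₁, where P₁ has degree one less. Odd powers
-- cancel in the mean of the fourth power, which leaves U + 6Z + V. Cauchy-Schwarz and induction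
-- bound Z by 3 · 9ᵈ · XY, because 9ᵈ⁺¹ · 9ᵈ is the square of 3 · 9ᵈ.
bonami : ∀ {k} d (a : Vec Bool k → ℚ) → Degree≤ d a →
  𝔼 (λ x → sq (sq (poly a x))) ≤ 9ℚ ^ d * sq (normsq a)
bonami {zero} d a h = subst (_≤ 9ℚ ^ d * sq (sq (a []))) (sym (lem (a [])))
  (subst (_≤ 9ℚ ^ d * sq (sq (a []))) (*-identityˡ (sq (sq (a [])))) (*-monoʳ (0≤² (sq (a []))) (1≤9^ d)))
  where
  lem : ∀ u → ((u * 1ℚ) * (u * 1ℚ)) * ((u * 1ℚ) * (u * 1ℚ)) ≡ (u * u) * (u * u)
  lem = solve-∀ ℚ-ring
  1≤9^ : ∀ d → 1ℚ ≤ 9ℚ ^ d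
  1≤9^ zero = ≤-refl
  1≤9^ (suc d) = ≤-trans (from-yes (1ℚ ≤? 9ℚ * 1ℚ)) (*-monoˡ (from-yes (0ℚ ≤? 9ℚ)) (1≤9^ d))
bonami {suc k} d a h = subst (_≤ 9ℚ ^ d * sq (normsq a)) (sym split) (step d h)
  where
  a₀ a₁ P₀ P₁ : Vec Bool k → ℚ
  a₀ = a ∘ (false ∷_)
  a₁ = a ∘ (true ∷_)
  P₀ = poly a₀
  P₁ = poly a₁
  U Z V X Y : ℚ
  U = 𝔼 (λ x → sq (sq (P₀ x)))
  Z = 𝔼 (λ x → sq (P₀ x) * sq (P₁ x))
  V = 𝔼 (λ x → sq (sq (P₁ x)))
  X = normsq a₀
  Y = normsq a₁
  6ℚ : ℚ
  6ℚ = + 6 / 1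
  quartic : ∀ p q → ½ * (((- 1ℚ * p + q) * (- 1ℚ * p + q)) * ((- 1ℚ * p + q) * (- 1ℚ * p + q)))
      + ½ * (((1ℚ * p + q) * (1ℚ * p + q)) * ((1ℚ * p + q) * (1ℚ * p + q)))
      ≡ 1ℚ * ((q * q) * (q * q)) + (+ 6 / 1) * ((q * q) * (p * p)) + 1ℚ * ((p * p) * (p * p))
  quartic = solve-∀ ℚ-ring
  F : Bool → Vec Bool k → ℚ
  F b x = sq (sq (sg b * P₁ x + P₀ x))
  split : 𝔼 (λ x → sq (sq (poly a x))) ≡ 1ℚ * U + 6ℚ * Z + 1ℚ * V
  split = trans (cong₂ (λ u v → ½ * u + ½ * v)
      (∫-cong k (λ x → cong (sq ∘ sq) (poly-∷ a true x))) (∫-cong k (λ x → cong (sq ∘ sq) (poly-∷ a false x))))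
    (trans (sym (trans (∫-+ k (λ x → ½ * F true x) (λ x → ½ * F false x)) (cong₂ _+_ (∫-*ˡ k ½ (F true)) (∫-*ˡ k ½ (F false)))))
    (trans (∫-cong k (λ x → quartic (P₁ x) (P₀ x)))
      (∫-lin₃ k 1ℚ 6ℚ 1ℚ (λ x → sq (sq (P₀ x))) (λ x → sq (P₀ x) * sq (P₁ x)) (λ x → sq (sq (P₁ x))))))
  norm-split : normsq a ≡ Y + X
  norm-split = cong₂ _+_ (*-identityˡ Y) (*-identityˡ X)
  Z²≤ : Z * Z ≤ U * V
  Z²≤ = subst₂ _≤_ (cong sq (∫-cong k (λ x → *-identityˡ (sq (P₀ x) * sq (P₁ x)))))
    (cong₂ _*_ (∫-cong k (λ x → *-identityˡ (sq (sq (P₀ x))))) (∫-cong k (λ x → *-identityˡ (sq (sq (P₁ x))))))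
    (cauchy-schwarz 0≤½ 0≤½ k (λ _ → 1ℚ) (λ x → sq (P₀ x)) (λ x → sq (P₁ x)) (λ _ → 0≤1))
  step : ∀ d → Degree≤ d a → 1ℚ * U + 6ℚ * Z + 1ℚ * V ≤ 9ℚ ^ d * sq (normsq a)
  step zero h = subst₂ _≤_ (sym lhs) (cong (λ n → 1ℚ * (n * n)) (sym norm-split))
    (≤-trans (bonami 0 a₀ (λ S → h (false ∷ S))) (*-monoˡ 0≤1 (≤-by {X * X} (Y * Y + (Y * X + X * Y))
      (0≤+ (0≤² Y) (0≤+ (0≤* (0≤normsq a₁) (0≤normsq a₀)) (0≤* (0≤normsq a₀) (0≤normsq a₁)))) (l₂ X Y))))
    where
    P₁≡0 : ∀ x → P₁ x ≡ 0ℚ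
    P₁≡0 x = trans (∫-cong k (λ S → trans (cong (_* χ S x) (h (true ∷ S) (s≤s z≤n))) (*-zeroˡ (χ S x)))) (∫-0 k)
    Z≡0 : Z ≡ 0ℚ
    Z≡0 = trans (∫-cong k (λ x → trans (cong (λ u → sq (P₀ x) * sq u) (P₁≡0 x)) (*-zeroʳ (sq (P₀ x))))) (∫-0 k)
    V≡0 : V ≡ 0ℚ
    V≡0 = trans (∫-cong k (λ x → cong (sq ∘ sq) (P₁≡0 x))) (∫-0 k)
    l₁ : ∀ u → 1ℚ * u + (+ 6 / 1) * 0ℚ + 1ℚ * 0ℚ ≡ u
    l₁ = solve-∀ ℚ-ring
    lhs : 1ℚ * U + 6ℚ * Z + 1ℚ * V ≡ U
    lhs = trans (cong₂ (λ z v → 1ℚ * U + 6ℚ * z + 1ℚ * v) Z≡0 V≡0) (l₁ U)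
    l₂ : ∀ X Y → X * X + (Y * Y + (Y * X + X * Y)) ≡ (Y + X) * (Y + X)
    l₂ = solve-∀ ℚ-ring
  step (suc d) h = subst (1ℚ * U + 6ℚ * Z + 1ℚ * V ≤_) (cong (λ n → 9ℚ ^ suc d * (n * n)) (sym norm-split))
    (≤-trans (+-mono-≤ (+-mono-≤ (*-monoˡ 0≤1 U≤) (*-monoˡ {6ℚ} (from-yes (0ℚ ≤? 6ℚ)) Z≤)) (*-monoˡ 0≤1 V≤))
      (≤-by ((+ 8 / 1) * (n * (Y * Y))) (0≤* (from-yes (0ℚ ≤? (+ 8 / 1))) (0≤* (0≤9^ d) (0≤² Y))) (l₂ n X Y)))
    where
    n = 9ℚ ^ d
    U≤ : U ≤ 9ℚ ^ suc d * sq X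
    U≤ = bonami (suc d) a₀ (λ S → h (false ∷ S))
    V≤ : V ≤ n * sq Y
    V≤ = bonami d a₁ (λ S lt → h (true ∷ S) (s≤s lt))
    l₁ : ∀ n X Y → ((+ 9 / 1) * n * (X * X)) * (n * (Y * Y)) ≡ ((+ 3 / 1) * n * (X * Y)) * ((+ 3 / 1) * n * (X * Y))
    l₁ = solve-∀ ℚ-ring
    Z≤ : Z ≤ (+ 3 / 1) * n * (X * Y)
    Z≤ = ²-cancel-≤ (0≤* (0≤* (from-yes (0ℚ ≤? (+ 3 / 1))) (0≤9^ d)) (0≤* (0≤normsq a₀) (0≤normsq a₁)))
      (≤-trans Z²≤ (subst (U * V ≤_) (l₁ n X Y)
        (*-mono₂ (𝔼-nonneg (λ x → 0≤² (sq (P₀ x)))) (0≤* (0≤9^ d) (0≤² Y)) U≤ V≤)))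
    l₂ : ∀ n X Y → 1ℚ * ((+ 9 / 1) * n * (X * X)) + (+ 6 / 1) * ((+ 3 / 1) * n * (X * Y)) + 1ℚ * (n * (Y * Y)) + (+ 8 / 1) * (n * (Y * Y))
       ≡ (+ 9 / 1) * n * ((Y + X) * (Y + X))
    l₂ = solve-∀ ℚ-ring

cube-∣∣ : ∀ x → ∣ x ∣ * (∣ x ∣ * ∣ x ∣) ≡ ∣ x ∣ * (x * x)
cube-∣∣ x = cong (∣ x ∣ *_) (∣∣²≡² x)

𝔼∣∣²≤ : ∀ {k} (h : Vec Bool k → ℚ) → sq (𝔼 (λ x → ∣ h x ∣)) ≤ 𝔼 (λ x → sq (h x))
𝔼∣∣²≤ {k} h = subst₂ _≤_ (cong sq (∫-cong k (λ x → l₁ ∣ h x ∣)))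
  (trans (cong₂ _*_ (∫-cong k (λ x → trans (*-identityˡ (sq ∣ h x ∣)) (∣∣²≡² (h x)))) (∫-const refl k (1ℚ * (1ℚ * 1ℚ)))) (*-identityʳ (𝔼 (λ x → sq (h x)))))
  (cauchy-schwarz 0≤½ 0≤½ k (λ _ → 1ℚ) (λ x → ∣ h x ∣) (λ _ → 1ℚ) (λ _ → 0≤1))
  where
  l₁ : ∀ u → 1ℚ * (u * 1ℚ) ≡ u
  l₁ = solve-∀ ℚ-ring

-- Interpolating the second moment between the first and the fourth.
L²≤L¹ : ∀ {k} d (a : Vec Bool k → ℚ) → Degree≤ d a → normsq a ≤ 9ℚ ^ d * sq (𝔼 (λ x → ∣ poly a x ∣))
L²≤L¹ {k} d a deg with 0ℚ <? normsq a
... | no ≮ = ≤-trans (≮⇒≥ ≮) (0≤* (0≤9^ d) (0≤² (𝔼 (λ x → ∣ poly a x ∣))))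
... | yes 0<M = *-cancelˡ-≤ 0<M³ (subst₂ _≤_ (l₁ M) (l₂ L (9ℚ ^ d) M) chain)
  where
  P : Vec Bool k → ℚ
  P = poly a
  M L Q T : ℚ
  M = normsq a
  L = 𝔼 (λ x → ∣ P x ∣)
  T = 𝔼 (λ x → ∣ P x ∣ * (P x * P x))
  Q = 𝔼 (λ x → sq (sq (P x)))
  M≡ : 𝔼 (λ x → sq (P x)) ≡ M
  M≡ = parseval a a
  0<M³ : 0ℚ < M * (M * M)
  0<M³ = 0<* 0<M (0<* 0<M 0<M)
  step₁ : M * M ≤ L * T
  step₁ = subst₂ _≤_ (cong sq (trans (∫-cong k (λ x → trans (l₃ ∣ P x ∣) (∣∣²≡² (P x)))) M≡))
    (cong₂ _*_ (∫-cong k (λ x → l₄ ∣ P x ∣)) (∫-cong k (λ x → cube-∣∣ (P x))))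
    (cauchy-schwarz 0≤½ 0≤½ k (λ x → ∣ P x ∣) (λ _ → 1ℚ) (λ x → ∣ P x ∣) (λ x → 0≤∣p∣ (P x)))
    where
    l₃ : ∀ u → u * (1ℚ * u) ≡ u * u
    l₃ = solve-∀ ℚ-ring
    l₄ : ∀ u → u * (1ℚ * 1ℚ) ≡ u
    l₄ = solve-∀ ℚ-ring
  step₂ : T * T ≤ M * Q
  step₂ = subst₂ _≤_ (cong sq (∫-cong k (λ x → *-identityˡ (∣ P x ∣ * (P x * P x)))))
    (cong₂ _*_ (trans (∫-cong k (λ x → trans (*-identityˡ (sq ∣ P x ∣)) (∣∣²≡² (P x)))) M≡) (∫-cong k (λ x → *-identityˡ (sq (sq (P x))))))
    (cauchy-schwarz 0≤½ 0≤½ k (λ _ → 1ℚ) (λ x → ∣ P x ∣) (λ x → P x * P x) (λ _ → 0≤1))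
  -- M⁴ ≤ L²T² ≤ L² · MQ, and Q ≤ 9ᵈM²; cancelling M³ then gives the claim.
  chain : (M * M) * (M * M) ≤ (L * L) * (M * (9ℚ ^ d * (M * M)))
  chain = ≤-trans (*-mono₂ (0≤² M) (≤-trans (0≤² M) step₁) step₁ step₁)
    (≤-trans (≤-reflexive (l₅ L T)) (*-monoˡ (0≤² L) (≤-trans step₂ (*-monoˡ (<⇒≤ 0<M) (bonami d a deg)))))
    where
    l₅ : ∀ L T → (L * T) * (L * T) ≡ (L * L) * (T * T)
    l₅ = solve-∀ ℚ-ring
  l₁ : ∀ M → (M * M) * (M * M) ≡ (M * (M * M)) * M
  l₁ = solve-∀ ℚ-ring
  l₂ : ∀ L n M → (L * L) * (M * (n * (M * M))) ≡ (M * (M * M)) * (n * (L * L))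
  l₂ = solve-∀ ℚ-ring

-- Binary matroids and random cuts

dot : ∀ {m} → Vec Bool m → Vec Bool m → Bool
dot [] [] = false
dot (a ∷ c) (b ∷ κ) = (a ∧ b) xor dot c κ

-- For a graph, κ marks one side of a bipartition of the vertices and the result is the set of
-- crossing edges. As κ varies these sets form the orthogonal complement of the kernel of `comb`.
cut : ∀ {m n} → Vec (Vec Bool m) n → Vec Bool m → Vec Bool n
cut C κ = Vec.map (λ c → dot c κ) C

-- For a graph this is the boundary of S modulo 2, so it vanishes exactly on the cycle space.
comb : ∀ {m n} → Vec Bool n → Vec (Vec Bool m) n → Vec Bool m
comb [] [] = 𝟘
comb (true ∷ S) (c ∷ C) = c ⊕ comb S C
comb (false ∷ S) (c ∷ C) = comb S C

dot-𝟘ˡ : ∀ {m} (κ : Vec Bool m) → dot 𝟘 κ ≡ false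
dot-𝟘ˡ [] = refl
dot-𝟘ˡ (b ∷ κ) = dot-𝟘ˡ κ

dot-𝟘ʳ : ∀ {m} (c : Vec Bool m) → dot c 𝟘 ≡ false
dot-𝟘ʳ [] = refl
dot-𝟘ʳ (true ∷ c) = dot-𝟘ʳ c
dot-𝟘ʳ (false ∷ c) = dot-𝟘ʳ c

dot-⊕ : ∀ {m} (c v κ : Vec Bool m) → dot (c ⊕ v) κ ≡ dot c κ xor dot v κ
dot-⊕ [] [] [] = refl
dot-⊕ (a ∷ c) (b ∷ v) (x ∷ κ) = trans (cong (((a xor b) ∧ x) xor_) (dot-⊕ c v κ)) (bits a b x (dot c κ) (dot v κ))
  where
  bits : ∀ a b x s t → ((a xor b) ∧ x) xor (s xor t) ≡ ((a ∧ x) xor s) xor ((b ∧ x) xor t)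
  bits true true true true t = refl
  bits true true true false true = refl
  bits true true true false false = refl
  bits true true false true t = refl
  bits true true false false t = refl
  bits true false x s t = sym (xor-assoc x s t)
  bits false true true true true = refl
  bits false true true true false = refl
  bits false true true false t = refl
  bits false true false s t = refl
  bits false false x s t = refl

sg-dot : ∀ {m} (c κ : Vec Bool m) → sg (dot c κ) ≡ χ c κ
sg-dot [] [] = refl
sg-dot (a ∷ c) (b ∷ κ) = trans (sg-xor (a ∧ b) (dot c κ)) (cong (sg (a ∧ b) *_) (sg-dot c κ))

χ-cut : ∀ {m n} (S : Vec Bool n) (C : Vec (Vec Bool m) n) κ → χ S (cut C κ) ≡ χ (comb S C) κ
χ-cut [] [] κ = sym (χ-𝟘ˡ κ)
χ-cut (true ∷ S) (c ∷ C) κ = trans (cong₂ _*_ (sg-dot c κ) (χ-cut S C κ)) (sym (χ-⊕ˡ c (comb S C) κ))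
χ-cut (false ∷ S) (c ∷ C) κ = trans (*-identityˡ (χ S (cut C κ))) (χ-cut S C κ)

dot-comb : ∀ {m n} (D : Vec Bool n) (I : Vec (Vec Bool m) n) κ → dot (comb D I) κ ≡ dot D (cut I κ)
dot-comb [] [] κ = dot-𝟘ˡ κ
dot-comb (true ∷ D) (c ∷ I) κ = trans (dot-⊕ c (comb D I) κ) (cong (dot c κ xor_) (dot-comb D I κ))
dot-comb (false ∷ D) (c ∷ I) κ = dot-comb D I κ

comb-𝟘 : ∀ {m n} (C : Vec (Vec Bool m) n) → comb 𝟘 C ≡ 𝟘
comb-𝟘 [] = refl
comb-𝟘 (c ∷ C) = comb-𝟘 C

comb-⊕ : ∀ {m n} (S T : Vec Bool n) (C : Vec (Vec Bool m) n) → comb (S ⊕ T) C ≡ comb S C ⊕ comb T C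
comb-⊕ [] [] [] = sym (⊕-identityˡ 𝟘)
comb-⊕ (true ∷ S) (true ∷ T) (c ∷ C) = trans (comb-⊕ S T C) (sym (trans (⊕-assoc c (comb S C) (c ⊕ comb T C))
  (trans (cong (c ⊕_) (trans (sym (⊕-assoc (comb S C) c (comb T C))) (trans (cong (_⊕ comb T C) (⊕-comm (comb S C) c)) (⊕-assoc c (comb S C) (comb T C)))))
    (⊕-cancel c (comb S C ⊕ comb T C)))))
comb-⊕ (true ∷ S) (false ∷ T) (c ∷ C) = trans (cong (c ⊕_) (comb-⊕ S T C)) (sym (⊕-assoc c (comb S C) (comb T C)))
comb-⊕ (false ∷ S) (true ∷ T) (c ∷ C) = trans (cong (c ⊕_) (comb-⊕ S T C)) (trans (sym (⊕-assoc c (comb S C) (comb T C)))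
  (trans (cong (_⊕ comb T C) (⊕-comm c (comb S C))) (⊕-assoc (comb S C) c (comb T C))))
comb-⊕ (false ∷ S) (false ∷ T) (c ∷ C) = comb-⊕ S T C

unit : ∀ {k} → Fin k → Vec Bool k
unit zero = true ∷ 𝟘
unit (suc i) = false ∷ unit i

wt-𝟘 : ∀ k → wt (𝟘 {k}) ≡ 0
wt-𝟘 zero = refl
wt-𝟘 (suc k) = wt-𝟘 k

wt-unit : ∀ {k} (i : Fin k) → wt (unit i) ≡ 1
wt-unit {suc k} zero = cong suc (wt-𝟘 k)
wt-unit (suc i) = wt-unit i

wt≡0⇒𝟘 : ∀ {k} (S : Vec Bool k) → wt S ≡ 0 → S ≡ 𝟘
wt≡0⇒𝟘 [] h = refl
wt≡0⇒𝟘 (false ∷ S) h = cong (false ∷_) (wt≡0⇒𝟘 S h)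

wt≡1⇒unit : ∀ {k} (S : Vec Bool k) → wt S ≡ 1 → ∃ λ i → S ≡ unit i
wt≡1⇒unit (true ∷ S) h = zero , cong (true ∷_) (wt≡0⇒𝟘 S (ℕₚ.suc-injective h))
wt≡1⇒unit (false ∷ S) h with wt≡1⇒unit S h
... | i , eq = suc i , cong (false ∷_) eq

comb-unit : ∀ {m n} (i : Fin n) (C : Vec (Vec Bool m) n) → comb (unit i) C ≡ lookup C i
comb-unit zero (c ∷ C) = trans (cong (c ⊕_) (comb-𝟘 C)) (⊕-identityʳ c)
comb-unit (suc i) (c ∷ C) = comb-unit i C

-- `Simple` excludes loops and parallel pairs: a nonempty set with zero sum has at least three
-- elements. This is all that the spectral bound uses of the complete graph.
Independent Simple : ∀ {m n} → Vec (Vec Bool m) n → Set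
Independent I = ∀ D → comb D I ≡ 𝟘 → D ≡ 𝟘
Simple C = ∀ S → wt S ℕ.≤ 2 → comb S C ≡ 𝟘 → S ≡ 𝟘

isZero-cong : ∀ {m n} {x : Vec Bool m} {y : Vec Bool n} → (x ≡ 𝟘 → y ≡ 𝟘) → (y ≡ 𝟘 → x ≡ 𝟘) → isZero x ≡ isZero y
isZero-cong {m} {n} {x} {y} f g with isZero x in p | isZero y in q
... | true | true = refl
... | false | false = refl
... | true | false = ⊥-elim (t≢f (trans (sym (isZero-𝟘 n)) (trans (cong isZero (sym (f (isZero⇒≡ x p)))) q)))
... | false | true = ⊥-elim (t≢f (trans (sym (isZero-𝟘 m)) (trans (cong isZero (sym (g (isZero⇒≡ y q)))) p)))

-- A random cut is uniform on an independent set. In the character expansion of ψ, independence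
-- makes `χ D (cut I κ)` a nontrivial character of κ unless D is empty, so each term has the same
-- mean on both sides.
𝔼-cut : ∀ {m r} (I : Vec (Vec Bool m) r) → Independent I → ∀ ψ → 𝔼 (λ κ → ψ (cut I κ)) ≡ 𝔼 ψ
𝔼-cut {m} {r} I ind ψ = begin
  𝔼 (λ κ → ψ (cut I κ))
    ≡⟨ ∫-cong m (λ κ → sym (poly-hat ψ (cut I κ))) ⟩
  𝔼 (λ κ → poly (hat ψ) (cut I κ))
    ≡⟨ ∫-swap m r (λ κ D → hat ψ D * χ D (cut I κ)) ⟩
  Sum (λ D → 𝔼 (λ κ → hat ψ D * χ D (cut I κ)))
    ≡⟨ ∫-cong r (λ D → trans (∫-*ˡ m (hat ψ D) (λ κ → χ D (cut I κ))) (trans (cong (hat ψ D *_) (eq D)) (sym (∫-*ˡ r (hat ψ D) (χ D))))) ⟩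
  Sum (λ D → 𝔼 (λ y → hat ψ D * χ D y))
    ≡⟨ sym (∫-swap r r (λ y D → hat ψ D * χ D y)) ⟩
  𝔼 (poly (hat ψ))
    ≡⟨ ∫-cong r (poly-hat ψ) ⟩
  𝔼 ψ ∎
  where
  open ≡-Reasoning
  eq : ∀ D → 𝔼 (λ κ → χ D (cut I κ)) ≡ 𝔼 (χ D)
  eq D = trans (∫-cong m (χ-cut D I)) (trans (𝔼-χ (comb D I)) (trans (cong ⟦_⟧ (isZero-cong (ind D) (λ { refl → comb-𝟘 I }))) (sym (𝔼-χ D))))

bit : Bool → ℕ
bit true = 1
bit false = 0

sumN : ∀ {k} → (Vec Bool k → ℕ) → ℕ
sumN {zero} F = F []
sumN {suc k} F = sumN (F ∘ (true ∷_)) ℕ.+ sumN (F ∘ (false ∷_))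

sumN-cong : ∀ {k} {F G : Vec Bool k → ℕ} → (∀ x → F x ≡ G x) → sumN F ≡ sumN G
sumN-cong {zero} h = h []
sumN-cong {suc k} h = cong₂ ℕ._+_ (sumN-cong (λ x → h (true ∷ x))) (sumN-cong (λ x → h (false ∷ x)))

sumN-+ : ∀ {k} (F G : Vec Bool k → ℕ) → sumN (λ x → F x ℕ.+ G x) ≡ sumN F ℕ.+ sumN G
sumN-+ {zero} F G = refl
sumN-+ {suc k} F G = trans (cong₂ ℕ._+_ (sumN-+ (F ∘ (true ∷_)) (G ∘ (true ∷_))) (sumN-+ (F ∘ (false ∷_)) (G ∘ (false ∷_))))
  (lem (sumN (F ∘ (true ∷_))) (sumN (G ∘ (true ∷_))) (sumN (F ∘ (false ∷_))) (sumN (G ∘ (false ∷_))))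
  where
  lem : ∀ a b c d → (a ℕ.+ b) ℕ.+ (c ℕ.+ d) ≡ (a ℕ.+ c) ℕ.+ (b ℕ.+ d)
  lem a b c d = trans (ℕₚ.+-assoc a b (c ℕ.+ d)) (trans (cong (a ℕ.+_) (trans (sym (ℕₚ.+-assoc b c d))
    (trans (cong (ℕ._+ d) (ℕₚ.+-comm b c)) (ℕₚ.+-assoc c b d)))) (sym (ℕₚ.+-assoc a c (b ℕ.+ d))))

sumN-0 : ∀ k → sumN {k} (λ _ → 0) ≡ 0
sumN-0 zero = refl
sumN-0 (suc k) = cong₂ ℕ._+_ (sumN-0 k) (sumN-0 k)

term≤sumN : ∀ {k} (F : Vec Bool k → ℕ) x → F x ℕ.≤ sumN F
term≤sumN F [] = ℕₚ.≤-refl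
term≤sumN F (true ∷ x) = ℕₚ.≤-trans (term≤sumN (F ∘ (true ∷_)) x) (ℕₚ.m≤m+n _ _)
term≤sumN F (false ∷ x) = ℕₚ.≤-trans (term≤sumN (F ∘ (false ∷_)) x) (ℕₚ.m≤n+m _ _)

two-terms≤sumN : ∀ {k} (F : Vec Bool k → ℕ) x y → x ≢ y → F x ℕ.+ F y ℕ.≤ sumN F
two-terms≤sumN F [] [] x≢y = ⊥-elim (x≢y refl)
two-terms≤sumN F (true ∷ x) (true ∷ y) x≢y = ℕₚ.≤-trans (two-terms≤sumN (F ∘ (true ∷_)) x y (λ e → x≢y (cong (true ∷_) e))) (ℕₚ.m≤m+n _ _)
two-terms≤sumN F (true ∷ x) (false ∷ y) x≢y = ℕₚ.+-mono-≤ (term≤sumN (F ∘ (true ∷_)) x) (term≤sumN (F ∘ (false ∷_)) y)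
two-terms≤sumN F (false ∷ x) (true ∷ y) x≢y = subst (ℕ._≤ sumN F) (ℕₚ.+-comm (F (true ∷ y)) (F (false ∷ x)))
  (ℕₚ.+-mono-≤ (term≤sumN (F ∘ (true ∷_)) y) (term≤sumN (F ∘ (false ∷_)) x))
two-terms≤sumN F (false ∷ x) (false ∷ y) x≢y = ℕₚ.≤-trans (two-terms≤sumN (F ∘ (false ∷_)) x y (λ e → x≢y (cong (false ∷_) e))) (ℕₚ.m≤n+m _ _)

eqv : ∀ {k} → Vec Bool k → Vec Bool k → Bool
eqv x y = isZero (x ⊕ y)

eqv⇒≡ : ∀ {k} (x y : Vec Bool k) → eqv x y ≡ true → x ≡ y
eqv⇒≡ x y h = ⊕-zero⇒≡ (isZero⇒≡ (x ⊕ y) h)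

eqv-refl : ∀ {k} (x : Vec Bool k) → eqv x x ≡ true
eqv-refl {k} x = trans (cong isZero (⊕-self x)) (isZero-𝟘 k)

sumN-point : ∀ {k} (Q : Vec Bool k → Bool) D → sumN (λ x → bit (eqv x D ∧ Q x)) ≡ bit (Q D)
sumN-point Q [] = refl
sumN-point {suc k} Q (true ∷ D) = trans (cong₂ ℕ._+_ (sumN-point (Q ∘ (true ∷_)) D) (sumN-0 k)) (ℕₚ.+-identityʳ _)
sumN-point {suc k} Q (false ∷ D) = cong₂ ℕ._+_ (sumN-0 k) (sumN-point (Q ∘ (false ∷_)) D)

search : ∀ {k} (P : Vec Bool k → Bool) → (∃ λ x → P x ≡ true) ⊎ (∀ x → P x ≡ false)
search {zero} P with P [] in eq
... | true = inj₁ ([] , eq)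
... | false = inj₂ (λ { [] → eq })
search {suc k} P with search (P ∘ (true ∷_)) | search (P ∘ (false ∷_))
... | inj₁ (x , h) | _ = inj₁ (true ∷ x , h)
... | inj₂ _ | inj₁ (x , h) = inj₁ (false ∷ x , h)
... | inj₂ g | inj₂ h = inj₂ (λ { (true ∷ x) → g x ; (false ∷ x) → h x })

count : ∀ {m n} → (Vec Bool m → Bool) → Vec Bool n → Vec (Vec Bool m) n → ℕ
count P [] [] = 0
count P (s ∷ S) (c ∷ C) = bit (s ∧ P c) ℕ.+ count P S C

count-pos : ∀ {m n} (P : Vec Bool m → Bool) (S : Vec Bool n) C → 1 ℕ.≤ count P S C → ∃ λ i → P (lookup C i) ≡ true
count-pos P [] [] ()
count-pos P (s ∷ S) (c ∷ C) h with s | P c in eq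
... | true | true = zero , eq
... | true | false with count-pos P S C h
... | i , e = suc i , e
count-pos P (s ∷ S) (c ∷ C) h | false | _ with count-pos P S C h
... | i , e = suc i , e

-- A basis I of the columns selected by S; M is the set of coordinate vectors of these columns.
record Basis {m n} (S : Vec Bool n) (C : Vec (Vec Bool m) n) : Set where
  constructor basis
  field
    rank : ℕ
    I : Vec (Vec Bool m) rank
    M : Vec Bool rank → Bool
    indep : Independent I
    M-𝟘 : M 𝟘 ≡ false
    M-unit : ∀ i → M (unit i) ≡ true
    counts : ∀ P → count P S C ≡ sumN (λ D → bit (M D ∧ P (comb D I)))

-- Greedy, one column at a time: a column outside the span of I joins the basis, one inside it only
-- adds its coordinates to M. `Simple` is what allows M to be a set without zero instead of a
-- multiset.
find-basis : ∀ {m n} (S : Vec Bool n) (C : Vec (Vec Bool m) n) → Simple C → Basis S C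
find-basis [] [] simp = basis 0 [] (λ _ → false) (λ { [] _ → refl }) refl (λ ()) (λ P → refl)
find-basis (false ∷ S) (c ∷ C) simp with find-basis S C (λ T le e → cong Vec.tail (simp (false ∷ T) le e))
... | basis r I M ind M0 Mu cs = basis r I M ind M0 Mu cs
find-basis {m} {suc n} (true ∷ S) (c ∷ C) simp with find-basis S C (λ T le e → cong Vec.tail (simp (false ∷ T) le e))
... | basis r I M ind M0 Mu cs with search (λ D → eqv (comb D I) c)
... | inj₂ none = basis (suc r) (c ∷ I) M′ ind′ M0 Mu′ cs′
  where
  M′ : Vec Bool (suc r) → Bool
  M′ (true ∷ D) = isZero D
  M′ (false ∷ D) = M D
  ind′ : Independent (c ∷ I)
  ind′ (true ∷ D) e = ⊥-elim (t≢f (trans (sym (eqv-refl c)) (trans (cong (λ z → eqv z c) (⊕-zero⇒≡ {x = c} {comb D I} e)) (none D))))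
  ind′ (false ∷ D) e = cong (false ∷_) (ind D e)
  Mu′ : ∀ i → M′ (unit i) ≡ true
  Mu′ zero = isZero-𝟘 r
  Mu′ (suc i) = Mu i
  cs′ : ∀ P → count P (true ∷ S) (c ∷ C) ≡ sumN (λ D → bit (M′ D ∧ P (comb D (c ∷ I))))
  cs′ P = cong₂ ℕ._+_ (sym (trans (sumN-cong {r} (λ D → cong (λ z → bit (z ∧ P (c ⊕ comb D I))) (cong isZero (sym (⊕-identityʳ D)))))
      (trans (sumN-point (λ D → P (c ⊕ comb D I)) 𝟘) (cong (bit ∘ P) (trans (cong (c ⊕_) (comb-𝟘 I)) (⊕-identityʳ c)))))) (cs P)
... | inj₁ (D₀ , found) = basis r I M′ ind M0′ (λ i → cong (_∨ eqv (unit i) D₀) (Mu i)) cs′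
  where
  D₀≡c : comb D₀ I ≡ c
  D₀≡c = eqv⇒≡ (comb D₀ I) c found
  M′ : Vec Bool r → Bool
  M′ D = M D ∨ eqv D D₀
  contra : ∀ {k} {x : Vec Bool k} → true ∷ x ≡ 𝟘 → ⊥
  contra ()
  -- A zero column would be a dependency of weight one.
  M0′ : M 𝟘 ∨ eqv 𝟘 D₀ ≡ false
  M0′ rewrite M0 with eqv 𝟘 D₀ in e
  ... | false = refl
  ... | true = ⊥-elim (contra (simp (true ∷ 𝟘) (s≤s (subst (ℕ._≤ 1) (sym (wt-𝟘 n)) z≤n))
      (trans (cong (c ⊕_) (comb-𝟘 C)) (trans (⊕-identityʳ c) (trans (sym D₀≡c) (trans (cong (λ D → comb D I) (sym (eqv⇒≡ 𝟘 D₀ e))) (comb-𝟘 I)))))))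
  -- If these coordinates were already recorded, `counts` would produce another column equal to c, a
  -- dependency of weight two.
  fresh : M D₀ ≡ false
  fresh with M D₀ in e
  ... | false = refl
  ... | true = ⊥-elim (contra (simp (true ∷ unit i) (subst (λ z → suc z ℕ.≤ 2) (sym (wt-unit i)) ℕₚ.≤-refl)
        (trans (cong (c ⊕_) (trans (comb-unit i C) (sym (eqv⇒≡ c (lookup C i) ci)))) (⊕-self c))))
    where
    pos : 1 ℕ.≤ count (eqv c) S C
    pos = subst (1 ℕ.≤_) (sym (cs (eqv c))) (subst (ℕ._≤ sumN (λ D → bit (M D ∧ eqv c (comb D I))))
      (cong bit (trans (cong₂ _∧_ e (trans (cong (eqv c) D₀≡c) (eqv-refl c))) refl)) (term≤sumN (λ D → bit (M D ∧ eqv c (comb D I))) D₀))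
    i = proj₁ (count-pos (eqv c) S C pos)
    ci = proj₂ (count-pos (eqv c) S C pos)
  cs′ : ∀ P → count P (true ∷ S) (c ∷ C) ≡ sumN (λ D → bit (M′ D ∧ P (comb D I)))
  cs′ P = trans (cong₂ ℕ._+_ (trans (cong (bit ∘ P) (sym D₀≡c)) (sym (sumN-point (λ D → P (comb D I)) D₀))) (cs P))
    (trans (sym (sumN-+ (λ D → bit (eqv D D₀ ∧ P (comb D I))) (λ D → bit (M D ∧ P (comb D I))))) (sumN-cong pointwise))
    where
    pointwise : ∀ D → bit (eqv D D₀ ∧ P (comb D I)) ℕ.+ bit (M D ∧ P (comb D I)) ≡ bit (M′ D ∧ P (comb D I))
    pointwise D with M D in p | eqv D D₀ in q
    ... | true | true = ⊥-elim (t≢f (trans (sym p) (trans (cong M (eqv⇒≡ D D₀ q)) fresh)))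
    ... | true | false = refl
    ... | false | true = ℕₚ.+-identityʳ _
    ... | false | false = refl

-- The spectrum

odd : ℕ → Bool
odd zero = false
odd (suc n) = not (odd n)

sgn-wt : ∀ {k} (S : Vec Bool k) → sgn S ≡ sg (odd (wt S))
sgn-wt [] = refl
sgn-wt (true ∷ S) = trans (cong (- 1ℚ *_) (sgn-wt S)) (flip (odd (wt S)))
  where
  flip : ∀ b → - 1ℚ * sg b ≡ sg (not b)
  flip true = refl
  flip false = refl
sgn-wt (false ∷ S) = trans (*-identityˡ (sgn S)) (sgn-wt S)

-- The value of ψ when |S ∩ K| = i and |S ∩ K ∩ K′| = j, for a second random cut K′.  The values at
-- i ≤ 2 are forced by making edges, pairs and triangles tight at λmin.  The value at i = 3 makes
-- forests with four edges and K₄ minus an edge tight as well; there S ∩ K of size four is a forest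
-- and a four-cycle, with mean 1 - 12/16 > 0 and 1 - 12/8 < 0 over K′, which opens the gap.
G : ℕ → ℕ → ℚ
G 0 _ = + 1792 / 1
G 1 _ = - (+ 1280 / 1)
G 2 _ = - (+ 256 / 1)
G 3 _ = + 192 / 1
G 4 0 = - (+ 11 / 1)
G 4 (suc _) = 1ℚ
G _ _ = 0ℚ

-- The gap is attained by forests with four edges: beyond -256 they gain the probability 1/16 that
-- all four edges are cut, times the mean 1 - 12/16 of the values at size four.
λmin gap : ℚ
λmin = - (+ 256 / 1)
gap = + 1 / 64

module _ {m n} (C : Vec (Vec Bool m) n) where

  -- Averaging over the second cut inside `φ` leaves a function of X = S ∩ K alone, the only kind to
  -- which the vanishing identity for agreeing families applies.
  φ : Vec Bool n → ℚ
  φ X = 𝔼 (λ κ′ → G (wt X) (wt (X ∩ cut C κ′)))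

  V : Vec Bool n → ℚ
  V S = 𝔼 (λ κ → φ (S ∩ cut C κ))

  isTriangle good : Vec Bool n → Bool
  isTriangle S = (wt S ≡ᵇ 3) ∧ isZero (comb S C)
  good S = (wt S ≤ᵇ 2) ∨ isTriangle S

wt-∩ : ∀ {m n} (S : Vec Bool n) (C : Vec (Vec Bool m) n) κ → wt (S ∩ cut C κ) ≡ count (λ c → dot c κ) S C
wt-∩ [] [] κ = refl
wt-∩ (s ∷ S) (c ∷ C) κ with s ∧ dot c κ
... | true = cong suc (wt-∩ S C κ)
... | false = wt-∩ S C κ

wt-∩∩ : ∀ {m n} (S : Vec Bool n) (C : Vec (Vec Bool m) n) κ κ′ →
  wt (S ∩ cut C κ ∩ cut C κ′) ≡ count (λ c → dot c κ ∧ dot c κ′) S C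
wt-∩∩ [] [] κ κ′ = refl
wt-∩∩ (s ∷ S) (c ∷ C) κ κ′ rewrite ∧-assoc s (dot c κ) (dot c κ′) with s ∧ (dot c κ ∧ dot c κ′)
... | true = cong suc (wt-∩∩ S C κ κ′)
... | false = wt-∩∩ S C κ κ′

wt-count : ∀ {m n} (S : Vec Bool n) (C : Vec (Vec Bool m) n) → wt S ≡ count (λ _ → true) S C
wt-count [] [] = refl
wt-count (true ∷ S) (c ∷ C) = cong suc (wt-count S C)
wt-count (false ∷ S) (c ∷ C) = wt-count S C

size₀ : ∀ {r} → (Vec Bool r → Bool) → ℕ
size₀ M = sumN (λ D → bit (M D ∧ true))

W : ∀ {r} → (Vec Bool r → Bool) → Vec Bool r → ℕ
W M y = sumN (λ D → bit (M D ∧ dot D y))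

W₂ : ∀ {r} → (Vec Bool r → Bool) → Vec Bool r → Vec Bool r → ℕ
W₂ M y y′ = sumN (λ D → bit (M D ∧ (dot D y ∧ dot D y′)))

opaque
  -- `val M` is `V C S` in the coordinates of a basis, where the two cuts become independent uniform
  -- vectors. It depends on S only through M, so bounded rank leaves finitely many values.
  val score : ∀ {r} → (Vec Bool r → Bool) → ℚ
  val M = 𝔼 (λ y → 𝔼 (λ y′ → G (W M y) (W₂ M y y′)))
  score M = sg (odd (size₀ M)) * val M

  score-cong : ∀ {r} {M M′ : Vec Bool r → Bool} → (∀ D → M D ≡ M′ D) → score M ≡ score M′
  score-cong {r} h = cong₂ _*_ (cong (sg ∘ odd) (sumN-cong (λ D → cong (λ z → bit (z ∧ true)) (h D))))
    (∫-cong r (λ y → ∫-cong r (λ y′ → cong₂ G (sumN-cong (λ D → cong (λ z → bit (z ∧ dot D y)) (h D)))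
      (sumN-cong (λ D → cong (λ z → bit (z ∧ (dot D y ∧ dot D y′))) (h D))))))

  score-even : ∀ {r} (M : Vec Bool r → Bool) → odd (size₀ M) ≡ false → score M ≡ val M
  score-even M e = trans (cong (λ z → sg z * val M) e) (*-identityˡ (val M))

module _ {m n} {S : Vec Bool n} {C : Vec (Vec Bool m) n} (b : Basis S C) where
  open Basis b

  wt≡W : ∀ κ → wt (S ∩ cut C κ) ≡ W M (cut I κ)
  wt≡W κ = trans (wt-∩ S C κ) (trans (counts (λ c → dot c κ)) (sumN-cong (λ D → cong (λ z → bit (M D ∧ z)) (dot-comb D I κ))))

  wt≡size : wt S ≡ size₀ M
  wt≡size = trans (wt-count S C) (counts (λ _ → true))

  opaque
    unfolding val score
    V≡val : V C S ≡ val M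
    V≡val = trans (∫-cong m (λ κ → trans (∫-cong m (λ κ′ → cong₂ G (wt≡W κ)
          (trans (wt-∩∩ S C κ κ′) (trans (counts (λ c → dot c κ ∧ dot c κ′))
            (sumN-cong (λ D → cong (λ z → bit (M D ∧ z)) (cong₂ _∧_ (dot-comb D I κ) (dot-comb D I κ′))))))))
        (𝔼-cut I indep (λ y′ → G (W M (cut I κ)) (W₂ M (cut I κ) y′)))))
      (𝔼-cut I indep (λ y → 𝔼 (λ y′ → G (W M y) (W₂ M y y′))))

    score≡ : sgn S * V C S ≡ score M
    score≡ = cong₂ _*_ (trans (sgn-wt S) (cong (sg ∘ odd) wt≡size)) V≡val

-- `ĉ l` bounds G from below at all sizes at least l, for l ≥ 1. The entry 1792 at l = 0 is
-- legitimate only where l = 0 forces S ∩ K to be empty; `ĉ₀` does without that knowledge and has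
-- the overall minimum -1280 there.
ĉ ĉ₀ : ℕ → ℚ
ĉ 0 = + 1792 / 1
ĉ 1 = - (+ 1280 / 1)
ĉ 2 = - (+ 256 / 1)
ĉ _ = - (+ 11 / 1)
ĉ₀ 0 = - (+ 1280 / 1)
ĉ₀ (suc l) = ĉ (suc l)

G≥ĉ : ∀ i j l → suc l ℕ.≤ i → ĉ (suc l) ≤ G i j
G≥ĉ 1 j zero h = ≤-refl
G≥ĉ 1 j (suc l) (s≤s ())
G≥ĉ 2 j zero h = decide≤
G≥ĉ 2 j (suc zero) h = ≤-refl
G≥ĉ 2 j (suc (suc l)) (s≤s (s≤s ()))
G≥ĉ 3 j zero h = decide≤
G≥ĉ 3 j (suc zero) h = decide≤
G≥ĉ 3 j (suc (suc l)) h = decide≤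
G≥ĉ 4 zero zero h = decide≤
G≥ĉ 4 zero (suc zero) h = decide≤
G≥ĉ 4 zero (suc (suc l)) h = ≤-refl
G≥ĉ 4 (suc j) zero h = decide≤
G≥ĉ 4 (suc j) (suc zero) h = decide≤
G≥ĉ 4 (suc j) (suc (suc l)) h = decide≤
G≥ĉ (suc (suc (suc (suc (suc i))))) j zero h = decide≤
G≥ĉ (suc (suc (suc (suc (suc i))))) j (suc zero) h = decide≤
G≥ĉ (suc (suc (suc (suc (suc i))))) j (suc (suc l)) h = decide≤

G≥ĉ′ : ∀ i j l → l ℕ.≤ i → (l ≡ 0 → i ≡ 0) → ĉ l ≤ G i j
G≥ĉ′ i j zero h z with i | z refl
... | _ | refl = ≤-refl
G≥ĉ′ i j (suc l) h z = G≥ĉ i j l h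

G≥ĉ₀ : ∀ i j l → l ℕ.≤ i → ĉ₀ l ≤ G i j
G≥ĉ₀ zero j zero h = decide≤
G≥ĉ₀ (suc i) j zero h = G≥ĉ (suc i) j 0 (s≤s z≤n)
G≥ĉ₀ i j (suc l) h = G≥ĉ i j l h

-- For odd |S| the sign asks for an upper bound on `V C S`. Away from size 0 and odd sizes G is at
-- most 1; the excesses of 1792 and 192 over 1 are 1791 and 191.
G≤ : ∀ i j → G i j ≤ 1ℚ + ((+ 1791 / 1) * ⟦ i ≡ᵇ 0 ⟧ + (+ 191 / 1) * ⟦ odd i ⟧)
G≤ 0 j = decide≤
G≤ 1 j = decide≤
G≤ 2 j = decide≤
G≤ 3 j = decide≤
G≤ 4 zero = decide≤
G≤ 4 (suc j) = decide≤
G≤ (suc (suc (suc (suc (suc i))))) j with odd (suc (suc (suc (suc (suc i)))))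
... | true = decide≤
... | false = decide≤

≤W : ∀ {r} (M : Vec Bool r → Bool) → (∀ i → M (unit i) ≡ true) → ∀ y → wt y ℕ.≤ W M y
≤W M Mu [] = z≤n
≤W {suc r} M Mu (b ∷ y) = subst (ℕ._≤ W M (b ∷ y)) (wt-∷ b) (ℕₚ.+-mono-≤ first (≤W (M ∘ (false ∷_)) (λ i → Mu (suc i)) y))
  where
  wt-∷ : ∀ b → bit b ℕ.+ wt y ≡ wt (b ∷ y)
  wt-∷ true = refl
  wt-∷ false = refl
  first : bit b ℕ.≤ sumN (λ D → bit (M (true ∷ D) ∧ (b xor dot D y)))
  first = subst (ℕ._≤ sumN (λ D → bit (M (true ∷ D) ∧ (b xor dot D y))))
    (cong bit (trans (cong₂ (λ u v → u ∧ (b xor v)) (Mu zero) (dot-𝟘ˡ y)) (xor-identityʳ b)))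
    (term≤sumN (λ D → bit (M (true ∷ D) ∧ (b xor dot D y))) 𝟘)

-- The recursion descends to the first coordinate set in D. There D has a further coordinate, so it
-- differs from the basis vector and both are counted; `≤W` covers the remaining coordinates.
≤W′ : ∀ {r} (M : Vec Bool r → Bool) → (∀ i → M (unit i) ≡ true) → ∀ D → M D ≡ true → 2 ℕ.≤ wt D →
  ∀ y → wt y ℕ.+ bit (dot D y) ℕ.≤ W M y
≤W′ M Mu [] MD () y
≤W′ {suc r} M Mu (false ∷ D) MD le (b ∷ y) = subst (ℕ._≤ W M (b ∷ y)) (wt-∷ b) (ℕₚ.+-mono-≤ first (≤W′ (M ∘ (false ∷_)) (λ i → Mu (suc i)) D MD le y))
  where
  wt-∷ : ∀ b → bit b ℕ.+ (wt y ℕ.+ bit (dot D y)) ≡ wt (b ∷ y) ℕ.+ bit (dot D y)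
  wt-∷ true = refl
  wt-∷ false = refl
  first : bit b ℕ.≤ sumN (λ D → bit (M (true ∷ D) ∧ (b xor dot D y)))
  first = subst (ℕ._≤ sumN (λ D → bit (M (true ∷ D) ∧ (b xor dot D y))))
    (cong bit (trans (cong₂ (λ u v → u ∧ (b xor v)) (Mu zero) (dot-𝟘ˡ y)) (xor-identityʳ b)))
    (term≤sumN (λ D → bit (M (true ∷ D) ∧ (b xor dot D y))) 𝟘)
≤W′ {suc r} M Mu (true ∷ D) MD (s≤s le) (b ∷ y) = subst (ℕ._≤ W M (b ∷ y)) (wt-∷ b (bit (b xor dot D y)))
    (ℕₚ.+-mono-≤ first (≤W (M ∘ (false ∷_)) (λ i → Mu (suc i)) y))
  where
  wt-∷ : ∀ b d → (bit b ℕ.+ d) ℕ.+ wt y ≡ wt (b ∷ y) ℕ.+ d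
  wt-∷ true d = cong suc (ℕₚ.+-comm d (wt y))
  wt-∷ false d = ℕₚ.+-comm d (wt y)
  ≢ : 𝟘 ≢ D
  ≢ refl = ℕₚ.1+n≰n (subst (1 ℕ.≤_) (wt-𝟘 r) le)
  first : bit b ℕ.+ bit (b xor dot D y) ℕ.≤ sumN (λ D → bit (M (true ∷ D) ∧ (b xor dot D y)))
  first = subst (ℕ._≤ sumN (λ D → bit (M (true ∷ D) ∧ (b xor dot D y))))
    (cong₂ (λ u v → bit u ℕ.+ bit v) (trans (cong₂ (λ u v → u ∧ (b xor v)) (Mu zero) (dot-𝟘ˡ y)) (xor-identityʳ b)) (cong (_∧ (b xor dot D y)) MD))
    (two-terms≤sumN (λ D → bit (M (true ∷ D) ∧ (b xor dot D y))) 𝟘 D ≢)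

W-𝟘 : ∀ {r} (M : Vec Bool r → Bool) → W M 𝟘 ≡ 0
W-𝟘 {r} M = trans (sumN-cong (λ D → cong bit (trans (cong (M D ∧_) (dot-𝟘ʳ D)) (∧-zeroʳ (M D))))) (sumN-0 r)

-- A copy of 𝔼 that the type checker does not unfold to 2ʳ terms.
opaque
  𝔼° : ∀ {r} → (Vec Bool r → ℚ) → ℚ
  𝔼° = 𝔼

opaque
  unfolding val 𝔼°

  val≥ : ∀ {r} (M : Vec Bool r → Bool) (l : Vec Bool r → ℚ) → (∀ y j → l y ≤ G (W M y) j) → 𝔼° l ≤ val M
  val≥ {r} M l h = 𝔼-mono (λ y → subst (_≤ 𝔼 (λ y′ → G (W M y) (W₂ M y y′))) (∫-const refl r (l y)) (𝔼-mono (λ y′ → h y (W₂ M y y′))))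

pre : ∀ m {n} → Vec Bool (m ℕ.+ n) → Vec Bool m
pre zero x = []
pre (suc m) (b ∷ x) = b ∷ pre m x

𝔼-pre : ∀ m {n} (F : Vec Bool m → ℚ) → 𝔼 {m ℕ.+ n} (λ x → F (pre m x)) ≡ 𝔼 F
𝔼-pre zero {n} F = ∫-const refl n (F [])
𝔼-pre (suc m) {n} F = cong₂ (λ u v → ½ * u + ½ * v) (𝔼-pre m {n} (F ∘ (true ∷_))) (𝔼-pre m {n} (F ∘ (false ∷_)))

opaque
  unfolding 𝔼°

  𝔼°-pre : ∀ m {n} (F : Vec Bool m → ℚ) → 𝔼° {m ℕ.+ n} (λ x → F (pre m x)) ≡ 𝔼° F
  𝔼°-pre = 𝔼-pre

wt-pre : ∀ m {n} (x : Vec Bool (m ℕ.+ n)) → wt (pre m x) ℕ.≤ wt x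
wt-pre zero x = z≤n
wt-pre (suc m) (true ∷ x) = s≤s (wt-pre m x)
wt-pre (suc m) (false ∷ x) = wt-pre m x

-- The parity of |S ∩ K| is linear in K, hence odd with probability at most ½.
odd-score : ∀ {m n} {S : Vec Bool n} {C : Vec (Vec Bool m) n} (b : Basis S C) → ∀ r → Basis.rank b ≡ 4 ℕ.+ r →
  V C S ≤ + 209 / 1
odd-score {m} {n} {S} {C} (basis .(4 ℕ.+ r) I M indep M0 Mu cs) r refl = ≤-trans
  (𝔼-mono {m} {λ κ → φ C (S ∩ cut C κ)} {λ κ → 1ℚ + (c₁ * A κ + c₂ * B κ)} (λ κ →
     subst (φ C (S ∩ cut C κ) ≤_) (∫-const refl m (1ℚ + (c₁ * A κ + c₂ * B κ))) (𝔼-mono (λ κ′ → G≤ (wt (S ∩ cut C κ)) (wt (S ∩ cut C κ ∩ cut C κ′))))))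
  (subst (_≤ + 209 / 1) (sym (trans (∫-+ m (λ _ → 1ℚ) (λ κ → c₁ * A κ + c₂ * B κ)) (cong₂ _+_ (∫-const refl m 1ℚ)
      (trans (∫-+ m (λ κ → c₁ * A κ) (λ κ → c₂ * B κ)) (cong₂ _+_ (∫-*ˡ m c₁ A) (∫-*ˡ m c₂ B))))))
    -- The mean is at most 1 + 1791/16 + 191/2, just below 209.
    (≤-trans (+-monoʳ-≤ 1ℚ (+-mono-≤ (*-monoˡ {c₁} (from-yes (0ℚ ≤? c₁)) A≤) (*-monoˡ {c₂} (from-yes (0ℚ ≤? c₂)) B≤)))
      (from-yes (1ℚ + (c₁ * (+ 1 / 16) + c₂ * ½) ≤? (+ 209 / 1)))))
  where
  b : Basis S C
  b = basis (4 ℕ.+ r) I M indep M0 Mu cs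
  c₁ c₂ : ℚ
  c₁ = + 1791 / 1
  c₂ = + 191 / 1
  A B : Vec Bool m → ℚ
  A κ = ⟦ wt (S ∩ cut C κ) ≡ᵇ 0 ⟧
  B κ = ⟦ odd (wt (S ∩ cut C κ)) ⟧
  -- The cut avoids S only if it avoids four basis columns.
  A≤ : 𝔼 A ≤ + 1 / 16
  A≤ = subst (_≤ + 1 / 16) (sym (trans (∫-cong m (λ κ → cong (λ z → ⟦ z ≡ᵇ 0 ⟧) (wt≡W b κ))) (𝔼-cut I indep (λ y → ⟦ W M y ≡ᵇ 0 ⟧))))
    (≤-trans (𝔼-mono {4 ℕ.+ r} {λ y → ⟦ W M y ≡ᵇ 0 ⟧} {λ y → ⟦ wt (pre 4 y) ≡ᵇ 0 ⟧} (λ y → ind (W M y) (wt (pre 4 y)) (ℕₚ.≤-trans (wt-pre 4 y) (≤W M Mu y))))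
      (≤-reflexive (𝔼-pre 4 {r} (λ y → ⟦ wt y ≡ᵇ 0 ⟧))))
    where
    ind : ∀ i l → l ℕ.≤ i → ⟦ i ≡ᵇ 0 ⟧ ≤ ⟦ l ≡ᵇ 0 ⟧
    ind zero zero h = ≤-refl
    ind zero (suc l) ()
    ind (suc i) l h = 0≤⟦⟧ (l ≡ᵇ 0)
  B≡ : ∀ κ → B κ ≡ ½ * 1ℚ - ½ * χ (comb S C) κ
  B≡ κ = trans (bits (odd (wt (S ∩ cut C κ)))) (cong (λ z → ½ * 1ℚ - ½ * z) (trans (sym (sgn-wt (S ∩ cut C κ))) (trans (sym (χ-sgn S (cut C κ))) (χ-cut S C κ))))
    where
    bits : ∀ b → ⟦ b ⟧ ≡ ½ * 1ℚ - ½ * sg b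
    bits true = refl
    bits false = refl
  B≤ : 𝔼 B ≤ ½
  B≤ = subst (_≤ ½) (sym (trans (∫-cong m B≡) (trans (∫-- m (λ _ → ½ * 1ℚ) (λ κ → ½ * χ (comb S C) κ))
      (cong₂ _-_ (∫-const refl m (½ * 1ℚ)) (trans (∫-*ˡ m ½ (χ (comb S C))) (cong (½ *_) (𝔼-χ (comb S C))))))))
    (fin (isZero (comb S C)))
    where
    fin : ∀ b → ½ * 1ℚ - ½ * ⟦ b ⟧ ≤ ½
    fin true = decide≤
    fin false = decide≤

-- Finite verification in small rank

M₁ : Vec Bool 1 → Bool
M₁ (b ∷ []) = b

M₂ : Bool → Vec Bool 2 → Bool
M₂ t (true ∷ true ∷ []) = t
M₂ t (true ∷ false ∷ []) = true
M₂ t (false ∷ true ∷ []) = true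
M₂ t (false ∷ false ∷ []) = false

-- In rank three M contains the basis vectors and not zero, so the four bits at the vectors of
-- weight at least two describe every possible S.
M₃ : Vec Bool 4 → Vec Bool 3 → Bool
M₃ (a ∷ b ∷ c ∷ d ∷ []) (true ∷ true ∷ true ∷ []) = a
M₃ (a ∷ b ∷ c ∷ d ∷ []) (true ∷ true ∷ false ∷ []) = b
M₃ (a ∷ b ∷ c ∷ d ∷ []) (true ∷ false ∷ true ∷ []) = c
M₃ (a ∷ b ∷ c ∷ d ∷ []) (false ∷ true ∷ true ∷ []) = d
M₃ (a ∷ b ∷ c ∷ d ∷ []) (true ∷ false ∷ false ∷ []) = true
M₃ (a ∷ b ∷ c ∷ d ∷ []) (false ∷ true ∷ false ∷ []) = true
M₃ (a ∷ b ∷ c ∷ d ∷ []) (false ∷ false ∷ true ∷ []) = true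
M₃ (a ∷ b ∷ c ∷ d ∷ []) (false ∷ false ∷ false ∷ []) = false

all-cube : ∀ {k} → (Vec Bool k → Bool) → Bool
all-cube {zero} P = P []
all-cube {suc k} P = all-cube (P ∘ (true ∷_)) ∧ all-cube (P ∘ (false ∷_))

all-cube-sound : ∀ {k} (P : Vec Bool k → Bool) → all-cube P ≡ true → ∀ x → P x ≡ true
all-cube-sound P h [] = h
all-cube-sound P h (b ∷ x) with all-cube (P ∘ (true ∷_)) in e₁ | all-cube (P ∘ (false ∷_)) in e₂
all-cube-sound P h (true ∷ x) | true | true = all-cube-sound (P ∘ (true ∷_)) e₁ x
all-cube-sound P h (false ∷ x) | true | true = all-cube-sound (P ∘ (false ∷_)) e₂ x

≥gap : ℚ → Bool
≥gap q = ⌊ (λmin + gap) ≤? q ⌋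

≥gap-sound : ∀ q → ≥gap q ≡ true → λmin + gap ≤ q
≥gap-sound q e = toWitness {a? = (λmin + gap) ≤? q} (Equivalence.from T-≡ e)

opaque
  unfolding val score
  score₁ : λmin ≤ score M₁
  score₁ = decide≤

  score₂ : ∀ t → λmin ≤ score (M₂ t)
  score₂ true = decide≤
  score₂ false = decide≤

  score₃ : ∀ v → λmin + gap ≤ score (M₃ v)
  score₃ v = ≥gap-sound (score (M₃ v)) (all-cube-sound (λ v → ≥gap (score (M₃ v))) refl v)

  score₄ : λmin + gap ≤ score {4} (λ D → wt D ≡ᵇ 1)
  score₄ = decide≤

opaque
  unfolding 𝔼°

  -- Four independent columns alone give only -4919/16, which is below -256. One further column,
  -- with coordinates D, makes up for it.
  bound₄ : ∀ (D : Vec Bool 4) → (2 ≤ᵇ wt D) ≡ true → λmin + gap ≤ 𝔼° (λ y → ĉ (wt y ℕ.+ bit (dot D y)))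
  bound₄ D h = extract (2 ≤ᵇ wt D) h (all-cube-sound (λ D → not (2 ≤ᵇ wt D) ∨ ≥gap (value D)) refl D)
    where
    value : Vec Bool 4 → ℚ
    value D = 𝔼° (λ y → ĉ (wt y ℕ.+ bit (dot D y)))
    extract : ∀ b → b ≡ true → not b ∨ ≥gap (value D) ≡ true → λmin + gap ≤ value D
    extract true refl e = ≥gap-sound (value D) e

  -- Five independent columns suffice by themselves, but only with the value 1792 at y = 0; with
  -- `ĉ₀` the mean would be -325.5.
  bound₅ : λmin + gap ≤ 𝔼° {5} (λ y → ĉ (wt y))
  bound₅ = decide≤

  -- From six columns on even `ĉ₀` is enough, so larger ranks can be truncated to six coordinates,
  -- although the truncation no longer shows whether S ∩ K is empty.
  bound₆ : λmin + gap ≤ 𝔼° {6} (λ y → ĉ₀ (wt y))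
  bound₆ = decide≤

module _ {m n} {S : Vec Bool n} {C : Vec (Vec Bool m) n} where

  private
    zero-unless : ∀ {r} (M : Vec Bool r → Bool) (l : Vec Bool r → ℕ) → (∀ y → wt y ℕ.≤ l y) →
      ∀ y → l y ≡ 0 → W M y ≡ 0
    zero-unless M l h y e = trans (cong (W M) (wt≡0⇒𝟘 y (ℕₚ.≤-antisym (subst (wt y ℕ.≤_) e (h y)) z≤n))) (W-𝟘 M)

    extra-element : ∀ {r} (M : Vec Bool r → Bool) → M 𝟘 ≡ false → (∀ i → M (unit i) ≡ true) →
      (∃ λ D → M D ≡ true × (2 ≤ᵇ wt D) ≡ true) ⊎ (∀ D → M D ≡ (wt D ≡ᵇ 1))
    extra-element M M0 Mu with search (λ D → M D ∧ (2 ≤ᵇ wt D))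
    ... | inj₁ (D , h) = inj₁ (D , ∧-true h)
    ... | inj₂ none = inj₂ M≡
      where
      M≡ : ∀ D → M D ≡ (wt D ≡ᵇ 1)
      M≡ D with wt D in e
      ... | 0 = trans (cong M (wt≡0⇒𝟘 D e)) M0
      ... | 1 = trans (cong M (proj₂ (wt≡1⇒unit D e))) (Mu (proj₁ (wt≡1⇒unit D e)))
      ... | suc (suc w) = trans (sym (∧-identityʳ (M D))) (trans (cong (λ z → M D ∧ (2 ≤ᵇ z)) (sym e)) (none D))

    val≥wt′ : ∀ {r} (M : Vec Bool r → Bool) → (∀ i → M (unit i) ≡ true) → ∀ D → M D ≡ true → (2 ≤ᵇ wt D) ≡ true →
      𝔼° (λ y → ĉ (wt y ℕ.+ bit (dot D y))) ≤ val M
    val≥wt′ M Mu D MD big = val≥ M (λ y → ĉ (wt y ℕ.+ bit (dot D y)))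
      (λ y j → G≥ĉ′ (W M y) j (wt y ℕ.+ bit (dot D y)) (≤W′ M Mu D MD (ℕₚ.≤ᵇ⇒≤ 2 (wt D) (Equivalence.from T-≡ big)) y)
          (zero-unless M (λ y → wt y ℕ.+ bit (dot D y)) (λ y → ℕₚ.m≤m+n (wt y) _) y))

    val≥wt : ∀ {r} (M : Vec Bool r → Bool) → (∀ i → M (unit i) ≡ true) → 𝔼° (λ y → ĉ (wt y)) ≤ val M
    val≥wt M Mu = val≥ M (λ y → ĉ (wt y)) (λ y j → G≥ĉ′ (W M y) j (wt y) (≤W M Mu y) (zero-unless M wt (λ y → ℕₚ.≤-refl) y))

    val≥pre : ∀ k r (M : Vec Bool (k ℕ.+ r) → Bool) → (∀ i → M (unit i) ≡ true) → 𝔼° {k} (λ y → ĉ₀ (wt y)) ≤ val M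
    val≥pre k r M Mu = subst (_≤ val M) (𝔼°-pre k {r} (λ y → ĉ₀ (wt y))) (val≥ M (λ y → ĉ₀ (wt (pre k {r} y)))
        (λ y j → G≥ĉ₀ (W M y) j (wt (pre k {r} y)) (ℕₚ.≤-trans (wt-pre k y) (≤W M Mu y))))

    even-val₄ : ∀ (M : Vec Bool 4 → Bool) → (∀ i → M (unit i) ≡ true) → odd (size₀ M) ≡ false →
      (∃ λ D → M D ≡ true × (2 ≤ᵇ wt D) ≡ true) ⊎ (∀ D → M D ≡ (wt D ≡ᵇ 1)) → λmin + gap ≤ val M
    even-val₄ M Mu ev (inj₁ (D , MD , big)) = ≤-trans (bound₄ D big) (val≥wt′ M Mu D MD big)
    even-val₄ M Mu ev (inj₂ M≡) = subst (λmin + gap ≤_) (trans (score-cong (λ D → sym (M≡ D))) (score-even M ev)) score₄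

    even-val : ∀ (b : Basis S C) r → Basis.rank b ≡ 4 ℕ.+ r → odd (size₀ (Basis.M b)) ≡ false → λmin + gap ≤ val (Basis.M b)
    even-val (basis .4 I M ind M0 Mu cs) 0 refl ev = even-val₄ M Mu ev (extra-element M M0 Mu)
    even-val (basis .5 I M ind M0 Mu cs) 1 refl ev = ≤-trans bound₅ (val≥wt M Mu)
    even-val (basis .(6 ℕ.+ r) I M ind M0 Mu cs) (suc (suc r)) refl ev = ≤-trans bound₆ (val≥pre 6 r M Mu)

    neg-one : ∀ v → - 1ℚ * v ≡ - v
    neg-one = solve-∀ ℚ-ring

    high-rank-odd : ∀ (b : Basis S C) r → Basis.rank b ≡ 4 ℕ.+ r → odd (size₀ (Basis.M b)) ≡ true → - (+ 209 / 1) ≤ sgn S * V C S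
    high-rank-odd b r e par = subst (- (+ 209 / 1) ≤_) (sym eq) (neg-antimono-≤ (odd-score b r e))
      where
      eq : sgn S * V C S ≡ - V C S
      eq = trans (cong (_* V C S) (trans (sgn-wt S) (cong sg (trans (cong odd (wt≡size b)) par)))) (neg-one (V C S))

    high-rank-even : ∀ (b : Basis S C) r → Basis.rank b ≡ 4 ℕ.+ r → odd (size₀ (Basis.M b)) ≡ false → λmin + gap ≤ sgn S * V C S
    high-rank-even b r e par = subst (λmin + gap ≤_) (sym (trans (score≡ b) (score-even (Basis.M b) par))) (even-val b r e par)

    high-rank : ∀ (b : Basis S C) r → Basis.rank b ≡ 4 ℕ.+ r → ∀ p → odd (size₀ (Basis.M b)) ≡ p → λmin + gap ≤ sgn S * V C S
    high-rank b r e true par = ≤-trans 209-bound (high-rank-odd b r e par)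
      where
      209-bound : λmin + gap ≤ - (+ 209 / 1)
      209-bound = decide≤
    high-rank b r e false par = high-rank-even b r e par

  rank≥3 : ∀ (b : Basis S C) r → Basis.rank b ≡ 3 ℕ.+ r → λmin + gap ≤ sgn S * V C S
  rank≥3 b (suc r) e = high-rank b r e (odd (size₀ (Basis.M b))) refl
  rank≥3 b@(basis .3 I M ind M0 Mu cs) 0 refl = subst (λmin + gap ≤_) (sym (trans (score≡ b) (score-cong {3} {M} {M₃ (p ∷ q ∷ s ∷ t ∷ [])} M≡)))
      (score₃ (p ∷ q ∷ s ∷ t ∷ []))
    where
    p = M (true ∷ true ∷ true ∷ [])
    q = M (true ∷ true ∷ false ∷ [])
    s = M (true ∷ false ∷ true ∷ [])
    t = M (false ∷ true ∷ true ∷ [])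
    M≡ : ∀ D → M D ≡ M₃ (p ∷ q ∷ s ∷ t ∷ []) D
    M≡ (true ∷ true ∷ true ∷ []) = refl
    M≡ (true ∷ true ∷ false ∷ []) = refl
    M≡ (true ∷ false ∷ true ∷ []) = refl
    M≡ (false ∷ true ∷ true ∷ []) = refl
    M≡ (true ∷ false ∷ false ∷ []) = Mu zero
    M≡ (false ∷ true ∷ false ∷ []) = Mu (suc zero)
    M≡ (false ∷ false ∷ true ∷ []) = Mu (suc (suc zero))
    M≡ (false ∷ false ∷ false ∷ []) = M0

  private
    rank₂-good : ∀ (b : Basis S C) → (e : Basis.rank b ≡ 2) → λmin ≤ sgn S * V C S × good C S ≡ true
    rank₂-good b@(basis .2 I M ind M0 Mu cs) refl =
        subst (λmin ≤_) (sym (trans (score≡ b) (score-cong {2} {M} {M₂ t} M≡))) (score₂ t)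
      , isgood t refl
      where
      t = M (true ∷ true ∷ [])
      M≡ : ∀ D → M D ≡ M₂ t D
      M≡ (true ∷ true ∷ []) = refl
      M≡ (true ∷ false ∷ []) = Mu zero
      M≡ (false ∷ true ∷ []) = Mu (suc zero)
      M≡ (false ∷ false ∷ []) = M0
      size≡ : wt S ≡ size₀ (M₂ t)
      size≡ = trans (wt≡size b) (sumN-cong (λ D → cong (λ z → bit (z ∧ true)) (M≡ D)))
      even : ∀ y → odd (W (M₂ true) y) ≡ false
      even (true ∷ true ∷ []) = refl
      even (true ∷ false ∷ []) = refl
      even (false ∷ true ∷ []) = refl
      even (false ∷ false ∷ []) = refl
      isgood : ∀ u → t ≡ u → good C S ≡ true
      isgood false e rewrite trans size≡ (cong (λ u → size₀ (M₂ u)) e) = refl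
      isgood true e rewrite trans size≡ (cong (λ u → size₀ (M₂ u)) e) with isZero (comb S C) in z
      ... | true = refl
      -- Every cut meets the three columns evenly, so the character of `comb S C` is constantly 1;
      -- its mean is then not zero, which forces `comb S C` to vanish.
      ... | false = ⊥-elim (1≢0 (trans (sym one) (trans (𝔼-χ (comb S C)) (cong ⟦_⟧ z))))
        where
        one : 𝔼 (χ (comb S C)) ≡ 1ℚ
        one = trans (∫-cong m (λ κ → trans (sym (χ-cut S C κ)) (trans (χ-sgn S (cut C κ)) (trans (sgn-wt (S ∩ cut C κ))
          (cong sg (trans (cong odd (trans (wt≡W b κ) (sumN-cong (λ D → cong (λ z → bit (z ∧ dot D (cut I κ))) (trans (M≡ D) (cong (λ u → M₂ u D) e))))))
            (even (cut I κ)))))))) (∫-const refl m 1ℚ)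

    rank₁-good : ∀ (b : Basis S C) → (e : Basis.rank b ≡ 1) → λmin ≤ sgn S * V C S × good C S ≡ true
    rank₁-good b@(basis .1 I M ind M0 Mu cs) refl =
        subst (λmin ≤_) (sym (trans (score≡ b) (score-cong {1} {M} {M₁} M≡))) score₁
      , cong (λ w → (w ≤ᵇ 2) ∨ ((w ≡ᵇ 3) ∧ isZero (comb S C))) (trans (wt≡size b) (sumN-cong (λ D → cong (λ z → bit (z ∧ true)) (M≡ D))))
      where
      M≡ : ∀ D → M D ≡ M₁ D
      M≡ (true ∷ []) = Mu zero
      M≡ (false ∷ []) = M0

    gap≥0 : λmin ≤ λmin + gap
    gap≥0 = decide≤

  -- The rank of S decides. In a simple matroid rank one means a single column and rank two a pair
  -- or a triangle, so the good sets are those of rank at most two, and every larger rank has the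
  -- gap.
  spectral : Simple C → S ≢ 𝟘 → λmin ≤ sgn S * V C S × (good C S ≡ false → λmin + gap ≤ sgn S * V C S)
  spectral simp S≢𝟘 = go (find-basis S C simp) _ refl
    where
    excluded : λmin ≤ sgn S * V C S × good C S ≡ true → λmin ≤ sgn S * V C S × (good C S ≡ false → λmin + gap ≤ sgn S * V C S)
    excluded (h , g) = h , λ f → ⊥-elim (t≢f (trans (sym g) f))
    empty : ∀ (b : Basis S C) → Basis.rank b ≡ 0 → wt S ≡ 0
    empty b@(basis .0 I M ind M0 Mu cs) refl = trans (wt≡size b) (cong (λ z → bit (z ∧ true)) M0)
    go : (b : Basis S C) → ∀ r → Basis.rank b ≡ r → λmin ≤ sgn S * V C S × (good C S ≡ false → λmin + gap ≤ sgn S * V C S)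
    go b 0 e = ⊥-elim (S≢𝟘 (wt≡0⇒𝟘 S (empty b e)))
    go b 1 e = excluded (rank₁-good b e)
    go b 2 e = excluded (rank₂-good b e)
    go b (suc (suc (suc r))) e = ≤-trans gap≥0 (rank≥3 b r e) , (λ _ → rank≥3 b r e)

-- Coordinates

_≐_ : Bool → Bool → Bool
b ≐ s = not (b xor s)

⟦∧⟧ : ∀ p q → ⟦ p ∧ q ⟧ ≡ ⟦ p ⟧ * ⟦ q ⟧
⟦∧⟧ true q = sym (*-identityˡ ⟦ q ⟧)
⟦∧⟧ false q = sym (*-zeroˡ ⟦ q ⟧)

module _ {a b : ℚ} (a+b : a + b ≡ 1ℚ) where

  weight : Bool → ℚ
  weight true = a
  weight false = b

  ∫-coord : ∀ {k} (i : Fin k) s (H : Vec Bool k → ℚ) → (∀ x v → H (x [ i ]≔ v) ≡ H x) →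
    ∫ a b k (λ x → ⟦ lookup x i ≐ s ⟧ * H x) ≡ weight s * ∫ a b k H
  ∫-coord {suc k} zero s H inv = trans (cong₂ (λ u v → a * u + b * v)
      (∫-*ˡ k ⟦ true ≐ s ⟧ (H ∘ (true ∷_))) (trans (∫-*ˡ k ⟦ false ≐ s ⟧ (H ∘ (false ∷_))) (cong (⟦ false ≐ s ⟧ *_) same)))
    (trans (fin s) (cong (weight s *_) (sym (trans (cong (λ v → a * t + b * v) same)
      (trans (sym (*-distribʳ-+ t a b)) (trans (cong (_* t) a+b) (*-identityˡ t)))))))
    where
    t : ℚ
    t = ∫ a b k (H ∘ (true ∷_))
    same : ∫ a b k (H ∘ (false ∷_)) ≡ t
    same = ∫-cong k (λ x → inv (true ∷ x) false)
    l₁ : ∀ a b t → a * (1ℚ * t) + b * (0ℚ * t) ≡ a * t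
    l₁ = solve-∀ ℚ-ring
    l₂ : ∀ a b t → a * (0ℚ * t) + b * (1ℚ * t) ≡ b * t
    l₂ = solve-∀ ℚ-ring
    fin : ∀ s → a * (⟦ true ≐ s ⟧ * t) + b * (⟦ false ≐ s ⟧ * t) ≡ weight s * t
    fin true = l₁ a b t
    fin false = l₂ a b t
  ∫-coord {suc k} (suc i) s H inv = trans (cong₂ (λ u v → a * u + b * v)
      (∫-coord i s (H ∘ (true ∷_)) (λ x v → inv (true ∷ x) v)) (∫-coord i s (H ∘ (false ∷_)) (λ x v → inv (false ∷ x) v)))
    (lem a b (weight s) (∫ a b k (H ∘ (true ∷_))) (∫ a b k (H ∘ (false ∷_))))
    where
    lem : ∀ a b c u v → a * (c * u) + b * (c * v) ≡ c * (a * u + b * v)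
    lem = solve-∀ ℚ-ring

  ∫-coord₃ : ∀ {k} {i j l : Fin k} → i ≢ j → j ≢ l → i ≢ l → ∀ s t u →
    ∫ a b k (λ x → ⟦ (lookup x i ≐ s) ∧ (lookup x j ≐ t) ∧ (lookup x l ≐ u) ⟧) ≡ weight s * (weight t * weight u)
  ∫-coord₃ {k} {i} {j} {l} i≢j j≢l i≢l s t u = trans
    (∫-cong k (λ x → trans (⟦∧⟧ (lookup x i ≐ s) _) (cong (⟦ lookup x i ≐ s ⟧ *_)
      (trans (⟦∧⟧ (lookup x j ≐ t) _) (cong (⟦ lookup x j ≐ t ⟧ *_) (sym (*-identityʳ ⟦ lookup x l ≐ u ⟧)))))))
    (trans (∫-coord i s (λ x → ⟦ lookup x j ≐ t ⟧ * (⟦ lookup x l ≐ u ⟧ * 1ℚ))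
        (λ x v → cong₂ (λ p q → ⟦ p ≐ t ⟧ * (⟦ q ≐ u ⟧ * 1ℚ)) (lookup∘update′ (i≢j ∘ sym) x v) (lookup∘update′ (i≢l ∘ sym) x v)))
      (cong (weight s *_) (trans (∫-coord j t (λ x → ⟦ lookup x l ≐ u ⟧ * 1ℚ)
          (λ x v → cong (λ q → ⟦ q ≐ u ⟧ * 1ℚ) (lookup∘update′ (j≢l ∘ sym) x v)))
        (cong (weight t *_) (trans (∫-coord l u (λ _ → 1ℚ) (λ _ _ → refl)) (trans (cong (weight u *_) (∫-const a+b k 1ℚ)) (*-identityʳ (weight u))))))))

χ-unit : ∀ {k} (i : Fin k) x → χ (unit i) x ≡ sg (lookup x i)
χ-unit zero (b ∷ x) = trans (cong (sg b *_) (χ-𝟘ˡ x)) (*-identityʳ (sg b))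
χ-unit (suc i) (b ∷ x) = trans (*-identityˡ (χ (unit i) x)) (χ-unit i x)

lookup-𝟘 : ∀ {k} (i : Fin k) → lookup 𝟘 i ≡ false
lookup-𝟘 zero = refl
lookup-𝟘 (suc i) = lookup-𝟘 i

lookup-unit : ∀ {k} (i : Fin k) → lookup (unit i) i ≡ true
lookup-unit zero = refl
lookup-unit (suc i) = lookup-unit i

lookup-unit′ : ∀ {k} {i u : Fin k} → u ≢ i → lookup (unit i) u ≡ false
lookup-unit′ {i = zero} {zero} h = ⊥-elim (h refl)
lookup-unit′ {i = zero} {suc u} h = lookup-𝟘 u
lookup-unit′ {i = suc i} {zero} h = refl
lookup-unit′ {i = suc i} {suc u} h = lookup-unit′ (h ∘ cong suc)

wt-⊕-unit : ∀ {k} (T : Vec Bool k) u → lookup T u ≡ false → wt (T ⊕ unit u) ≡ suc (wt T)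
wt-⊕-unit (true ∷ T) (suc u) h = cong suc (wt-⊕-unit T u h)
wt-⊕-unit (false ∷ T) zero h = cong (suc ∘ wt) (⊕-identityʳ T)
wt-⊕-unit (false ∷ T) (suc u) h = wt-⊕-unit T u h

peel : ∀ {k} (T : Vec Bool k) {r} → wt T ≡ suc r → ∃ λ i → ∃ λ T′ → T ≡ unit i ⊕ T′ × wt T′ ≡ r × lookup T′ i ≡ false
peel (true ∷ T) e = zero , false ∷ T , cong (true ∷_) (sym (⊕-identityˡ T)) , ℕₚ.suc-injective e , refl
peel (false ∷ T) e with peel T e
... | i , T′ , eq , w , l = suc i , false ∷ T′ , cong (false ∷_) eq , w , l

lookup-peel : ∀ {k} {i u : Fin k} {T} → lookup (unit i ⊕ T) u ≡ true → u ≡ i ⊎ lookup T u ≡ true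
lookup-peel {i = i} {u} {T} h with u Fin.≟ i
... | yes e = inj₁ e
... | no ne = inj₂ (trans (cong (_xor lookup T u) (sym (lookup-unit′ ne))) (trans (sym (lookup-zipWith _xor_ u (unit i) T)) h))

lookup-peel-self : ∀ {k} {i : Fin k} {T} → lookup T i ≡ false → lookup (unit i ⊕ T) i ≡ true
lookup-peel-self {i = i} {T} h = trans (lookup-zipWith _xor_ i (unit i) T) (cong₂ _xor_ (lookup-unit i) h)

record Support₃ {k} (T : Vec Bool k) : Set where
  constructor support₃
  field
    i j l : Fin k
    i≢j : i ≢ j
    j≢l : j ≢ l
    i≢l : i ≢ l
    T≡ : T ≡ unit i ⊕ (unit j ⊕ unit l)
    covers : ∀ u → lookup T u ≡ true → u ≡ i ⊎ u ≡ j ⊎ u ≡ l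

wt≡3⇒Support₃ : ∀ {k} (T : Vec Bool k) → wt T ≡ 3 → Support₃ T
wt≡3⇒Support₃ T e with peel T e
... | i , T₁ , refl , w₁ , l₁ with peel T₁ w₁
... | j , T₂ , refl , w₂ , l₂ with wt≡1⇒unit T₂ w₂
... | l , refl = support₃ i j l i≢j j≢l i≢l refl covers
  where
  i≢j : i ≢ j
  i≢j refl = t≢f (trans (sym (lookup-peel-self {i = i} {unit l} l₂)) l₁)
  j≢l : j ≢ l
  j≢l refl = t≢f (trans (sym (lookup-unit j)) l₂)
  i≢l : i ≢ l
  i≢l refl = t≢f (trans (sym (trans (lookup-zipWith _xor_ i (unit j) (unit i)) (cong₂ _xor_ (lookup-unit′ i≢j) (lookup-unit i)))) l₁)
  covers : ∀ u → lookup (unit i ⊕ (unit j ⊕ unit l)) u ≡ true → u ≡ i ⊎ u ≡ j ⊎ u ≡ l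
  covers u h with lookup-peel {i = i} {u} {unit j ⊕ unit l} h
  ... | inj₁ e = inj₁ e
  ... | inj₂ h₁ with lookup-peel {i = j} {u} {unit l} h₁
  ... | inj₁ e = inj₂ (inj₁ e)
  ... | inj₂ h₂ with u Fin.≟ l
  ... | yes e = inj₂ (inj₂ e)
  ... | no ne = ⊥-elim (t≢f (trans (sym h₂) (lookup-unit′ ne)))

-- Hoffman bound and stability for agreeing families

Sum-point : ∀ {k} (F : Vec Bool k → ℚ) x → Sum (λ y → ⟦ eqv x y ⟧ * F y) ≡ F x
Sum-point F [] = *-identityˡ (F [])
Sum-point {suc k} F (true ∷ x) = trans (cong₂ (λ u v → 1ℚ * u + 1ℚ * v) (Sum-point (F ∘ (true ∷_)) x)
    (trans (∫-cong k (λ y → *-zeroˡ (F (false ∷ y)))) (∫-0 k))) (lem (F (true ∷ x)))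
  where
  lem : ∀ u → 1ℚ * u + 1ℚ * 0ℚ ≡ u
  lem = solve-∀ ℚ-ring
Sum-point {suc k} F (false ∷ x) = trans (cong₂ (λ u v → 1ℚ * u + 1ℚ * v)
    (trans (∫-cong k (λ y → *-zeroˡ (F (true ∷ y)))) (∫-0 k)) (Sum-point (F ∘ (false ∷_)) x)) (lem (F (false ∷ x)))
  where
  lem : ∀ u → 1ℚ * 0ℚ + 1ℚ * u ≡ u
  lem = solve-∀ ℚ-ring

∩-idem : ∀ {k} (x : Vec Bool k) → x ∩ x ≡ x
∩-idem [] = refl
∩-idem (true ∷ x) = cong (true ∷_) (∩-idem x)
∩-idem (false ∷ x) = cong (false ∷_) (∩-idem x)

∩-𝟘ˡ : ∀ {k} (x : Vec Bool k) → 𝟘 ∩ x ≡ 𝟘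
∩-𝟘ˡ [] = refl
∩-𝟘ˡ (b ∷ x) = cong (false ∷_) (∩-𝟘ˡ x)

sgn-𝟘 : ∀ k → sgn (𝟘 {k}) ≡ 1ℚ
sgn-𝟘 zero = refl
sgn-𝟘 (suc k) = trans (*-identityˡ (sgn (𝟘 {k}))) (sgn-𝟘 k)

-- Numerical and averaging inequalities

hoffman⇒≤⅛ : ∀ x r → 0ℚ ≤ x → 0ℚ ≤ r → - (+ 256 / 1) * x + ((+ 2048 / 1) * (x * x) + r) ≤ 0ℚ → x ≤ ⅛
hoffman⇒≤⅛ x r 0≤x 0≤r h = go (0ℚ <? x)
  where
  lem : ∀ x r → (+ 2048 / 1) * x * x + ((0ℚ - (- (+ 256 / 1) * x + ((+ 2048 / 1) * (x * x) + r))) + r) ≡ (+ 2048 / 1) * x * (+ 1 / 8)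
  lem = solve-∀ ℚ-ring
  go : Dec (0ℚ < x) → x ≤ ⅛
  go (no ≮) = ≤-trans (≮⇒≥ ≮) decide≤
  go (yes 0<x) = *-cancelˡ-≤ {(+ 2048 / 1) * x} (0<* (from-yes (0ℚ <? (+ 2048 / 1))) 0<x)
    (≤-by {(+ 2048 / 1) * x * x} ((0ℚ - (- (+ 256 / 1) * x + ((+ 2048 / 1) * (x * x) + r))) + r) (0≤+ (0≤- h) 0≤r) (lem x r))

-- Write x = ⅛ - η with η ≤ ε. Then 256x - 2048x² = 256η - 2048η² ≤ 256ε, and division by the gap
-- 1/64 gives 16384.
hoffman⇒bad≤ : ∀ x ε b → x ≤ ⅛ → ⅛ - ε ≤ x → - (+ 256 / 1) * x + ((+ 2048 / 1) * (x * x) + (+ 1 / 64) * b) ≤ 0ℚ → b ≤ (+ 16384 / 1) * ε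
hoffman⇒bad≤ x ε b x≤ ε≥ h = ≤-by {b} ((+ 64 / 1) * (0ℚ - H) + (+ 64 / 1) * ((+ 256 / 1) * (x - (⅛ - ε)) + (+ 2048 / 1) * ((⅛ - x) * (⅛ - x))))
    (0≤+ (0≤* (decide≤ {0ℚ} {+ 64 / 1}) (0≤- h)) (0≤* (decide≤ {0ℚ} {+ 64 / 1}) (0≤+ (0≤* (decide≤ {0ℚ} {+ 256 / 1}) (0≤- ε≥)) (0≤* (decide≤ {0ℚ} {+ 2048 / 1}) (0≤² (⅛ - x))))))
    (lem x ε b)
  where
  H = - (+ 256 / 1) * x + ((+ 2048 / 1) * (x * x) + (+ 1 / 64) * b)
  lem : ∀ x ε b → b + ((+ 64 / 1) * (0ℚ - (- (+ 256 / 1) * x + ((+ 2048 / 1) * (x * x) + (+ 1 / 64) * b)))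
      + (+ 64 / 1) * ((+ 256 / 1) * (x - ((+ 1 / 8) - ε)) + (+ 2048 / 1) * (((+ 1 / 8) - x) * ((+ 1 / 8) - x)))) ≡ (+ 16384 / 1) * ε
  lem = solve-∀ ℚ-ring

-- Since fA = 0, the product is Gg = hH - fH - hA. Keeping f and A in place of g and G matters: only
-- the former are bounded by 1, so the last two terms cost no more than |H| and |h|.
product-bound : ∀ f A g G h H → 0ℚ ≤ f → f ≤ 1ℚ → 0ℚ ≤ A → A ≤ 1ℚ → f * A ≡ 0ℚ → f ≡ g + h → A ≡ G + H →
  ∣ G * g ∣ ≤ (½ * (h * h) + ½ * (H * H)) + (∣ H ∣ + ∣ h ∣)
product-bound f A g G h H 0≤f f≤1 0≤A A≤1 fA fe Ae =
  subst (λ z → ∣ z ∣ ≤ (½ * (h * h) + ½ * (H * H)) + (∣ H ∣ + ∣ h ∣)) (sym eq)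
    (≤-trans (∣p-q∣≤∣p∣+∣q∣ (h * H) (f * H + h * A)) (+-mono-≤ am-gm
      (≤-trans (∣p+q∣≤∣p∣+∣q∣ (f * H) (h * A)) (+-mono-≤ (scale₁ f H 0≤f f≤1) (scale₂ h A 0≤A A≤1)))))
  where
  lem : ∀ g G h H → G * g ≡ (h * H - ((g + h) * H + h * (G + H))) + (g + h) * (G + H)
  lem = solve-∀ ℚ-ring
  eq : G * g ≡ h * H - (f * H + h * A)
  eq = trans (lem g G h H) (trans (cong₂ (λ u v → (h * H - (u * H + h * v)) + u * v) (sym fe) (sym Ae))
    (trans (cong (λ z → (h * H - (f * H + h * A)) + z) fA) (+-identityʳ (h * H - (f * H + h * A)))))
  scale₁ : ∀ t y → 0ℚ ≤ t → t ≤ 1ℚ → ∣ t * y ∣ ≤ ∣ y ∣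
  scale₁ t y 0≤t t≤1 = subst₂ _≤_ (sym (trans (∣p*q∣≡∣p∣*∣q∣ t y) (cong (_* ∣ y ∣) (0≤p⇒∣p∣≡p 0≤t)))) (*-identityˡ ∣ y ∣) (*-monoʳ (0≤∣p∣ y) t≤1)
  scale₂ : ∀ y t → 0ℚ ≤ t → t ≤ 1ℚ → ∣ y * t ∣ ≤ ∣ y ∣
  scale₂ y t 0≤t t≤1 = subst (λ z → ∣ z ∣ ≤ ∣ y ∣) (*-comm t y) (scale₁ t y 0≤t t≤1)
  lem₂ : ∀ u v → u * v + ½ * ((u - v) * (u - v)) ≡ ½ * (u * u) + ½ * (v * v)
  lem₂ = solve-∀ ℚ-ring
  am-gm : ∣ h * H ∣ ≤ ½ * (h * h) + ½ * (H * H)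
  am-gm = subst₂ _≤_ (sym (∣p*q∣≡∣p∣*∣q∣ h H)) (cong₂ (λ u v → ½ * u + ½ * v) (∣∣²≡² h) (∣∣²≡² H))
    (≤-by {∣ h ∣ * ∣ H ∣} (½ * ((∣ h ∣ - ∣ H ∣) * (∣ h ∣ - ∣ H ∣))) (0≤* 0≤½ (0≤² (∣ h ∣ - ∣ H ∣))) (lem₂ ∣ h ∣ ∣ H ∣))

-- From W ≤ 1 also u² ≤ W, and (u + v + z)² ≤ 3(u² + v² + z²) yields the factor 9.
sq-sum-bound : ∀ L u v z W → 0ℚ ≤ L → L ≤ u + (v + z) → 0ℚ ≤ u → u ≤ W → W ≤ 1ℚ → v * v ≤ W → z * z ≤ W → L * L ≤ (+ 9 / 1) * W
sq-sum-bound L u v z W 0≤L L≤ 0≤u u≤W W≤1 v² z² = ≤-trans (*-mono₂ 0≤L (≤-trans 0≤L L≤) L≤ L≤)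
  (≤-by {(u + (v + z)) * (u + (v + z))} (((u - v) * (u - v) + (v - z) * (v - z) + (z - u) * (z - u)) + (+ 3 / 1) * ((W - u * u) + (W - v * v) + (W - z * z)))
    (0≤+ (0≤+ (0≤+ (0≤² (u - v)) (0≤² (v - z))) (0≤² (z - u))) (0≤* (decide≤ {0ℚ} {+ 3 / 1}) (0≤+ (0≤+ (0≤- u²) (0≤- v²)) (0≤- z²)))) (lem u v z W))
  where
  u² : u * u ≤ W
  u² = ≤-trans (*-mono₂ 0≤u (≤-trans 0≤u u≤W) (≤-trans u≤W W≤1) u≤W) (≤-reflexive (*-identityˡ W))
  lem : ∀ u v z W → (u + (v + z)) * (u + (v + z)) + (((u - v) * (u - v) + (v - z) * (v - z) + (z - u) * (z - u)) + (+ 3 / 1) * ((W - u * u) + (W - v * v) + (W - z * z))) ≡ (+ 9 / 1) * W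
  lem = solve-∀ ℚ-ring

Sum-unique : ∀ {k} (P : Vec Bool k → Bool) → (∀ x y → P x ≡ true → P y ≡ true → x ≡ y) → Sum (λ x → ⟦ P x ⟧) ≤ 1ℚ
Sum-unique {k} P uniq = go (search P)
  where
  go : (∃ λ x → P x ≡ true) ⊎ (∀ x → P x ≡ false) → Sum (λ x → ⟦ P x ⟧) ≤ 1ℚ
  go (inj₂ none) = subst (_≤ 1ℚ) (sym (trans (∫-cong k (λ x → cong ⟦_⟧ (none x))) (∫-0 k))) 0≤1
  go (inj₁ (x₀ , h)) = subst (Sum (λ x → ⟦ P x ⟧) ≤_) (Sum-point (λ _ → 1ℚ) x₀)
    (∫-mono 0≤1 0≤1 k (λ x → subst (⟦ P x ⟧ ≤_) (sym (*-identityʳ ⟦ eqv x₀ x ⟧)) (le x (P x) refl)))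
    where
    le : ∀ x p → P x ≡ p → ⟦ P x ⟧ ≤ ⟦ eqv x₀ x ⟧
    le x true e = ≤-trans (⟦⟧≤1 (P x)) (≤-reflexive (cong ⟦_⟧ (sym (subst (λ y → eqv x₀ y ≡ true) (uniq x₀ x h e) (eqv-refl x₀)))))
    le x false e = subst (λ p → ⟦ p ⟧ ≤ ⟦ eqv x₀ x ⟧) (sym e) (0≤⟦⟧ (eqv x₀ x))

term≤Sum : ∀ {k} (u : Vec Bool k → ℚ) → (∀ x → 0ℚ ≤ u x) → ∀ x → u x ≤ Sum u
term≤Sum {k} u h x = subst (_≤ Sum u) (Sum-point u x) (∫-mono 0≤1 0≤1 k (λ y → le (u y) (h y) (eqv x y)))
  where
  le : ∀ r → 0ℚ ≤ r → ∀ b → ⟦ b ⟧ * r ≤ r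
  le r 0≤r b = subst (⟦ b ⟧ * r ≤_) (*-identityˡ r) (*-monoʳ 0≤r (⟦⟧≤1 b))

-- Applied with u the weights of the triangles and z the weight of the edges outside a triangle;
-- positivity of `u x` ensures that the chosen set is a triangle.
averaging : ∀ {k} (u z : Vec Bool k → ℚ) c → (∀ x → 0ℚ ≤ u x) → 0ℚ < Sum u → Sum (λ x → u x * z x) ≤ c * Sum u →
  ∃ λ x → 0ℚ < u x × z x ≤ c
averaging {k} u z c 0≤u pos avg = go (search (λ x → ⌊ 0ℚ <? u x ⌋ ∧ ⌊ z x ≤? c ⌋))
  where
  d : Vec Bool k → ℚ
  d x = u x * (z x - c)
  Sum-d≤0 : Sum d ≤ 0ℚ
  Sum-d≤0 = subst (_≤ 0ℚ) (sym eq) (subst (Sum (λ x → u x * z x) - c * Sum u ≤_) (+-inverseʳ (c * Sum u)) (+-monoˡ-≤ (- (c * Sum u)) avg))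
    where
    lem : ∀ u z c → u * (z - c) ≡ u * z - c * u
    lem = solve-∀ ℚ-ring
    eq : Sum d ≡ Sum (λ x → u x * z x) - c * Sum u
    eq = trans (∫-cong k (λ x → lem (u x) (z x) c)) (trans (∫-- k (λ x → u x * z x) (λ x → c * u x)) (cong (λ t → Sum (λ x → u x * z x) - t) (∫-*ˡ k c u)))
  positive-point : (∃ λ x → ⌊ 0ℚ <? u x ⌋ ≡ true) ⊎ (∀ x → ⌊ 0ℚ <? u x ⌋ ≡ false) → ∃ λ x → 0ℚ < u x
  positive-point (inj₁ (x , h)) = x , toWitness {a? = 0ℚ <? u x} (Equivalence.from T-≡ h)
  positive-point (inj₂ none) = ⊥-elim (<-irrefl refl (<-≤-trans pos (subst (Sum u ≤_) (∫-0 k) (∫-mono 0≤1 0≤1 k (λ x → ≮⇒≥ (λ lt → t≢f (trans (sym (Equivalence.to T-≡ (fromWitness lt))) (none x))))))))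
  go : (∃ λ x → ⌊ 0ℚ <? u x ⌋ ∧ ⌊ z x ≤? c ⌋ ≡ true) ⊎ (∀ x → ⌊ 0ℚ <? u x ⌋ ∧ ⌊ z x ≤? c ⌋ ≡ false) → ∃ λ x → 0ℚ < u x × z x ≤ c
  go (inj₁ (x , h)) = x , decode (0ℚ <? u x) (z x ≤? c) h
    where
    decode : (p : Dec (0ℚ < u x)) (q : Dec (z x ≤ c)) → ⌊ p ⌋ ∧ ⌊ q ⌋ ≡ true → 0ℚ < u x × z x ≤ c
    decode (yes p) (yes q) _ = p , q
  go (inj₂ none) = ⊥-elim (<-irrefl refl (<-≤-trans strict (≤-trans (term≤Sum d 0≤d x₀) Sum-d≤0)))
    where
    big : ∀ x → 0ℚ < u x → c < z x
    big x lt = decode (0ℚ <? u x) (z x ≤? c) (none x)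
      where
      decode : (p : Dec (0ℚ < u x)) (q : Dec (z x ≤ c)) → ⌊ p ⌋ ∧ ⌊ q ⌋ ≡ false → c < z x
      decode (no p) _ _ = ⊥-elim (p lt)
      decode (yes _) (no q) _ = ≰⇒> q
    0≤d : ∀ x → 0ℚ ≤ d x
    0≤d x = cases (0ℚ <? u x)
      where
      cases : Dec (0ℚ < u x) → 0ℚ ≤ d x
      cases (yes lt) = 0≤* (0≤u x) (<⇒≤ (0<- (big x lt)))
      cases (no ≮) = ≤-reflexive (sym (trans (cong (_* (z x - c)) (≤-antisym (≮⇒≥ ≮) (0≤u x))) (*-zeroˡ (z x - c))))
    x₀ : Vec Bool k
    x₀ = proj₁ (positive-point (search (λ x → ⌊ 0ℚ <? u x ⌋)))
    x₀-pos : 0ℚ < u x₀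
    x₀-pos = proj₂ (positive-point (search (λ x → ⌊ 0ℚ <? u x ⌋)))
    strict : 0ℚ < d x₀
    strict = 0<* x₀-pos (0<- (big x₀ x₀-pos))

odd-⊕ : ∀ {k} (S T : Vec Bool k) → odd (wt (S ⊕ T)) ≡ odd (wt S) xor odd (wt T)
odd-⊕ [] [] = refl
odd-⊕ (true ∷ S) (true ∷ T) = trans (odd-⊕ S T) (bits (odd (wt S)) (odd (wt T)))
  where
  bits : ∀ p q → p xor q ≡ not p xor not q
  bits true true = refl
  bits true false = refl
  bits false true = refl
  bits false false = refl
odd-⊕ (true ∷ S) (false ∷ T) = trans (cong not (odd-⊕ S T)) (bits (odd (wt S)) (odd (wt T)))
  where
  bits : ∀ p q → not (p xor q) ≡ not p xor q
  bits true true = refl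
  bits true false = refl
  bits false q = refl
odd-⊕ (false ∷ S) (true ∷ T) = trans (cong not (odd-⊕ S T)) (bits (odd (wt S)) (odd (wt T)))
  where
  bits : ∀ p q → not (p xor q) ≡ p xor not q
  bits true true = refl
  bits true false = refl
  bits false q = refl
odd-⊕ (false ∷ S) (false ∷ T) = odd-⊕ S T

≡ᵇ-true : ∀ i j → (i ≡ᵇ j) ≡ true → i ≡ j
≡ᵇ-true i j e = ℕₚ.≡ᵇ⇒≡ i j (Equivalence.from T-≡ e)

-- The five types of S, each with the indicators of empty set, edge, triangle and good set, then the
-- sign and the multiplier of the operator A. Inequalities between total weights reduce to a check
-- of these rows.
data Kind : Bool → Bool → Bool → Bool → ℚ → ℚ → Set where
  is-empty : Kind true false false true 1ℚ 1ℚ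
  is-edge : Kind false true false true (- 1ℚ) 0ℚ
  is-pair : Kind false false false true 1ℚ 0ℚ
  is-triangle : Kind false false true true (- 1ℚ) (- 1ℚ)
  is-bad : ∀ {s r} → - 1ℚ ≤ s → - 1ℚ ≤ r → r ≤ 1ℚ → Kind false false false false s r

α²-bound : ∀ α ε → ⅛ - ε ≤ α → (+ 1 / 64) - (+ 1 / 4) * ε ≤ α * α
α²-bound α ε h = ≤-by {(+ 1 / 64) - (+ 1 / 4) * ε} ((α - ⅛) * (α - ⅛) + (+ 1 / 4) * (α - (⅛ - ε))) (0≤+ (0≤² (α - ⅛)) (0≤* (decide≤ {0ℚ} {+ 1 / 4}) (0≤- h))) (lem α ε)
  where
  lem : ∀ α ε → ((+ 1 / 64) - (+ 1 / 4) * ε) + ((α - (+ 1 / 8)) * (α - (+ 1 / 8)) + (+ 1 / 4) * (α - ((+ 1 / 8) - ε))) ≡ α * α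
  lem = solve-∀ ℚ-ring

-- W₃ is at least 1/64 - ε/4 - 16384ε, and the threshold 2097280 = 128 · (16384 + 1) keeps the loss
-- below 1/128.
W₃-bound : ∀ α ε W W₃ → 0ℚ ≤ ε → ⅛ - ε ≤ α → W ≤ (+ 16384 / 1) * ε → (+ 2097280 / 1) * ε ≤ 1ℚ → α * α - W ≤ W₃ → + 1 / 128 ≤ W₃
W₃-bound α ε W W₃ 0≤ε h₁ h₂ h₃ h₄ = ≤-trans (≤-by {+ 1 / 128} ((+ 1 / 128) * (1ℚ - (+ 2097280 / 1) * ε) + (α * α - ((+ 1 / 64) - (+ 1 / 4) * ε)) + ((+ 16384 / 1) * ε - W) + (+ 3 / 4) * ε)
   (0≤+ (0≤+ (0≤+ (0≤* (decide≤ {0ℚ} {+ 1 / 128}) (0≤- h₃)) (0≤- (α²-bound α ε h₁))) (0≤- h₂)) (0≤* (decide≤ {0ℚ} {+ 3 / 4}) 0≤ε)) (lem α ε W)) h₄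
  where
  lem : ∀ α ε W → (+ 1 / 128) + ((+ 1 / 128) * (1ℚ - (+ 2097280 / 1) * ε) + (α * α - ((+ 1 / 64) - (+ 1 / 4) * ε)) + ((+ 16384 / 1) * ε - W) + (+ 3 / 4) * ε) ≡ α * α - W
  lem = solve-∀ ℚ-ring

-- Edges, triangles and bad sets together carry at least α/2, so the edges carry at least α/2 - α² -
-- 2W. Removing the edges outside the triangle and two of its edges, each at most α², leaves α/2 -
-- 3α² - 2W - Z, whose main term is 1/64 at α = ⅛.
coefficient-bound : ∀ α ε W W₁ W₃ Z N K x y z → 0ℚ ≤ N → 0ℚ ≤ α → α ≤ ⅛ → ⅛ - ε ≤ α → W ≤ K * ε →
  α ≤ 0ℚ + ((+ 2 / 1) * W₁ + ((+ 2 / 1) * W₃ + (+ 2 / 1) * W)) → W₃ ≤ α * α + W → Z ≤ (+ 128 / 1) * (N * ((+ 9 / 1) * W)) →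
  W₁ ≤ Z + (x + (y + z)) → y ≤ α * α → z ≤ α * α →
  (+ 1 / 64) - (½ + ((+ 2 / 1) + (+ 128 / 1) * (N * (+ 9 / 1))) * K) * ε ≤ x
coefficient-bound α ε W W₁ W₃ Z N K x y z 0≤N 0≤α α≤ ε≥ W≤ h₁ h₂ h₃ h₄ h₅ h₆ =
  ≤-by {(+ 1 / 64) - (½ + ((+ 2 / 1) + (+ 128 / 1) * (N * (+ 9 / 1))) * K) * ε}
    ((Z + (x + (y + z)) - W₁) + ((+ 128 / 1) * (N * ((+ 9 / 1) * W)) - Z) + (α * α - y) + (α * α - z)
      + ½ * (0ℚ + ((+ 2 / 1) * W₁ + ((+ 2 / 1) * W₃ + (+ 2 / 1) * W)) - α) + (α * α + W - W₃)
      + ((+ 2 / 1) + (+ 128 / 1) * (N * (+ 9 / 1))) * (K * ε - W) + ½ * (α - (⅛ - ε)) + (+ 3 / 1) * ((⅛ - α) * (⅛ + α)))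
    (0≤+ (0≤+ (0≤+ (0≤+ (0≤+ (0≤+ (0≤+ (0≤+ (0≤- h₄) (0≤- h₃)) (0≤- h₅)) (0≤- h₆)) (0≤* 0≤½ (0≤- h₁))) (0≤- h₂))
      (0≤* (0≤+ (decide≤ {0ℚ} {+ 2 / 1}) (0≤* (decide≤ {0ℚ} {+ 128 / 1}) (0≤* 0≤N (decide≤ {0ℚ} {+ 9 / 1})))) (0≤- W≤)))
      (0≤* 0≤½ (0≤- ε≥))) (0≤* (decide≤ {0ℚ} {+ 3 / 1}) (0≤* (0≤- α≤) (0≤+ (decide≤ {0ℚ} {⅛}) 0≤α))))
    (lem α ε W W₁ W₃ Z N K x y z)
  where
  lem : ∀ α ε W W₁ W₃ Z N K x y z → ((+ 1 / 64) - (½ + ((+ 2 / 1) + (+ 128 / 1) * (N * (+ 9 / 1))) * K) * ε)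
    + ((Z + (x + (y + z)) - W₁) + ((+ 128 / 1) * (N * ((+ 9 / 1) * W)) - Z) + (α * α - y) + (α * α - z)
      + ½ * (0ℚ + ((+ 2 / 1) * W₁ + ((+ 2 / 1) * W₃ + (+ 2 / 1) * W)) - α) + (α * α + W - W₃)
      + ((+ 2 / 1) + (+ 128 / 1) * (N * (+ 9 / 1))) * (K * ε - W) + ½ * (α - ((+ 1 / 8) - ε)) + (+ 3 / 1) * (((+ 1 / 8) - α) * ((+ 1 / 8) + α))) ≡ x
  lem = solve-∀ ℚ-ring

opaque
  -- D bounds the loss in the three large level-one weights, C₀ the distance to the junta.
  D C₀ : ℚ
  D = ½ + ((+ 2 / 1) + (+ 128 / 1) * (9ℚ ^ 6 * (+ 9 / 1))) * (+ 16384 / 1)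
  C₀ = 1ℚ + (+ 24 / 1) * D

  D≡ : D ≡ ½ + ((+ 2 / 1) + (+ 128 / 1) * (9ℚ ^ 6 * (+ 9 / 1))) * (+ 16384 / 1)
  D≡ = refl

  C₀≡ : C₀ ≡ 1ℚ + (+ 24 / 1) * D
  C₀≡ = refl

  C₀-large : + 2097280 / 1 ≤ C₀
  C₀-large = decide≤

sign-of : ∀ x → ∃ λ s → 0ℚ ≤ sg s * x
sign-of x = go (≤-total 0ℚ x)
  where
  go : 0ℚ ≤ x ⊎ x ≤ 0ℚ → ∃ λ s → 0ℚ ≤ sg s * x
  go (inj₁ h) = false , subst (0ℚ ≤_) (sym (*-identityˡ x)) h
  go (inj₂ h) = true , subst (0ℚ ≤_) (lem x) (neg-antimono-≤ h)
    where
    lem : ∀ x → - x ≡ - 1ℚ * x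
    lem = solve-∀ ℚ-ring

-- As α ≤ ⅛, it is enough that ⅛ - t = (1/64 - t²) / (⅛ + t) ≤ 8δ.
deficit-bound : ∀ α t δ → α ≤ ⅛ → 0ℚ ≤ t → t ≤ α → (+ 1 / 64) - δ ≤ t * t → ½ * (α - t) ≤ (+ 4 / 1) * δ
deficit-bound α t δ α≤ 0≤t t≤ h = ≤-by {½ * (α - t)} (½ * (⅛ - α) + (+ 4 / 1) * (t * t - ((+ 1 / 64) - δ)) + (+ 4 / 1) * (t * (⅛ - t)))
    (0≤+ (0≤+ (0≤* 0≤½ (0≤- α≤)) (0≤* (decide≤ {0ℚ} {+ 4 / 1}) (0≤- h))) (0≤* (decide≤ {0ℚ} {+ 4 / 1}) (0≤* 0≤t (0≤- (≤-trans t≤ α≤))))) (lem α t δ)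
  where
  lem : ∀ α t δ → ½ * (α - t) + (½ * ((+ 1 / 8) - α) + (+ 4 / 1) * (t * t - ((+ 1 / 64) - δ)) + (+ 4 / 1) * (t * ((+ 1 / 8) - t))) ≡ (+ 4 / 1) * δ
  lem = solve-∀ ℚ-ring

-- Fourier weights of an agreeing family

module Agreeing {m n} (C : Vec (Vec Bool m) n) (simp : Simple C) (F : Vec Bool n → Bool)
  (agree : ∀ κ B x → F x ≡ true → F (x ⊕ ∼ (B ∩ cut C κ)) ≡ true → ⊥) where

  f : Vec Bool n → ℚ
  f x = ⟦ F x ⟧

  a w : Vec Bool n → ℚ
  a = hat f
  w S = a S * a S

  α : ℚ
  α = 𝔼 f

  0≤w : ∀ S → 0ℚ ≤ w S
  0≤w S = 0≤² (a S)

  ⟪_⟫ : (Vec Bool n → ℚ) → ℚ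
  ⟪ c ⟫ = Sum (λ S → w S * c S)

  ⟪⟫-mono : ∀ {c d} → (∀ S → c S ≤ d S) → ⟪ c ⟫ ≤ ⟪ d ⟫
  ⟪⟫-mono h = ∫-mono 0≤1 0≤1 n (λ S → *-monoˡ (0≤w S) (h S))

  ⟪⟫-cong : ∀ {c d} → (∀ S → c S ≡ d S) → ⟪ c ⟫ ≡ ⟪ d ⟫
  ⟪⟫-cong h = ∫-cong n (λ S → cong (w S *_) (h S))

  ⟪⟫-+ : ∀ c d → ⟪ (λ S → c S + d S) ⟫ ≡ ⟪ c ⟫ + ⟪ d ⟫
  ⟪⟫-+ c d = trans (∫-cong n (λ S → *-distribˡ-+ (w S) (c S) (d S))) (∫-+ n (λ S → w S * c S) (λ S → w S * d S))

  ⟪⟫-* : ∀ k c → ⟪ (λ S → k * c S) ⟫ ≡ k * ⟪ c ⟫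
  ⟪⟫-* k c = trans (∫-cong n (λ S → lem (w S) k (c S))) (∫-*ˡ n k (λ S → w S * c S))
    where
    lem : ∀ u v z → u * (v * z) ≡ v * (u * z)
    lem = solve-∀ ℚ-ring

  ⟪⟫-lin₃ : ∀ k₁ k₂ k₃ c₁ c₂ c₃ → ⟪ (λ S → k₁ * c₁ S + (k₂ * c₂ S + k₃ * c₃ S)) ⟫ ≡ k₁ * ⟪ c₁ ⟫ + (k₂ * ⟪ c₂ ⟫ + k₃ * ⟪ c₃ ⟫)
  ⟪⟫-lin₃ k₁ k₂ k₃ c₁ c₂ c₃ = trans (⟪⟫-+ (λ S → k₁ * c₁ S) (λ S → k₂ * c₂ S + k₃ * c₃ S))
    (cong₂ _+_ (⟪⟫-* k₁ c₁) (trans (⟪⟫-+ (λ S → k₂ * c₂ S) (λ S → k₃ * c₃ S)) (cong₂ _+_ (⟪⟫-* k₂ c₂) (⟪⟫-* k₃ c₃))))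

  f² : ∀ x → f x * f x ≡ f x
  f² x with F x
  ... | true = refl
  ... | false = refl

  ⟪1⟫ : ⟪ (λ _ → 1ℚ) ⟫ ≡ α
  ⟪1⟫ = trans (∫-cong n (λ S → *-identityʳ (w S))) (trans (sym (parseval a a))
    (∫-cong n (λ x → trans (cong₂ _*_ (poly-hat f x) (poly-hat f x)) (f² x))))

  a-𝟘 : a 𝟘 ≡ α
  a-𝟘 = ∫-cong n (λ x → trans (cong (f x *_) (χ-𝟘ˡ x)) (*-identityʳ (f x)))

  isZero≡eqv : ∀ {k} (S : Vec Bool k) → isZero S ≡ eqv 𝟘 S
  isZero≡eqv S = cong isZero (sym (⊕-identityˡ S))

  ⟪isZero⟫ : ⟪ (λ S → ⟦ isZero S ⟧) ⟫ ≡ α * α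
  ⟪isZero⟫ = trans (∫-cong n (λ S → trans (*-comm (w S) ⟦ isZero S ⟧) (cong (λ z → ⟦ z ⟧ * w S) (isZero≡eqv S))))
    (trans (Sum-point w 𝟘) (cong₂ _*_ a-𝟘 a-𝟘))

  shift-poly : ∀ s x → f (x ⊕ s) ≡ poly (λ S → a S * χ S s) x
  shift-poly s x = trans (sym (poly-hat f (x ⊕ s))) (∫-cong n (λ S → trans (cong (a S *_) (χ-⊕ʳ S x s)) (lem (a S) (χ S x) (χ S s))))
    where
    lem : ∀ u v z → u * (v * z) ≡ u * z * v
    lem = solve-∀ ℚ-ring

  disjoint : ∀ κ B x → f x * f (x ⊕ ∼ (B ∩ cut C κ)) ≡ 0ℚ
  disjoint κ B x = go (F x) (F (x ⊕ ∼ (B ∩ cut C κ))) refl refl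
    where
    go : ∀ p q → F x ≡ p → F (x ⊕ ∼ (B ∩ cut C κ)) ≡ q → ⟦ p ⟧ * ⟦ q ⟧ ≡ 0ℚ
    go true true e e′ = ⊥-elim (agree κ B x e e′)
    go true false _ _ = refl
    go false q _ _ = *-zeroˡ ⟦ q ⟧

  -- By Parseval this is the correlation of f with its translate by the complement of B ∩ K; taking
  -- the complement produces the factor `sgn S`.
  ⟪character⟫ : ∀ κ B → ⟪ (λ S → sgn S * χ S (B ∩ cut C κ)) ⟫ ≡ 0ℚ
  ⟪character⟫ κ B = begin
    ⟪ (λ S → sgn S * χ S (B ∩ cut C κ)) ⟫
      ≡⟨ ∫-cong n (λ S → trans (cong (w S *_) (sym (χ-∼ S (B ∩ cut C κ)))) (*-assoc (a S) (a S) (χ S s))) ⟩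
    Sum (λ S → a S * (a S * χ S s))
      ≡⟨ sym (parseval a (λ S → a S * χ S s)) ⟩
    𝔼 (λ x → poly a x * poly (λ S → a S * χ S s) x)
      ≡⟨ ∫-cong n (λ x → trans (cong₂ _*_ (poly-hat f x) (sym (shift-poly s x))) (disjoint κ B x)) ⟩
    𝔼 {n} (λ _ → 0ℚ)
      ≡⟨ ∫-0 n ⟩
    0ℚ ∎
    where
    open ≡-Reasoning
    s = ∼ (B ∩ cut C κ)

  -- Expand ψ in characters: χ_B(S ∩ K) = χ_S(B ∩ K), and B ∩ K is contained in the cut K.
  ⟪occ⟫ : ∀ ψ → ⟪ (λ S → sgn S * 𝔼 (λ κ → ψ (S ∩ cut C κ))) ⟫ ≡ 0ℚ
  ⟪occ⟫ ψ = begin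
    ⟪ (λ S → sgn S * 𝔼 (λ κ → ψ (S ∩ cut C κ))) ⟫
      ≡⟨ ∫-cong n (λ S → trans (sym (*-assoc (w S) (sgn S) _)) (trans (sym (∫-*ˡ m (w S * sgn S) (λ κ → ψ (S ∩ cut C κ)))) (∫-cong m (λ κ →
           trans (cong ((w S * sgn S) *_) (trans (sym (poly-hat ψ (S ∩ cut C κ))) (∫-cong n (λ B → cong (hat ψ B *_) (χ-∩ S (cut C κ) B)))))
             (sym (∫-*ˡ n (w S * sgn S) (λ B → hat ψ B * χ S (B ∩ cut C κ)))))))) ⟩
    Sum (λ S → 𝔼 (λ κ → Sum (λ B → (w S * sgn S) * (hat ψ B * χ S (B ∩ cut C κ)))))
      ≡⟨ ∫-swap n m (λ S κ → Sum (λ B → (w S * sgn S) * (hat ψ B * χ S (B ∩ cut C κ)))) ⟩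
    𝔼 (λ κ → Sum (λ S → Sum (λ B → (w S * sgn S) * (hat ψ B * χ S (B ∩ cut C κ)))))
      ≡⟨ ∫-cong m (λ κ → trans (∫-swap n n (λ S B → (w S * sgn S) * (hat ψ B * χ S (B ∩ cut C κ))))
           (trans (∫-cong n (λ B → trans (∫-cong n (λ S → lem (w S) (sgn S) (hat ψ B) (χ S (B ∩ cut C κ))))
               (trans (∫-*ˡ n (hat ψ B) (λ S → w S * (sgn S * χ S (B ∩ cut C κ)))) (trans (cong (hat ψ B *_) (⟪character⟫ κ B)) (*-zeroʳ (hat ψ B))))))
             (∫-0 n))) ⟩
    𝔼 {m} (λ _ → 0ℚ)
      ≡⟨ ∫-0 m ⟩
    0ℚ ∎
    where
    open ≡-Reasoning
    lem : ∀ u v z y → (u * v) * (z * y) ≡ z * (u * (v * y))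
    lem = solve-∀ ℚ-ring

  Wb : ℚ
  Wb = ⟪ (λ S → ⟦ not (good C S) ⟧) ⟫

  0≤Wb : 0ℚ ≤ Wb
  0≤Wb = ∫-nonneg 0≤1 0≤1 n (λ S → 0≤* (0≤w S) (0≤⟦⟧ (not (good C S))))

  -- By `⟪occ⟫` the spectral coefficients pair to zero with the weights. The left side pairs a
  -- pointwise minorant of them: -256 everywhere, 2048 = 1792 + 256 more at the empty set, and the
  -- gap more at bad sets.
  hoffman : λmin * α + ((+ 2048 / 1) * (α * α) + gap * Wb) ≤ 0ℚ
  hoffman = subst₂ _≤_ (trans (⟪⟫-lin₃ λmin (+ 2048 / 1) gap (λ _ → 1ℚ) (λ S → ⟦ isZero S ⟧) (λ S → ⟦ not (good C S) ⟧))
      (cong₂ (λ u v → λmin * u + ((+ 2048 / 1) * v + gap * Wb)) ⟪1⟫ ⟪isZero⟫))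
    (⟪occ⟫ (φ C)) (⟪⟫-mono (λ S → pointwise S (isZero S) (good C S) refl refl))
    where
    V-𝟘 : sgn (𝟘 {n}) * V C 𝟘 ≡ + 1792 / 1
    V-𝟘 = trans (cong₂ (λ u v → u * v) (sgn-𝟘 n) (trans (∫-cong m (λ κ → trans (cong (φ C) (∩-𝟘ˡ (cut C κ)))
      (trans (∫-cong m (λ κ′ → cong (λ i → G i (wt (𝟘 ∩ cut C κ′))) (wt-𝟘 n))) (∫-const {½} {½} refl m (+ 1792 / 1))))) (∫-const {½} {½} refl m (+ 1792 / 1)))) (*-identityˡ (+ 1792 / 1))
    nonzero : ∀ S → isZero S ≡ false → S ≢ 𝟘
    nonzero S e refl = t≢f (trans (sym (isZero-𝟘 n)) e)
    good-𝟘 : good C 𝟘 ≡ true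
    good-𝟘 = cong (λ i → (i ≤ᵇ 2) ∨ ((i ≡ᵇ 3) ∧ isZero (comb 𝟘 C))) (wt-𝟘 n)
    low : λmin * 1ℚ + ((+ 2048 / 1) * 1ℚ + gap * 0ℚ) ≤ + 1792 / 1
    low = decide≤
    l₁ : λmin * 1ℚ + ((+ 2048 / 1) * 0ℚ + gap * 0ℚ) ≤ λmin
    l₁ = decide≤
    l₂ : λmin * 1ℚ + ((+ 2048 / 1) * 0ℚ + gap * 1ℚ) ≤ λmin + gap
    l₂ = decide≤
    pointwise : ∀ S z g → isZero S ≡ z → good C S ≡ g →
      λmin * 1ℚ + ((+ 2048 / 1) * ⟦ isZero S ⟧ + gap * ⟦ not (good C S) ⟧) ≤ sgn S * V C S
    pointwise S true g e e′ = subst₂ (λ p q → λmin * 1ℚ + ((+ 2048 / 1) * ⟦ p ⟧ + gap * ⟦ not q ⟧) ≤ sgn S * V C S)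
      (sym e) (sym (trans (cong (good C) (isZero⇒≡ S e)) good-𝟘))
      (≤-trans low (≤-reflexive (sym (trans (cong (λ T → sgn T * V C T) (isZero⇒≡ S e)) V-𝟘))))
    pointwise S false true e e′ = subst₂ (λ p q → λmin * 1ℚ + ((+ 2048 / 1) * ⟦ p ⟧ + gap * ⟦ not q ⟧) ≤ sgn S * V C S)
      (sym e) (sym e′) (≤-trans l₁ (proj₁ (spectral simp (nonzero S e))))
    pointwise S false false e e′ = subst₂ (λ p q → λmin * 1ℚ + ((+ 2048 / 1) * ⟦ p ⟧ + gap * ⟦ not q ⟧) ≤ sgn S * V C S)
      (sym e) (sym e′) (≤-trans l₂ (proj₂ (spectral simp (nonzero S e)) e′))

  0≤α : 0ℚ ≤ α
  0≤α = 𝔼-nonneg (λ x → 0≤⟦⟧ (F x))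

  α≤⅛ : α ≤ ⅛
  α≤⅛ = hoffman⇒≤⅛ α (gap * Wb) 0≤α (0≤* (decide≤ {0ℚ} {gap}) 0≤Wb) hoffman

  Wb≤ : ∀ ε → ⅛ - ε ≤ α → Wb ≤ (+ 16384 / 1) * ε
  Wb≤ ε h = hoffman⇒bad≤ α ε Wb α≤⅛ h hoffman

  Wb≤1 : Wb ≤ 1ℚ
  Wb≤1 = ≤-trans (⟪⟫-mono (λ S → ⟦⟧≤1 (not (good C S)))) (≤-trans (≤-reflexive ⟪1⟫) (≤-trans α≤⅛ (decide≤ {⅛} {1ℚ})))

  -- The multiplier of `A`: averaging `χ S` over complements of cuts kills every S outside the cycle
  -- space and leaves the sign of the others.
  ρ : Vec Bool n → ℚ
  ρ S = sgn S * ⟦ isZero (comb S C) ⟧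

  A : Vec Bool n → ℚ
  A x = 𝔼 (λ κ → f (x ⊕ ∼ cut C κ))

  A≡poly : ∀ x → A x ≡ poly (λ S → a S * ρ S) x
  A≡poly x = trans (∫-cong m (λ κ → shift-poly (∼ cut C κ) x))
    (trans (∫-swap m n (λ κ S → (a S * χ S (∼ cut C κ)) * χ S x))
      (∫-cong n (λ S → trans (∫-*ʳ m (χ S x) (λ κ → a S * χ S (∼ cut C κ))) (cong (_* χ S x)
        (trans (∫-*ˡ m (a S) (λ κ → χ S (∼ cut C κ))) (cong (a S *_)
          (trans (∫-cong m (λ κ → trans (χ-∼ S (cut C κ)) (cong (sgn S *_) (χ-cut S C κ))))
            (trans (∫-*ˡ m (sgn S) (χ (comb S C))) (cong (sgn S *_) (𝔼-χ (comb S C)))))))))))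

  0≤A : ∀ x → 0ℚ ≤ A x
  0≤A x = 𝔼-nonneg (λ κ → 0≤⟦⟧ (F (x ⊕ ∼ cut C κ)))

  A≤1 : ∀ x → A x ≤ 1ℚ
  A≤1 x = subst (A x ≤_) (∫-const {½} {½} refl m 1ℚ) (𝔼-mono (λ κ → ⟦⟧≤1 (F (x ⊕ ∼ cut C κ))))

  fA≡0 : ∀ x → f x * A x ≡ 0ℚ
  fA≡0 x = trans (sym (∫-*ˡ m (f x) (λ κ → f (x ⊕ ∼ cut C κ)))) (trans (∫-cong m (λ κ →
    trans (cong (λ K → f x * f (x ⊕ ∼ K)) (sym (∩-idem (cut C κ)))) (disjoint κ (cut C κ) x))) (∫-0 m))

  ⟪ρ⟫ : ⟪ ρ ⟫ ≡ 0ℚ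
  ⟪ρ⟫ = trans (∫-cong n (λ S → *-assoc (a S) (a S) (ρ S))) (trans (sym (parseval a (λ S → a S * ρ S)))
    (trans (∫-cong n (λ x → trans (cong₂ _*_ (poly-hat f x) (sym (A≡poly x))) (fA≡0 x))) (∫-0 n)))

  ⟪sgn⟫ : ⟪ sgn ⟫ ≡ 0ℚ
  ⟪sgn⟫ = trans (⟪⟫-cong (λ S → sym (trans (cong (sgn S *_) (∫-const {½} {½} refl m 1ℚ)) (*-identityʳ (sgn S))))) (⟪occ⟫ (λ _ → 1ℚ))

  -- Coefficients of the good part g and the bad part h of f, of Ag and Ah, and of g · Ag.
  ag ah b bh c : Vec Bool n → ℚ
  ag S = ⟦ good C S ⟧ * a S
  ah S = ⟦ not (good C S) ⟧ * a S
  b S = ag S * ρ S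
  bh S = ah S * ρ S
  c = conv b ag

  a-split : ∀ S → a S ≡ ag S + ah S
  a-split S = go (good C S) (a S)
    where
    go : ∀ p u → u ≡ ⟦ p ⟧ * u + ⟦ not p ⟧ * u
    go true = solve-∀ ℚ-ring
    go false = solve-∀ ℚ-ring

  f-split : ∀ x → f x ≡ poly ag x + poly ah x
  f-split x = trans (sym (poly-hat f x)) (trans (poly-cong a-split x) (poly-+ ag ah x))

  A-split : ∀ x → A x ≡ poly b x + poly bh x
  A-split x = trans (A≡poly x) (trans (poly-cong (λ S → trans (cong (_* ρ S) (a-split S)) (*-distribʳ-+ (ρ S) (ag S) (ah S))) x) (poly-+ b bh x))

  normsq-ah : normsq ah ≡ Wb
  normsq-ah = ∫-cong n (λ S → go (not (good C S)) (a S))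
    where
    go : ∀ p u → (⟦ p ⟧ * u) * (⟦ p ⟧ * u) ≡ (u * u) * ⟦ p ⟧
    go true = solve-∀ ℚ-ring
    go false = solve-∀ ℚ-ring

  ρ²≤1 : ∀ S → ρ S * ρ S ≤ 1ℚ
  ρ²≤1 S = subst (_≤ 1ℚ) (sym (trans (lem (sgn S) ⟦ z ⟧) (trans (cong (_* (⟦ z ⟧ * ⟦ z ⟧)) (sgn² S)) (*-identityˡ (⟦ z ⟧ * ⟦ z ⟧))))) (go z)
    where
    z = isZero (comb S C)
    lem : ∀ s t → (s * t) * (s * t) ≡ (s * s) * (t * t)
    lem = solve-∀ ℚ-ring
    go : ∀ z → ⟦ z ⟧ * ⟦ z ⟧ ≤ 1ℚ
    go true = decide≤
    go false = decide≤

  normsq-bh : normsq bh ≤ Wb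
  normsq-bh = subst (normsq bh ≤_) normsq-ah (∫-mono 0≤1 0≤1 n (λ S → subst₂ _≤_ (lem (ah S) (ρ S)) (*-identityʳ (ah S * ah S)) (*-monoˡ (0≤² (ah S)) (ρ²≤1 S))))
    where
    lem : ∀ u r → (u * u) * (r * r) ≡ (u * r) * (u * r)
    lem = solve-∀ ℚ-ring

  good⇒wt≤3 : ∀ S → good C S ≡ true → wt S ℕ.≤ 3
  good⇒wt≤3 S e = go (wt S ≤ᵇ 2) refl e
    where
    go : ∀ p → (wt S ≤ᵇ 2) ≡ p → p ∨ isTriangle C S ≡ true → wt S ℕ.≤ 3
    go true le _ = ℕₚ.m≤n⇒m≤1+n (ℕₚ.≤ᵇ⇒≤ (wt S) 2 (Equivalence.from T-≡ le))
    go false _ tri = ℕₚ.≤-reflexive (≡ᵇ-true (wt S) 3 (proj₁ (∧-true tri)))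

  ag-high : ∀ S → 3 ℕ.< wt S → ag S ≡ 0ℚ
  ag-high S lt = go (good C S) refl
    where
    go : ∀ p → good C S ≡ p → ⟦ p ⟧ * a S ≡ 0ℚ
    go true e = ⊥-elim (ℕₚ.<⇒≱ lt (good⇒wt≤3 S e))
    go false _ = *-zeroˡ (a S)

  c-degree : Degree≤ 6 c
  c-degree R lt = trans (∫-cong n (λ S → go S (wt S ℕₚ.≤? 3))) (∫-0 n)
    where
    go : ∀ S → Dec (wt S ℕ.≤ 3) → b S * ag (S ⊕ R) ≡ 0ℚ
    go S (no ≰) = trans (cong (λ u → (u * ρ S) * ag (S ⊕ R)) (ag-high S (ℕₚ.≰⇒> ≰))) (trans (cong (_* ag (S ⊕ R)) (*-zeroˡ (ρ S))) (*-zeroˡ (ag (S ⊕ R))))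
    go S (yes le) = trans (cong (b S *_) (ag-high (S ⊕ R) big)) (*-zeroʳ (b S))
      where
      big : 3 ℕ.< wt (S ⊕ R)
      big = ℕₚ.+-cancelˡ-< 3 3 (wt (S ⊕ R)) (ℕₚ.<-≤-trans lt (ℕₚ.≤-trans (subst (λ X → wt X ℕ.≤ wt S ℕ.+ wt (S ⊕ R)) (⊕-cancel S R) (wt-⊕ S (S ⊕ R))) (ℕₚ.+-monoˡ-≤ (wt (S ⊕ R)) le)))

  -- The product of the good parts has degree at most 3 + 3, so its L² norm is controlled by its L¹
  -- norm, and `product-bound` leaves there only error terms whose squares are at most `Wb`.
  normsq-c : normsq c ≤ 9ℚ ^ 6 * ((+ 9 / 1) * Wb)
  normsq-c = ≤-trans (L²≤L¹ 6 c c-degree) (*-monoˡ (0≤9^ 6) (sq-sum-bound L U V′ Z Wb 0≤L L≤ 0≤U U≤ Wb≤1 V²≤ Z²≤))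
    where
    h Ah : Vec Bool n → ℚ
    h = poly ah
    Ah = poly bh
    L U V′ Z : ℚ
    L = 𝔼 (λ x → ∣ poly c x ∣)
    U = 𝔼 (λ x → ½ * (h x * h x) + ½ * (Ah x * Ah x))
    V′ = 𝔼 (λ x → ∣ Ah x ∣)
    Z = 𝔼 (λ x → ∣ h x ∣)
    0≤L : 0ℚ ≤ L
    0≤L = 𝔼-nonneg (λ x → 0≤∣p∣ (poly c x))
    L≤ : L ≤ U + (V′ + Z)
    L≤ = subst (L ≤_) (trans (∫-+ n (λ x → ½ * (h x * h x) + ½ * (Ah x * Ah x)) (λ x → ∣ Ah x ∣ + ∣ h x ∣)) (cong (λ z → U + z) (∫-+ n (λ x → ∣ Ah x ∣) (λ x → ∣ h x ∣))))
      (𝔼-mono (λ x → subst (λ z → ∣ z ∣ ≤ (½ * (h x * h x) + ½ * (Ah x * Ah x)) + (∣ Ah x ∣ + ∣ h x ∣)) (poly-* b ag x)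
        (product-bound (f x) (A x) (poly ag x) (poly b x) (h x) (Ah x) (0≤⟦⟧ (F x)) (⟦⟧≤1 (F x)) (0≤A x) (A≤1 x) (fA≡0 x) (f-split x) (A-split x))))
    0≤U : 0ℚ ≤ U
    0≤U = 𝔼-nonneg (λ x → 0≤+ (0≤* 0≤½ (0≤² (h x))) (0≤* 0≤½ (0≤² (Ah x))))
    h² : 𝔼 (λ x → h x * h x) ≡ Wb
    h² = trans (parseval ah ah) normsq-ah
    Ah² : 𝔼 (λ x → Ah x * Ah x) ≤ Wb
    Ah² = subst (_≤ Wb) (sym (parseval bh bh)) normsq-bh
    half : ∀ u → ½ * u + ½ * u ≡ u
    half = solve-∀ ℚ-ring
    U≤ : U ≤ Wb
    U≤ = subst₂ _≤_ (sym (trans (∫-+ n (λ x → ½ * (h x * h x)) (λ x → ½ * (Ah x * Ah x))) (cong₂ _+_ (∫-*ˡ n ½ (λ x → h x * h x)) (∫-*ˡ n ½ (λ x → Ah x * Ah x)))))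
      (half Wb) (+-mono-≤ (*-monoˡ 0≤½ (≤-reflexive h²)) (*-monoˡ 0≤½ Ah²))
    V²≤ : V′ * V′ ≤ Wb
    V²≤ = ≤-trans (𝔼∣∣²≤ Ah) Ah²
    Z²≤ : Z * Z ≤ Wb
    Z²≤ = ≤-trans (𝔼∣∣²≤ h) (≤-reflexive h²)

  W₁ W₃ : ℚ
  W₁ = ⟪ (λ S → ⟦ wt S ≡ᵇ 1 ⟧) ⟫
  W₃ = ⟪ (λ S → ⟦ isTriangle C S ⟧) ⟫

  Simple-𝟘 : ∀ S → wt S ℕ.≤ 2 → 1 ℕ.≤ wt S → isZero (comb S C) ≡ false
  Simple-𝟘 S le ge = go (isZero (comb S C)) refl
    where
    go : ∀ p → isZero (comb S C) ≡ p → p ≡ false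
    go false _ = refl
    go true e = ⊥-elim (ℕₚ.<⇒≱ (subst (1 ℕ.≤_) (trans (cong wt (simp S le (isZero⇒≡ (comb S C) e))) (wt-𝟘 n)) ge) z≤n)

  isZero-wt : ∀ {k} (S : Vec Bool k) → isZero S ≡ (wt S ≡ᵇ 0)
  isZero-wt [] = refl
  isZero-wt (true ∷ S) = refl
  isZero-wt (false ∷ S) = isZero-wt S

  kind : ∀ S → Kind (isZero S) (wt S ≡ᵇ 1) (isTriangle C S) (good C S) (sgn S) (ρ S)
  kind S = go (wt S) (isZero (comb S C)) refl refl
    where
    mk : ∀ {z o t g s r} → isZero S ≡ z → (wt S ≡ᵇ 1) ≡ o → isTriangle C S ≡ t → good C S ≡ g → sgn S ≡ s → ρ S ≡ r →
      Kind z o t g s r → Kind (isZero S) (wt S ≡ᵇ 1) (isTriangle C S) (good C S) (sgn S) (ρ S)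
    mk refl refl refl refl refl refl k = k
    module _ (i : ℕ) (z : Bool) (e : wt S ≡ i) (e′ : isZero (comb S C) ≡ z) where
      eZ : isZero S ≡ (i ≡ᵇ 0)
      eZ = trans (isZero-wt S) (cong (_≡ᵇ 0) e)
      eO : (wt S ≡ᵇ 1) ≡ (i ≡ᵇ 1)
      eO = cong (_≡ᵇ 1) e
      eT : isTriangle C S ≡ (i ≡ᵇ 3) ∧ z
      eT = cong₂ (λ i z → (i ≡ᵇ 3) ∧ z) e e′
      eG : good C S ≡ (i ≤ᵇ 2) ∨ ((i ≡ᵇ 3) ∧ z)
      eG = cong₂ (λ i z → (i ≤ᵇ 2) ∨ ((i ≡ᵇ 3) ∧ z)) e e′
      eS : sgn S ≡ sg (odd i)
      eS = trans (sgn-wt S) (cong (sg ∘ odd) e)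
      eR : ρ S ≡ sg (odd i) * ⟦ z ⟧
      eR = cong₂ (λ s z → s * ⟦ z ⟧) eS e′
    comb-𝟘′ : wt S ≡ 0 → isZero (comb S C) ≡ true
    comb-𝟘′ e = trans (cong isZero (trans (cong (λ T → comb T C) (wt≡0⇒𝟘 S e)) (comb-𝟘 C))) (isZero-𝟘 m)
    badBounds : ∀ i z → - 1ℚ ≤ sg (odd i) × (- 1ℚ ≤ sg (odd i) * ⟦ z ⟧) × (sg (odd i) * ⟦ z ⟧ ≤ 1ℚ)
    badBounds i z = lo (odd i) z
      where
      lo : ∀ p z → - 1ℚ ≤ sg p × (- 1ℚ ≤ sg p * ⟦ z ⟧) × (sg p * ⟦ z ⟧ ≤ 1ℚ)
      lo true true = decide≤ , decide≤ , decide≤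
      lo true false = decide≤ , decide≤ , decide≤
      lo false true = decide≤ , decide≤ , decide≤
      lo false false = decide≤ , decide≤ , decide≤
    go : ∀ i z → wt S ≡ i → isZero (comb S C) ≡ z → Kind (isZero S) (wt S ≡ᵇ 1) (isTriangle C S) (good C S) (sgn S) (ρ S)
    go 0 z e e′ = mk (eZ 0 true e e″) (eO 0 true e e″) (eT 0 true e e″) (eG 0 true e e″) (eS 0 true e e″) (eR 0 true e e″) is-empty
      where e″ = comb-𝟘′ e
    go 1 z e e′ = mk (eZ 1 false e e″) (eO 1 false e e″) (eT 1 false e e″) (eG 1 false e e″) (eS 1 false e e″) (eR 1 false e e″) is-edge
      where e″ = Simple-𝟘 S (subst (ℕ._≤ 2) (sym e) (s≤s z≤n)) (subst (1 ℕ.≤_) (sym e) (s≤s z≤n))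
    go 2 z e e′ = mk (eZ 2 false e e″) (eO 2 false e e″) (eT 2 false e e″) (eG 2 false e e″) (eS 2 false e e″) (eR 2 false e e″) is-pair
      where e″ = Simple-𝟘 S (subst (ℕ._≤ 2) (sym e) (s≤s (s≤s z≤n))) (subst (1 ℕ.≤_) (sym e) (s≤s z≤n))
    go 3 true e e′ = mk (eZ 3 true e e′) (eO 3 true e e′) (eT 3 true e e′) (eG 3 true e e′) (eS 3 true e e′) (eR 3 true e e′) is-triangle
    go 3 false e e′ = mk (eZ 3 false e e′) (eO 3 false e e′) (eT 3 false e e′) (eG 3 false e e′) (eS 3 false e e′) (eR 3 false e e′)
      (is-bad (proj₁ (badBounds 3 false)) (proj₁ (proj₂ (badBounds 3 false))) (proj₂ (proj₂ (badBounds 3 false))))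
    go i@(suc (suc (suc (suc _)))) z e e′ = mk (eZ i z e e′) (eO i z e e′) (eT i z e e′) (eG i z e e′) (eS i z e e′) (eR i z e e′)
      (is-bad (proj₁ (badBounds i z)) (proj₁ (proj₂ (badBounds i z))) (proj₂ (proj₂ (badBounds i z))))

  -- On good sets ρ is 1 at the empty set, -1 at triangles and 0 at edges and pairs, so `⟪ρ⟫`
  -- equates W₃ with α² up to the bad weight. This is the origin of the 1/64 on triangles.
  α²-Wb≤W₃ : α * α - Wb ≤ W₃
  α²-Wb≤W₃ = ≤-by {α * α - Wb} (0ℚ - (1ℚ * (α * α) + (- 1ℚ * W₃ + - 1ℚ * Wb))) (0≤- neg) (lem (α * α) W₃ Wb)
    where
    pointwise : ∀ {z o t g s r} → Kind z o t g s r → 1ℚ * ⟦ z ⟧ + (- 1ℚ * ⟦ t ⟧ + - 1ℚ * ⟦ not g ⟧) ≤ r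
    pointwise is-empty = decide≤
    pointwise is-edge = decide≤
    pointwise is-pair = decide≤
    pointwise is-triangle = decide≤
    pointwise (is-bad s≥ r≥ r≤) = r≥
    neg : 1ℚ * (α * α) + (- 1ℚ * W₃ + - 1ℚ * Wb) ≤ 0ℚ
    neg = subst₂ _≤_ (trans (⟪⟫-lin₃ 1ℚ (- 1ℚ) (- 1ℚ) (λ S → ⟦ isZero S ⟧) (λ S → ⟦ isTriangle C S ⟧) (λ S → ⟦ not (good C S) ⟧))
      (cong (λ u → 1ℚ * u + (- 1ℚ * W₃ + - 1ℚ * Wb)) ⟪isZero⟫)) ⟪ρ⟫ (⟪⟫-mono (λ S → pointwise (kind S)))
    lem : ∀ u v z → (u - z) + (0ℚ - (1ℚ * u + (- 1ℚ * v + - 1ℚ * z))) ≡ v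
    lem = solve-∀ ℚ-ring

  W₃≤α²+Wb : W₃ ≤ α * α + Wb
  W₃≤α²+Wb = ≤-by {W₃} (1ℚ * (α * α) + (- 1ℚ * W₃ + 1ℚ * Wb)) pos (lem (α * α) W₃ Wb)
    where
    pointwise : ∀ {z o t g s r} → Kind z o t g s r → r ≤ 1ℚ * ⟦ z ⟧ + (- 1ℚ * ⟦ t ⟧ + 1ℚ * ⟦ not g ⟧)
    pointwise is-empty = decide≤
    pointwise is-edge = decide≤
    pointwise is-pair = decide≤
    pointwise is-triangle = decide≤
    pointwise (is-bad s≥ r≥ r≤) = r≤
    pos : 0ℚ ≤ 1ℚ * (α * α) + (- 1ℚ * W₃ + 1ℚ * Wb)
    pos = subst₂ _≤_ ⟪ρ⟫ (trans (⟪⟫-lin₃ 1ℚ (- 1ℚ) 1ℚ (λ S → ⟦ isZero S ⟧) (λ S → ⟦ isTriangle C S ⟧) (λ S → ⟦ not (good C S) ⟧))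
      (cong (λ u → 1ℚ * u + (- 1ℚ * W₃ + 1ℚ * Wb)) ⟪isZero⟫)) (⟪⟫-mono (λ S → pointwise (kind S)))
    lem : ∀ u v z → v + (1ℚ * u + (- 1ℚ * v + 1ℚ * z)) ≡ u + z
    lem = solve-∀ ℚ-ring

  -- By `⟪sgn⟫` odd and even levels carry equal weight. The good odd sets are edges and triangles,
  -- so with W₃ near α² about 1/16 - 1/64 = 3/64 is left for the edges.
  α≤2W : α ≤ 0ℚ + ((+ 2 / 1) * W₁ + ((+ 2 / 1) * W₃ + (+ 2 / 1) * Wb))
  α≤2W = subst₂ _≤_ ⟪1⟫ (trans (⟪⟫-+ sgn (λ S → (+ 2 / 1) * ⟦ wt S ≡ᵇ 1 ⟧ + ((+ 2 / 1) * ⟦ isTriangle C S ⟧ + (+ 2 / 1) * ⟦ not (good C S) ⟧)))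
      (cong₂ _+_ ⟪sgn⟫ (⟪⟫-lin₃ (+ 2 / 1) (+ 2 / 1) (+ 2 / 1) (λ S → ⟦ wt S ≡ᵇ 1 ⟧) (λ S → ⟦ isTriangle C S ⟧) (λ S → ⟦ not (good C S) ⟧))))
    (⟪⟫-mono (λ S → pointwise (kind S)))
    where
    pointwise : ∀ {z o t g s r} → Kind z o t g s r → 1ℚ ≤ s + ((+ 2 / 1) * ⟦ o ⟧ + ((+ 2 / 1) * ⟦ t ⟧ + (+ 2 / 1) * ⟦ not g ⟧))
    pointwise is-empty = decide≤
    pointwise is-edge = decide≤
    pointwise is-pair = decide≤
    pointwise is-triangle = decide≤
    pointwise (is-bad s≥ r≥ r≤) = +-monoˡ-≤ (+ 2 / 1) s≥

  module _ (T U : Vec Bool n) (tri : isTriangle C T ≡ true) (U₁ : wt U ≡ 1) (TU₄ : wt (T ⊕ U) ≡ 4) where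

    private
      R = T ⊕ U
      T₃ : wt T ≡ 3
      T₃ = ≡ᵇ-true (wt T) 3 (proj₁ (∧-true tri))
      combT : comb T C ≡ 𝟘
      combT = isZero⇒≡ (comb T C) (proj₂ (∧-true tri))

      -- A nonzero term needs S good and in the cycle space, hence empty or a triangle. If S is
      -- empty, S ⊕ R = R has weight four and is not good. If S is a triangle, S ⊕ R has the nonzero
      -- boundary of U, so it is good only with weight at most two; then S ⊕ T has even weight at
      -- most three and lies in the cycle space, which by simplicity gives S = T.
      vanish : ∀ S → eqv T S ≡ false → b S * ag (S ⊕ R) ≡ 0ℚ
      vanish S ≢T = go (good C S) (isZero (comb S C)) (good C (S ⊕ R)) refl refl refl
        where
        impossible : good C S ≡ true → isZero (comb S C) ≡ true → good C (S ⊕ R) ≡ true → ⊥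
        impossible gS zS gX = cases (wt S ℕₚ.≤? 2)
          where
          combS : comb S C ≡ 𝟘
          combS = isZero⇒≡ (comb S C) zS
          combX : comb (S ⊕ R) C ≡ comb U C
          combX = trans (comb-⊕ S R C) (trans (cong (_⊕ comb R C) combS) (trans (⊕-identityˡ (comb R C))
            (trans (comb-⊕ T U C) (trans (cong (_⊕ comb U C) combT) (⊕-identityˡ (comb U C))))))
          X-not-cycle : isZero (comb (S ⊕ R) C) ≡ false
          X-not-cycle = trans (cong isZero combX) (Simple-𝟘 U (subst (ℕ._≤ 2) (sym U₁) (s≤s z≤n)) (subst (1 ℕ.≤_) (sym U₁) (s≤s z≤n)))
          X≤2 : wt (S ⊕ R) ℕ.≤ 2
          X≤2 = go₂ (wt (S ⊕ R) ≤ᵇ 2) refl gX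
            where
            go₂ : ∀ p → (wt (S ⊕ R) ≤ᵇ 2) ≡ p → p ∨ isTriangle C (S ⊕ R) ≡ true → wt (S ⊕ R) ℕ.≤ 2
            go₂ true le _ = ℕₚ.≤ᵇ⇒≤ (wt (S ⊕ R)) 2 (Equivalence.from T-≡ le)
            go₂ false _ t = ⊥-elim (t≢f (trans (sym (proj₂ (∧-true {wt (S ⊕ R) ≡ᵇ 3} t))) X-not-cycle))
          cases : Dec (wt S ℕ.≤ 2) → ⊥
          cases (yes le) = ℕₚ.<⇒≱ (subst (2 ℕ.<_) (sym (trans (cong wt (trans (cong (_⊕ R) (simp S le combS)) (⊕-identityˡ R))) TU₄)) (s≤s (s≤s (s≤s z≤n)))) X≤2
          cases (no ≰) = t≢f (trans (sym (trans (cong (λ Y → eqv T Y) (⊕-zero⇒≡ (simp (S ⊕ T) even≤ combST))) (eqv-refl T))) ≢T)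
            where
            S₃ : wt S ≡ 3
            S₃ = ℕₚ.≤-antisym (good⇒wt≤3 S gS) (ℕₚ.≰⇒> ≰)
            ST≡ : (S ⊕ R) ⊕ U ≡ S ⊕ T
            ST≡ = trans (⊕-assoc S R U) (cong (S ⊕_) (trans (⊕-assoc T U U) (trans (cong (T ⊕_) (⊕-self U)) (⊕-identityʳ T))))
            ST≤3 : wt (S ⊕ T) ℕ.≤ 3
            ST≤3 = subst (λ Y → wt Y ℕ.≤ 3) ST≡ (ℕₚ.≤-trans (wt-⊕ (S ⊕ R) U) (ℕₚ.+-mono-≤ X≤2 (ℕₚ.≤-reflexive U₁)))
            even : odd (wt (S ⊕ T)) ≡ false
            even = trans (odd-⊕ S T) (cong₂ (λ i j → odd i xor odd j) S₃ T₃)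
            even≤ : wt (S ⊕ T) ℕ.≤ 2
            even≤ = below (wt (S ⊕ T)) ST≤3 even
              where
              below : ∀ i → i ℕ.≤ 3 → odd i ≡ false → i ℕ.≤ 2
              below 0 _ _ = z≤n
              below 2 _ _ = ℕₚ.≤-refl
              below (suc (suc (suc (suc i)))) (s≤s (s≤s (s≤s ()))) _
            combST : comb (S ⊕ T) C ≡ 𝟘
            combST = trans (comb-⊕ S T C) (trans (cong₂ _⊕_ combS combT) (⊕-self 𝟘))
        go : ∀ p z q → good C S ≡ p → isZero (comb S C) ≡ z → good C (S ⊕ R) ≡ q →
          ((⟦ p ⟧ * a S) * (sgn S * ⟦ z ⟧)) * (⟦ q ⟧ * a (S ⊕ R)) ≡ 0ℚ
        go false z q _ _ _ = l₁ (a S) (sgn S) ⟦ z ⟧ (⟦ q ⟧ * a (S ⊕ R))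
          where
          l₁ : ∀ u s z t → ((0ℚ * u) * (s * z)) * t ≡ 0ℚ
          l₁ = solve-∀ ℚ-ring
        go true false q _ _ _ = l₁ (a S) (sgn S) (⟦ q ⟧ * a (S ⊕ R))
          where
          l₁ : ∀ u s t → ((1ℚ * u) * (s * 0ℚ)) * t ≡ 0ℚ
          l₁ = solve-∀ ℚ-ring
        go true true false _ _ _ = l₁ (a S) (sgn S) (a (S ⊕ R))
          where
          l₁ : ∀ u s t → ((1ℚ * u) * (s * 1ℚ)) * (0ℚ * t) ≡ 0ℚ
          l₁ = solve-∀ ℚ-ring
        go true true true g z g′ = ⊥-elim (impossible g z g′)

    c-at : c R ≡ b T * ag U
    c-at = trans (∫-cong n (λ S → isolate S (eqv T S) refl)) (trans (Sum-point (λ S → b S * ag (S ⊕ R)) T) (cong (λ Y → b T * ag Y) (⊕-cancel T U)))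
      where
      isolate : ∀ S p → eqv T S ≡ p → b S * ag (S ⊕ R) ≡ ⟦ p ⟧ * (b S * ag (S ⊕ R))
      isolate S true _ = sym (*-identityˡ (b S * ag (S ⊕ R)))
      isolate S false e = trans (vanish S e) (sym (*-zeroˡ (b S * ag (S ⊕ R))))

    c²-at : c R * c R ≡ w T * w U
    c²-at = trans (cong₂ _*_ c-at c-at) (trans (cong₂ (λ p q → (((⟦ p ⟧ * a T) * (sgn T * ⟦ q ⟧)) * ag U) * (((⟦ p ⟧ * a T) * (sgn T * ⟦ q ⟧)) * ag U)) gT (proj₂ (∧-true {wt T ≡ᵇ 3} tri)))
      (trans (cong (λ p → (((1ℚ * a T) * (sgn T * 1ℚ)) * (⟦ p ⟧ * a U)) * (((1ℚ * a T) * (sgn T * 1ℚ)) * (⟦ p ⟧ * a U))) gU)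
        (trans (lem (a T) (sgn T) (a U)) (trans (cong (_* (w T * w U)) (sgn² T)) (*-identityˡ (w T * w U))))))
      where
      gT : good C T ≡ true
      gT = trans (cong (λ z → (wt T ≤ᵇ 2) ∨ z) tri) (∨-zeroʳ (wt T ≤ᵇ 2))
      gU : good C U ≡ true
      gU = cong (λ i → (i ≤ᵇ 2) ∨ ((i ≡ᵇ 3) ∧ isZero (comb U C))) U₁
      lem : ∀ t s u → (((1ℚ * t) * (s * 1ℚ)) * (1ℚ * u)) * (((1ℚ * t) * (s * 1ℚ)) * (1ℚ * u)) ≡ (s * s) * ((t * t) * (u * u))
      lem = solve-∀ ℚ-ring

  outside : Vec Bool n → Vec Bool n → Bool
  outside T U = (wt U ≡ᵇ 1) ∧ (wt (T ⊕ U) ≡ᵇ 4)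

  Z : Vec Bool n → ℚ
  Z T = ⟪ (λ U → ⟦ outside T U ⟧) ⟫

  -- Each pair (T, U) contributes the squared coefficient of `c` at R = T ⊕ U, and R determines T:
  -- two triangles that each differ from R in one edge differ from each other in at most two, so
  -- they coincide.
  ΣZ≤ : Sum (λ T → (w T * ⟦ isTriangle C T ⟧) * Z T) ≤ normsq c
  ΣZ≤ = subst (_≤ normsq c) (sym eq) (∫-mono 0≤1 0≤1 n (λ R → subst (_≤ c R * c R) (sym (∫-*ˡ n (c R * c R) (λ T → ⟦ K T (T ⊕ R) ⟧)))
      (subst (c R * c R * Sum (λ T → ⟦ K T (T ⊕ R) ⟧) ≤_) (*-identityʳ (c R * c R)) (*-monoˡ (0≤² (c R)) (Sum-unique (λ T → K T (T ⊕ R)) (uniq R))))))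
    where
    K : Vec Bool n → Vec Bool n → Bool
    K T U = isTriangle C T ∧ outside T U
    H : Vec Bool n → Vec Bool n → ℚ
    H T U = (c (T ⊕ U) * c (T ⊕ U)) * ⟦ K T U ⟧
    step : ∀ T U → (w T * ⟦ isTriangle C T ⟧) * (w U * ⟦ outside T U ⟧) ≡ H T U
    step T U = go (isTriangle C T) (outside T U) refl refl
      where
      go : ∀ p q → isTriangle C T ≡ p → outside T U ≡ q → (w T * ⟦ p ⟧) * (w U * ⟦ q ⟧) ≡ (c (T ⊕ U) * c (T ⊕ U)) * ⟦ p ∧ q ⟧
      go true true e e′ = trans (l₁ (w T) (w U)) (cong (_* 1ℚ) (sym (c²-at T U e (≡ᵇ-true (wt U) 1 (proj₁ (∧-true e′))) (≡ᵇ-true (wt (T ⊕ U)) 4 (proj₂ (∧-true {wt U ≡ᵇ 1} e′))))))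
        where
        l₁ : ∀ u v → (u * 1ℚ) * (v * 1ℚ) ≡ (u * v) * 1ℚ
        l₁ = solve-∀ ℚ-ring
      go true false _ _ = l₁ (w T) (w U) (c (T ⊕ U) * c (T ⊕ U))
        where
        l₁ : ∀ u v z → (u * 1ℚ) * (v * 0ℚ) ≡ z * 0ℚ
        l₁ = solve-∀ ℚ-ring
      go false q _ _ = l₁ (w T) (w U * ⟦ q ⟧) (c (T ⊕ U) * c (T ⊕ U))
        where
        l₁ : ∀ u v z → (u * 0ℚ) * v ≡ z * 0ℚ
        l₁ = solve-∀ ℚ-ring
    eq : Sum (λ T → (w T * ⟦ isTriangle C T ⟧) * Z T) ≡ Sum (λ R → Sum (λ T → (c R * c R) * ⟦ K T (T ⊕ R) ⟧))
    eq = trans (∫-cong n (λ T → trans (sym (∫-*ˡ n (w T * ⟦ isTriangle C T ⟧) (λ U → w U * ⟦ outside T U ⟧))) (trans (∫-cong n (step T))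
        (trans (sym (∫-shift n T (H T))) (∫-cong n (λ R → cong (λ Y → (c Y * c Y) * ⟦ K T (T ⊕ R) ⟧) (⊕-cancel T R)))))))
      (∫-swap n n (λ T R → (c R * c R) * ⟦ K T (T ⊕ R) ⟧))
    uniq : ∀ R S T → K S (S ⊕ R) ≡ true → K T (T ⊕ R) ≡ true → S ≡ T
    uniq R S T eS eT = ⊕-zero⇒≡ (simp (S ⊕ T) (subst (λ Y → wt Y ℕ.≤ 2) ST≡ (ℕₚ.≤-trans (wt-⊕ (S ⊕ R) (T ⊕ R)) (ℕₚ.+-mono-≤ (one S eS) (one T eT))))
        (trans (comb-⊕ S T C) (trans (cong₂ _⊕_ (cyc S eS) (cyc T eT)) (⊕-self 𝟘))))
      where
      one : ∀ S → K S (S ⊕ R) ≡ true → wt (S ⊕ R) ℕ.≤ 1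
      one S e = ℕₚ.≤-reflexive (≡ᵇ-true (wt (S ⊕ R)) 1 (proj₁ (∧-true (proj₂ (∧-true {isTriangle C S} e)))))
      cyc : ∀ S → K S (S ⊕ R) ≡ true → comb S C ≡ 𝟘
      cyc S e = isZero⇒≡ (comb S C) (proj₂ (∧-true {wt S ≡ᵇ 3} (proj₁ (∧-true e))))
      ST≡ : (S ⊕ R) ⊕ (T ⊕ R) ≡ S ⊕ T
      ST≡ = trans (⊕-assoc S R (T ⊕ R)) (cong (S ⊕_) (trans (cong (R ⊕_) (⊕-comm T R)) (⊕-cancel R T)))

  a-bounds : ∀ U → - α ≤ a U × a U ≤ α
  a-bounds U = subst (_≤ a U) (trans (∫-cong n (λ x → lem (f x))) (trans (∫-*ˡ n (- 1ℚ) f) (sym (lem α)))) (𝔼-mono (λ x → proj₁ (pointwise (F x) (χ U x) (χ-bounds x))))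
             , 𝔼-mono (λ x → proj₂ (pointwise (F x) (χ U x) (χ-bounds x)))
    where
    lem : ∀ u → - u ≡ - 1ℚ * u
    lem = solve-∀ ℚ-ring
    χ-bounds : ∀ x → - 1ℚ ≤ χ U x × χ U x ≤ 1ℚ
    χ-bounds x = subst (λ z → - 1ℚ ≤ z × z ≤ 1ℚ) (sym (trans (χ-sgn U x) (sgn-wt (U ∩ x)))) (go (odd (wt (U ∩ x))))
      where
      go : ∀ p → - 1ℚ ≤ sg p × sg p ≤ 1ℚ
      go true = decide≤ , decide≤
      go false = decide≤ , decide≤
    pointwise : ∀ p y → - 1ℚ ≤ y × y ≤ 1ℚ → - ⟦ p ⟧ ≤ ⟦ p ⟧ * y × ⟦ p ⟧ * y ≤ ⟦ p ⟧
    pointwise true y (lo , hi) = subst (- 1ℚ ≤_) (sym (*-identityˡ y)) lo , subst (_≤ 1ℚ) (sym (*-identityˡ y)) hi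
    pointwise false y _ = subst (0ℚ ≤_) (sym (*-zeroˡ y)) ≤-refl , subst (_≤ 0ℚ) (sym (*-zeroˡ y)) ≤-refl

  -- The cap that equalises the weights: about 3/64 must fit on three edges, none of which can
  -- exceed α² ≤ 1/64.
  w≤α² : ∀ U → w U ≤ α * α
  w≤α² U = ≤-by {w U} ((α - a U) * (a U - (- α))) (0≤* (0≤- (proj₂ (a-bounds U))) (0≤- (proj₁ (a-bounds U)))) (lem α (a U))
    where
    lem : ∀ α u → u * u + (α - u) * (u - (- α)) ≡ α * α
    lem = solve-∀ ℚ-ring

  W₁≤ : ∀ T (tri : isTriangle C T ≡ true) (sup : Support₃ T) → (let open Support₃ sup) → W₁ ≤ Z T + (w (unit i) + (w (unit j) + w (unit l)))
  W₁≤ T tri sup = subst (W₁ ≤_) eq (⟪⟫-mono (λ U → pointwise U (wt U ≡ᵇ 1) refl))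
    where
    open Support₃ sup
    E : Fin n → Vec Bool n → ℚ
    E u U = ⟦ eqv (unit u) U ⟧
    E-sum : ∀ u → ⟪ E u ⟫ ≡ w (unit u)
    E-sum u = trans (∫-cong n (λ U → *-comm (w U) (E u U))) (Sum-point w (unit u))
    eq : ⟪ (λ U → ⟦ outside T U ⟧ + (E i U + (E j U + E l U))) ⟫ ≡ Z T + (w (unit i) + (w (unit j) + w (unit l)))
    eq = trans (⟪⟫-+ (λ U → ⟦ outside T U ⟧) (λ U → E i U + (E j U + E l U))) (cong (λ z → Z T + z)
      (trans (⟪⟫-+ (E i) (λ U → E j U + E l U)) (cong₂ _+_ (E-sum i) (trans (⟪⟫-+ (E j) (E l)) (cong₂ _+_ (E-sum j) (E-sum l))))))
    0≤E : ∀ u U → 0ℚ ≤ E u U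
    0≤E u U = 0≤⟦⟧ (eqv (unit u) U)
    E-self : ∀ {u v} → u ≡ v → E v (unit u) ≡ 1ℚ
    E-self {u} refl = cong ⟦_⟧ (eqv-refl (unit u))
    left : ∀ {x y} → 0ℚ ≤ y → x ≤ x + y
    left {x} {y} h = subst (_≤ x + y) (+-identityʳ x) (+-monoʳ-≤ x h)
    right : ∀ {x y} → 0ℚ ≤ x → y ≤ x + y
    right {x} {y} h = subst (_≤ x + y) (+-identityˡ y) (+-monoˡ-≤ y h)
    at : ∀ u → 1ℚ ≤ ⟦ outside T (unit u) ⟧ + (E i (unit u) + (E j (unit u) + E l (unit u)))
    at u = go (lookup T u) refl
      where
      o = 0≤⟦⟧ (outside T (unit u))
      go : ∀ p → lookup T u ≡ p → 1ℚ ≤ ⟦ outside T (unit u) ⟧ + (E i (unit u) + (E j (unit u) + E l (unit u)))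
      go false e = ≤-trans (≤-reflexive (sym (cong ⟦_⟧ (cong₂ (λ p q → (p ≡ᵇ 1) ∧ (q ≡ᵇ 4)) (wt-unit u) (trans (wt-⊕-unit T u e) (cong suc (≡ᵇ-true (wt T) 3 (proj₁ (∧-true tri)))))))))
        (left (0≤+ (0≤E i (unit u)) (0≤+ (0≤E j (unit u)) (0≤E l (unit u)))))
      go true e = which (covers u e)
        where
        which : u ≡ i ⊎ u ≡ j ⊎ u ≡ l → 1ℚ ≤ ⟦ outside T (unit u) ⟧ + (E i (unit u) + (E j (unit u) + E l (unit u)))
        which (inj₁ p) = ≤-trans (≤-reflexive (sym (E-self p))) (≤-trans (left (0≤+ (0≤E j (unit u)) (0≤E l (unit u)))) (right o))
        which (inj₂ (inj₁ p)) = ≤-trans (≤-reflexive (sym (E-self p))) (≤-trans (≤-trans (left (0≤E l (unit u))) (right (0≤E i (unit u)))) (right o))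
        which (inj₂ (inj₂ p)) = ≤-trans (≤-reflexive (sym (E-self p))) (≤-trans (≤-trans (right (0≤E j (unit u))) (right (0≤E i (unit u)))) (right o))
    pointwise : ∀ U p → (wt U ≡ᵇ 1) ≡ p → ⟦ wt U ≡ᵇ 1 ⟧ ≤ ⟦ outside T U ⟧ + (E i U + (E j U + E l U))
    pointwise U false e = subst (λ p → ⟦ p ⟧ ≤ ⟦ outside T U ⟧ + (E i U + (E j U + E l U))) (sym e) (0≤+ (0≤⟦⟧ (outside T U)) (0≤+ (0≤E i U) (0≤+ (0≤E j U) (0≤E l U))))
    pointwise U true e = ≤-trans (⟦⟧≤1 (wt U ≡ᵇ 1)) (subst (λ Y → 1ℚ ≤ ⟦ outside T Y ⟧ + (E i Y + (E j Y + E l Y))) (sym (proj₂ single)) (at (proj₁ single)))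
      where single = wt≡1⇒unit U (≡ᵇ-true (wt U) 1 e)

  -- From large edge coefficients to a nearby junta

  record NearJunta (ε : ℚ) : Set where
    constructor nearJunta
    field
      i j l : Fin n
      i≢j : i ≢ j
      j≢l : j ≢ l
      i≢l : i ≢ l
      cycle : lookup C i ⊕ (lookup C j ⊕ lookup C l) ≡ 𝟘
      s t u : Bool
      close : 𝔼 (λ x → ⟦ ((lookup x i ≐ s) ∧ (lookup x j ≐ t) ∧ (lookup x l ≐ u)) xor F x ⟧) ≤ C₀ * ε

  -- `a (unit i)` measures the bias of coordinate i within the family: the mass on the minority
  -- value is half of α - |`a (unit i)`|. The witness s is the majority value.
  deficit : ∀ (i : Fin n) δ → (+ 1 / 64) - δ ≤ w (unit i) → ∃ λ s → 𝔼 (λ x → f x * ⟦ lookup x i xor s ⟧) ≤ (+ 4 / 1) * δ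
  deficit i δ h = s , subst (_≤ (+ 4 / 1) * δ) (sym eq) (deficit-bound α t δ α≤⅛ 0≤t (t≤ s) (subst ((+ 1 / 64) - δ ≤_) (sym t²) h))
    where
    s = proj₁ (sign-of (a (unit i)))
    0≤t = proj₂ (sign-of (a (unit i)))
    t = sg s * a (unit i)
    l₀ : ∀ u v → (u * v) * (u * v) ≡ (u * u) * (v * v)
    l₀ = solve-∀ ℚ-ring
    t² : t * t ≡ w (unit i)
    t² = trans (l₀ (sg s) (a (unit i))) (trans (cong (_* w (unit i)) (sg² s)) (*-identityˡ (w (unit i))))
    l₁ : ∀ u → - 1ℚ * u ≡ - u
    l₁ = solve-∀ ℚ-ring
    t≤ : ∀ s → sg s * a (unit i) ≤ α
    t≤ true = subst₂ _≤_ (sym (l₁ (a (unit i)))) (neg-neg α) (neg-antimono-≤ (proj₁ (a-bounds (unit i))))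
      where
      neg-neg : ∀ u → - (- u) ≡ u
      neg-neg = solve-∀ ℚ-ring
    t≤ false = subst (_≤ α) (sym (*-identityˡ (a (unit i)))) (proj₂ (a-bounds (unit i)))
    bits : ∀ p s → ⟦ p xor s ⟧ ≡ ½ * (1ℚ - sg s * sg p)
    bits true true = refl
    bits true false = refl
    bits false true = refl
    bits false false = refl
    l₂ : ∀ u s c → u * (½ * (1ℚ - s * c)) ≡ ½ * u + (- ½ * s) * (u * c)
    l₂ = solve-∀ ℚ-ring
    l₃ : ∀ α s v → ½ * α + (- ½ * s) * v ≡ ½ * (α - s * v)
    l₃ = solve-∀ ℚ-ring
    eq : 𝔼 (λ x → f x * ⟦ lookup x i xor s ⟧) ≡ ½ * (α - t)
    eq = trans (∫-cong n (λ x → trans (cong (f x *_) (trans (bits (lookup x i) s) (cong (λ z → ½ * (1ℚ - sg s * z)) (sym (χ-unit i x))))) (l₂ (f x) (sg s) (χ (unit i) x))))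
      (trans (∫-+ n (λ x → ½ * f x) (λ x → (- ½ * sg s) * (f x * χ (unit i) x))) (trans (cong₂ _+_ (∫-*ˡ n ½ f) (∫-*ˡ n (- ½ * sg s) (λ x → f x * χ (unit i) x)))
        (l₃ α (sg s) (a (unit i)))))

  -- The symmetric difference has measure μ(J) - μ(F) + 2μ(F minus J), and F minus J is covered by
  -- the three events that a coordinate takes its minority value. The errors ⅛ - α ≤ ε and 3 · 2 ·
  -- 4Dε add up to C₀ε.
  close-from-deficits : ∀ ε (i j l : Fin n) s t u → i ≢ j → j ≢ l → i ≢ l → ⅛ - ε ≤ α →
    𝔼 (λ x → f x * ⟦ lookup x i xor s ⟧) ≤ (+ 4 / 1) * (D * ε) → 𝔼 (λ x → f x * ⟦ lookup x j xor t ⟧) ≤ (+ 4 / 1) * (D * ε) → 𝔼 (λ x → f x * ⟦ lookup x l xor u ⟧) ≤ (+ 4 / 1) * (D * ε) →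
    𝔼 (λ x → ⟦ ((lookup x i ≐ s) ∧ (lookup x j ≐ t) ∧ (lookup x l ≐ u)) xor F x ⟧) ≤ C₀ * ε
  close-from-deficits ε i j l s t u i≢j j≢l i≢l ε≥ h₁ h₂ h₃ = ≤-trans
    (subst (𝔼 (λ x → ⟦ J x xor F x ⟧) ≤_) eq (𝔼-mono (λ x → pointwise (F x) (lookup x i xor s) (lookup x j xor t) (lookup x l xor u))))
    (subst (λ z → (⅛ - α) + ((+ 2 / 1) * P + (+ 2 / 1) * Q + (+ 2 / 1) * R) ≤ z * ε) (sym C₀≡) (fin α ε D P Q R ε≥ h₁ h₂ h₃))
    where
    J : Vec Bool n → Bool
    J x = (lookup x i ≐ s) ∧ (lookup x j ≐ t) ∧ (lookup x l ≐ u)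
    P Q R : ℚ
    P = 𝔼 (λ x → f x * ⟦ lookup x i xor s ⟧)
    Q = 𝔼 (λ x → f x * ⟦ lookup x j xor t ⟧)
    R = 𝔼 (λ x → f x * ⟦ lookup x l xor u ⟧)
    2ℚ : ℚ
    2ℚ = + 2 / 1
    pointwise : ∀ F p q r → ⟦ (not p ∧ not q ∧ not r) xor F ⟧ ≤ (⟦ not p ∧ not q ∧ not r ⟧ - ⟦ F ⟧) + (2ℚ * (⟦ F ⟧ * ⟦ p ⟧) + 2ℚ * (⟦ F ⟧ * ⟦ q ⟧) + 2ℚ * (⟦ F ⟧ * ⟦ r ⟧))
    pointwise true true true true = decide≤
    pointwise true true true false = decide≤
    pointwise true true false true = decide≤
    pointwise true true false false = decide≤
    pointwise true false true true = decide≤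
    pointwise true false true false = decide≤
    pointwise true false false true = decide≤
    pointwise true false false false = decide≤
    pointwise false true q r = lem ⟦ q ⟧ ⟦ r ⟧
      where
      lem′ : ∀ q r → (0ℚ - 0ℚ) + ((+ 2 / 1) * (0ℚ * 1ℚ) + (+ 2 / 1) * (0ℚ * q) + (+ 2 / 1) * (0ℚ * r)) ≡ 0ℚ
      lem′ = solve-∀ ℚ-ring
      lem : ∀ q r → 0ℚ ≤ (0ℚ - 0ℚ) + ((+ 2 / 1) * (0ℚ * 1ℚ) + (+ 2 / 1) * (0ℚ * q) + (+ 2 / 1) * (0ℚ * r))
      lem q r = ≤-reflexive (sym (lem′ q r))
    pointwise false false true r = lem ⟦ r ⟧
      where
      lem′ : ∀ r → (0ℚ - 0ℚ) + ((+ 2 / 1) * (0ℚ * 0ℚ) + (+ 2 / 1) * (0ℚ * 1ℚ) + (+ 2 / 1) * (0ℚ * r)) ≡ 0ℚ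
      lem′ = solve-∀ ℚ-ring
      lem : ∀ r → 0ℚ ≤ (0ℚ - 0ℚ) + ((+ 2 / 1) * (0ℚ * 0ℚ) + (+ 2 / 1) * (0ℚ * 1ℚ) + (+ 2 / 1) * (0ℚ * r))
      lem r = ≤-reflexive (sym (lem′ r))
    pointwise false false false true = decide≤
    pointwise false false false false = decide≤
    eq : 𝔼 (λ x → (⟦ J x ⟧ - f x) + (2ℚ * (f x * ⟦ lookup x i xor s ⟧) + 2ℚ * (f x * ⟦ lookup x j xor t ⟧) + 2ℚ * (f x * ⟦ lookup x l xor u ⟧)))
      ≡ (⅛ - α) + (2ℚ * P + 2ℚ * Q + 2ℚ * R)
    eq = trans (∫-+ n (λ x → ⟦ J x ⟧ - f x) (λ x → 2ℚ * (f x * ⟦ lookup x i xor s ⟧) + 2ℚ * (f x * ⟦ lookup x j xor t ⟧) + 2ℚ * (f x * ⟦ lookup x l xor u ⟧)))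
      (cong₂ _+_ (trans (∫-- n (λ x → ⟦ J x ⟧) f) (cong (_- α) (trans (∫-coord₃ {½} {½} refl i≢j j≢l i≢l s t u) (eighth s t u))))
        (∫-lin₃ n 2ℚ 2ℚ 2ℚ (λ x → f x * ⟦ lookup x i xor s ⟧) (λ x → f x * ⟦ lookup x j xor t ⟧) (λ x → f x * ⟦ lookup x l xor u ⟧)))
      where
      wh : ∀ s → weight {½} {½} refl s ≡ ½
      wh true = refl
      wh false = refl
      eighth : ∀ s t u → weight {½} {½} refl s * (weight {½} {½} refl t * weight {½} {½} refl u) ≡ ⅛
      eighth s t u = cong₂ _*_ (wh s) (cong₂ _*_ (wh t) (wh u))
    fin : ∀ α ε D P Q R → ⅛ - ε ≤ α → P ≤ (+ 4 / 1) * (D * ε) → Q ≤ (+ 4 / 1) * (D * ε) → R ≤ (+ 4 / 1) * (D * ε) →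
      (⅛ - α) + ((+ 2 / 1) * P + (+ 2 / 1) * Q + (+ 2 / 1) * R) ≤ (1ℚ + (+ 24 / 1) * D) * ε
    fin α ε D P Q R hε hP hQ hR = ≤-by {(⅛ - α) + ((+ 2 / 1) * P + (+ 2 / 1) * Q + (+ 2 / 1) * R)}
        ((α - (⅛ - ε)) + (+ 2 / 1) * (((+ 4 / 1) * (D * ε) - P) + ((+ 4 / 1) * (D * ε) - Q) + ((+ 4 / 1) * (D * ε) - R)))
        (0≤+ (0≤- hε) (0≤* (decide≤ {0ℚ} {+ 2 / 1}) (0≤+ (0≤+ (0≤- hP) (0≤- hQ)) (0≤- hR)))) (lem α ε D P Q R)
      where
      lem : ∀ α ε D P Q R → ((+ 1 / 8) - α) + ((+ 2 / 1) * P + (+ 2 / 1) * Q + (+ 2 / 1) * R)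
        + ((α - ((+ 1 / 8) - ε)) + (+ 2 / 1) * (((+ 4 / 1) * (D * ε) - P) + ((+ 4 / 1) * (D * ε) - Q) + ((+ 4 / 1) * (D * ε) - R))) ≡ (1ℚ + (+ 24 / 1) * D) * ε
      lem = solve-∀ ℚ-ring

  stability : ∀ ε → 0ℚ ≤ ε → (+ 2097280 / 1) * ε ≤ 1ℚ → ⅛ - ε ≤ α → NearJunta ε
  -- The triangles carry weight at least 1/128, so for some triangle the edges outside it weigh at
  -- most 128 times the bound on `normsq c`.
  stability ε 0≤ε small ε≥ = go (averaging (λ T → w T * ⟦ isTriangle C T ⟧) Z avg (λ T → 0≤* (0≤w T) (0≤⟦⟧ (isTriangle C T)))
      (<-≤-trans (from-yes (0ℚ <? (+ 1 / 128))) W₃≥) (≤-trans ΣZ≤ (≤-trans normsq-c scale)))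
    where
    N₆ Q₀ avg : ℚ
    N₆ = 9ℚ ^ 6
    Q₀ = N₆ * ((+ 9 / 1) * Wb)
    avg = (+ 128 / 1) * Q₀
    W₃≥ : + 1 / 128 ≤ W₃
    W₃≥ = W₃-bound α ε Wb W₃ 0≤ε ε≥ (Wb≤ ε ε≥) small α²-Wb≤W₃
    0≤Q₀ : 0ℚ ≤ Q₀
    0≤Q₀ = 0≤* (0≤9^ 6) (0≤* (decide≤ {0ℚ} {+ 9 / 1}) 0≤Wb)
    scale : Q₀ ≤ avg * W₃
    scale = ≤-by {Q₀} ((+ 128 / 1) * (Q₀ * (W₃ - (+ 1 / 128)))) (0≤* (decide≤ {0ℚ} {+ 128 / 1}) (0≤* 0≤Q₀ (0≤- W₃≥))) (lem Q₀ W₃)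
      where
      lem : ∀ q v → q + (+ 128 / 1) * (q * (v - (+ 1 / 128))) ≡ (+ 128 / 1) * q * v
      lem = solve-∀ ℚ-ring
    go : (∃ λ T → 0ℚ < w T * ⟦ isTriangle C T ⟧ × Z T ≤ avg) → NearJunta ε
    go (T , pos , Z≤) = nearJunta i j l i≢j j≢l i≢l cyc (proj₁ dᵢ) (proj₁ dⱼ) (proj₁ dₗ)
        (close-from-deficits ε i j l (proj₁ dᵢ) (proj₁ dⱼ) (proj₁ dₗ) i≢j j≢l i≢l ε≥ (proj₂ dᵢ) (proj₂ dⱼ) (proj₂ dₗ))
      where
      tri : isTriangle C T ≡ true
      tri = from-pos (isTriangle C T) pos
        where
        from-pos : ∀ p → 0ℚ < w T * ⟦ p ⟧ → p ≡ true
        from-pos true _ = refl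
        from-pos false lt = ⊥-elim (<-irrefl refl (subst (0ℚ <_) (*-zeroʳ (w T)) lt))
      sup : Support₃ T
      sup = wt≡3⇒Support₃ T (≡ᵇ-true (wt T) 3 (proj₁ (∧-true tri)))
      open Support₃ sup
      cyc : lookup C i ⊕ (lookup C j ⊕ lookup C l) ≡ 𝟘
      cyc = trans (sym (cong₂ _⊕_ (comb-unit i C) (cong₂ _⊕_ (comb-unit j C) (comb-unit l C))))
        (trans (sym (trans (comb-⊕ (unit i) (unit j ⊕ unit l) C) (cong (comb (unit i) C ⊕_) (comb-⊕ (unit j) (unit l) C))))
          (trans (cong (λ Y → comb Y C) (sym T≡)) (isZero⇒≡ (comb T C) (proj₂ (∧-true {wt T ≡ᵇ 3} tri)))))
      bound : ∀ x y z → W₁ ≤ Z T + (w (unit x) + (w (unit y) + w (unit z))) → (+ 1 / 64) - D * ε ≤ w (unit x)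
      bound x y z h = subst (λ d → (+ 1 / 64) - d * ε ≤ w (unit x)) (sym D≡) (coefficient-bound α ε Wb W₁ W₃ (Z T) N₆ (+ 16384 / 1) (w (unit x)) (w (unit y)) (w (unit z)) (0≤9^ 6) 0≤α α≤⅛ ε≥ (Wb≤ ε ε≥) α≤2W W₃≤α²+Wb Z≤ h (w≤α² (unit y)) (w≤α² (unit z)))
      W₁-i = W₁≤ T tri sup
      rot : ∀ p q r → p + (q + r) ≡ q + (r + p)
      rot = solve-∀ ℚ-ring
      W₁-j : W₁ ≤ Z T + (w (unit j) + (w (unit l) + w (unit i)))
      W₁-j = subst (λ y → W₁ ≤ Z T + y) (rot (w (unit i)) (w (unit j)) (w (unit l))) W₁-i
      W₁-l : W₁ ≤ Z T + (w (unit l) + (w (unit i) + w (unit j)))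
      W₁-l = subst (λ y → W₁ ≤ Z T + y) (rot (w (unit j)) (w (unit l)) (w (unit i))) W₁-j
      dᵢ = deficit i (D * ε) (bound i j l W₁-i)
      dⱼ = deficit j (D * ε) (bound j l i W₁-j)
      dₗ = deficit l (D * ε) (bound l i j W₁-l)

-- Subgraphs of the complete graph

Unique⇒lookup-injective : ∀ {A : Set} {xs : List A} → Unique xs → ∀ i j → List.lookup xs i ≡ List.lookup xs j → i ≡ j
Unique⇒lookup-injective (x ∷ u) zero zero e = refl
Unique⇒lookup-injective (x ∷ u) zero (suc j) e = ⊥-elim (All.lookup x (∈-lookup j) e)
Unique⇒lookup-injective (x ∷ u) (suc i) zero e = ⊥-elim (All.lookup x (∈-lookup i) (sym e))
Unique⇒lookup-injective (x ∷ u) (suc i) (suc j) e = cong suc (Unique⇒lookup-injective u i j e)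

isYes-true : ∀ {P : Set} (d : Dec P) → P → ⌊ d ⌋ ≡ true
isYes-true (yes _) _ = refl
isYes-true (no ¬p) p = ⊥-elim (¬p p)

or : ∀ {k} → Vec Bool k → Bool
or = Vec.foldr _ _∨_ false

or-tabulate⁻ : ∀ {k} (g : Fin k → Bool) → or (tabulate g) ≡ true → ∃ λ i → g i ≡ true
or-tabulate⁻ {suc k} g h with g zero in e
... | true = zero , e
... | false with or-tabulate⁻ (g ∘ suc) h
... | i , p = suc i , p

or-tabulate⁺ : ∀ {k} (g : Fin k → Bool) i → g i ≡ true → or (tabulate g) ≡ true
or-tabulate⁺ g zero e rewrite e = refl
or-tabulate⁺ g (suc i) e rewrite or-tabulate⁺ (g ∘ suc) i e = ∨-zeroʳ (g zero)

%2⇒odd : ∀ k → k % 2 ≡ 1 → odd k ≡ true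
%2⇒odd 1 e = refl
%2⇒odd (suc (suc k)) e = trans (not-involutive (odd k)) (%2⇒odd k (trans (sym ([m+n]%n≡m%n k 2)) (trans (cong (_% 2) (ℕₚ.+-comm k 2)) e)))

-- κ is a proper two-colouring, and the colour alternates along the walk around the cycle.
no-odd-cycle : ∀ {n} (G : Graph n) (κ : Vec Bool n) → (∀ {u v} → HasEdge G u v → lookup κ u xor lookup κ v ≡ true) → HasOddCycle G → ⊥
no-odd-cycle G κ bip ([] , _ , () , _)
no-odd-cycle {n} G κ bip (v ∷ vs , _ , _ , odd-len , cyc) = t≢f (trans (sym (%2⇒odd (suc (length vs)) odd-len)) (self (lookup κ v) (odd (suc (length vs))) (walk v vs v cyc)))
  where
  self : ∀ a p → a ≡ p xor a → p ≡ false
  self true true ()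
  self false true ()
  self a false _ = refl
  flip : ∀ a b c p → a xor b ≡ true → c ≡ p xor b → c ≡ not p xor a
  flip true false c true h e = e
  flip true false c false h e = e
  flip false true c true h e = e
  flip false true c false h e = e
  walk : ∀ x vs z → Path G (x ∷ vs ++ [ z ]) → lookup κ z ≡ odd (suc (length vs)) xor lookup κ x
  walk x [] z (h , _) = flip (lookup κ x) (lookup κ z) (lookup κ z) false (bip h) refl
  walk x (y ∷ vs) z (h , p) = flip (lookup κ x) (lookup κ y) (lookup κ z) (odd (suc (length vs))) (bip h) (walk y vs z p)

dot-unit : ∀ {m} (i : Fin m) κ → dot (unit i) κ ≡ lookup κ i
dot-unit zero (b ∷ κ) = trans (cong (b xor_) (dot-𝟘ˡ κ)) (xor-identityʳ b)
dot-unit (suc i) (b ∷ κ) = dot-unit i κ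

lookup-∼ : ∀ {k} (x : Vec Bool k) i → lookup (∼ x) i ≡ not (lookup x i)
lookup-∼ x i = lookup-map i not x

module EdgeSpace (n : ℕ) where

  private
    row : Fin n → List (Fin n × Fin n)
    row i = List.map (i ,_) (filter (λ j → i Fin.<? j) (allFin n))

    ∈-row : ∀ {i e} → e ∈ row i → proj₁ e ≡ i × i Fin.< proj₂ e
    ∈-row {i} e∈ with ∈-map⁻ (i ,_) e∈
    ... | j , j∈ , refl = refl , proj₂ (∈-filter⁻ (i Fin.<?_) {xs = allFin n} j∈)

  opaque
    edge : Fin (N n) → Fin n × Fin n
    edge = List.lookup (edgeList n)

    edge-< : ∀ k → proj₁ (edge k) Fin.< proj₂ (edge k)
    edge-< k with Any.satisfied (∈-concatMap⁻ row {xs = allFin n} (∈-lookup k))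
    ... | i , e∈ with ∈-row {i} e∈
    ... | refl , lt = lt

  edge-≢ : ∀ k → proj₁ (edge k) ≢ proj₂ (edge k)
  edge-≢ k e = ℕₚ.<-irrefl (cong Fin.toℕ e) (edge-< k)

  opaque
    unfolding edge

    edge-injective : ∀ {k l} → edge k ≡ edge l → k ≡ l
    edge-injective {k} {l} = Unique⇒lookup-injective unique k l
      where
      unique : Unique (edgeList n)
      unique = Uniqueₚ.concat⁺ (Allₚ.map⁺ (All.universal (λ i → Uniqueₚ.map⁺ (λ { refl → refl }) (Uniqueₚ.filter⁺ (i Fin.<?_) (Uniqueₚ.allFin⁺ n))) (allFin n)))
        (AllPairsₚ.map⁺ (AllPairs.map (λ i≢j {e} (e∈ , e∈′) → i≢j (trans (sym (proj₁ (∈-row e∈))) (proj₁ (∈-row e∈′)))) (Uniqueₚ.allFin⁺ n)))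

  IsEdge : Fin (N n) → Fin n → Fin n → Set
  IsEdge k u v = edge k ≡ (u , v) ⊎ edge k ≡ (v , u)

  IsEdge-sym : ∀ {k u v} → IsEdge k u v → IsEdge k v u
  IsEdge-sym (inj₁ e) = inj₂ e
  IsEdge-sym (inj₂ e) = inj₁ e

  opaque
    unfolding edge

    find-< : ∀ {u v : Fin n} → u Fin.< v → ∃ λ k → edge k ≡ (u , v)
    find-< {u} {v} lt = Any.index e∈ , sym (lookup-index e∈)
      where
      e∈ : (u , v) ∈ edgeList n
      e∈ = ∈-concatMap⁺ row {xs = allFin n} (Any.map (λ { refl → ∈-map⁺ (u ,_) (∈-filter⁺ (u Fin.<?_) (∈-allFin v) lt) }) (∈-allFin u))

  find-edge : ∀ {u v : Fin n} → u ≢ v → ∃ λ k → IsEdge k u v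
  find-edge {u} {v} u≢v with ℕₚ.<-cmp (Fin.toℕ u) (Fin.toℕ v)
  ... | tri< lt _ _ = proj₁ (find-< lt) , inj₁ (proj₂ (find-< lt))
  ... | tri≈ _ e _ = ⊥-elim (u≢v (Finₚ.toℕ-injective e))
  ... | tri> _ _ gt = proj₁ (find-< gt) , inj₂ (proj₂ (find-< gt))

  IsEdge-unique : ∀ {k l u v} → IsEdge k u v → IsEdge l u v → k ≡ l
  IsEdge-unique {k} {l} (inj₁ p) (inj₁ q) = edge-injective (trans p (sym q))
  IsEdge-unique {k} {l} (inj₂ p) (inj₂ q) = edge-injective (trans p (sym q))
  IsEdge-unique {k} {l} (inj₁ p) (inj₂ q) = ⊥-elim (ℕₚ.<-asym (subst (λ e → proj₁ e Fin.< proj₂ e) p (edge-< k)) (subst (λ e → proj₁ e Fin.< proj₂ e) q (edge-< l)))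
  IsEdge-unique {k} {l} (inj₂ p) (inj₁ q) = ⊥-elim (ℕₚ.<-asym (subst (λ e → proj₁ e Fin.< proj₂ e) p (edge-< k)) (subst (λ e → proj₁ e Fin.< proj₂ e) q (edge-< l)))

  IsEdge-≢ : ∀ {k u v} → IsEdge k u v → u ≢ v
  IsEdge-≢ {k} (inj₁ p) refl = edge-≢ k (trans (cong proj₁ p) (sym (cong proj₂ p)))
  IsEdge-≢ {k} (inj₂ p) refl = edge-≢ k (trans (cong proj₁ p) (sym (cong proj₂ p)))

  matches : Fin n → Fin n → Fin n × Fin n → Bool
  matches u v e = (⌊ proj₁ e Fin.≟ u ⌋ ∧ ⌊ proj₂ e Fin.≟ v ⌋) ∨ (⌊ proj₁ e Fin.≟ v ⌋ ∧ ⌊ proj₂ e Fin.≟ u ⌋)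

  matches⇒IsEdge : ∀ {u v} k → matches u v (edge k) ≡ true → IsEdge k u v
  matches⇒IsEdge {u} {v} k h with proj₁ (edge k) Fin.≟ u | proj₂ (edge k) Fin.≟ v | proj₁ (edge k) Fin.≟ v | proj₂ (edge k) Fin.≟ u
  ... | yes p | yes q | _ | _ = inj₁ (cong₂ _,_ p q)
  ... | yes _ | no _ | yes p | yes q = inj₂ (cong₂ _,_ p q)
  ... | no _ | yes _ | yes p | yes q = inj₂ (cong₂ _,_ p q)
  ... | no _ | no _ | yes p | yes q = inj₂ (cong₂ _,_ p q)

  IsEdge⇒matches : ∀ {u v} k → IsEdge k u v → matches u v (edge k) ≡ true
  IsEdge⇒matches {u} {v} k (inj₁ p) = cong (_∨ (⌊ proj₁ (edge k) Fin.≟ v ⌋ ∧ ⌊ proj₂ (edge k) Fin.≟ u ⌋))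
    (cong₂ _∧_ (isYes-true (proj₁ (edge k) Fin.≟ u) (cong proj₁ p)) (isYes-true (proj₂ (edge k) Fin.≟ v) (cong proj₂ p)))
  IsEdge⇒matches {u} {v} k (inj₂ p) = trans (cong ((⌊ proj₁ (edge k) Fin.≟ u ⌋ ∧ ⌊ proj₂ (edge k) Fin.≟ v ⌋) ∨_)
    (cong₂ _∧_ (isYes-true (proj₁ (edge k) Fin.≟ v) (cong proj₁ p)) (isYes-true (proj₂ (edge k) Fin.≟ u) (cong proj₂ p)))) (∨-zeroʳ _)

  opaque
    unfolding edge

    HasEdge⁻ : ∀ (G : Graph n) {u v} → HasEdge G u v → ∃ λ k → IsEdge k u v × lookup (edgeVec G) k ≡ true
    HasEdge⁻ G {u} {v} h with or-tabulate⁻ (λ k → lookup (edgeVec G) k ∧ matches u v (edge k)) h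
    ... | k , e = k , matches⇒IsEdge k (proj₂ (∧-true {lookup (edgeVec G) k} e)) , proj₁ (∧-true e)

    HasEdge⁺ : ∀ (G : Graph n) {u v} k → IsEdge k u v → lookup (edgeVec G) k ≡ true → HasEdge G u v
    HasEdge⁺ G {u} {v} k ie e = or-tabulate⁺ (λ k → lookup (edgeVec G) k ∧ matches u v (edge k)) k (cong₂ _∧_ e (IsEdge⇒matches k ie))

  edgeB≡lookup : ∀ (G : Graph n) {u v} k → IsEdge k u v → edgeB G u v ≡ lookup (edgeVec G) k
  edgeB≡lookup G {u} {v} k ie = go (lookup (edgeVec G) k) (edgeB G u v) refl refl
    where
    go : ∀ p q → lookup (edgeVec G) k ≡ p → edgeB G u v ≡ q → q ≡ p
    go true q e e′ = trans (sym e′) (HasEdge⁺ G k ie e)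
    go false true e e′ with HasEdge⁻ G e′
    ... | l , ie′ , e″ = ⊥-elim (t≢f (trans (sym e″) (trans (cong (lookup (edgeVec G)) (IsEdge-unique ie′ ie)) e)))
    go false false _ _ = refl

  HasOddCycle-mono : ∀ (G H : Graph n) → (∀ k → lookup (edgeVec G) k ≡ true → lookup (edgeVec H) k ≡ true) → HasOddCycle G → HasOddCycle H
  HasOddCycle-mono G H sub (vs , uniq , len , odd-len , cyc) = vs , uniq , len , odd-len , cycle vs cyc
    where
    step : ∀ {u v} → HasEdge G u v → HasEdge H u v
    step h with HasEdge⁻ G h
    ... | k , ie , e = HasEdge⁺ H k ie (sub k e)
    path : ∀ vs → Path G vs → Path H vs
    path [] _ = tt
    path (x ∷ []) _ = tt
    path (x ∷ y ∷ r) (h , p) = step h , path (y ∷ r) p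
    cycle : ∀ vs → CycleEdges G vs → CycleEdges H vs
    cycle (v ∷ vs) p = path (v ∷ vs ++ [ v ]) p

  -- Edge uv becomes the vector δᵤ + δᵥ, so that its product with κ tells whether κ separates u and v.
  opaque
    columns : Vec (Vec Bool n) (N n)
    columns = tabulate (λ k → unit (proj₁ (edge k)) ⊕ unit (proj₂ (edge k)))

    lookup-columns : ∀ k → lookup columns k ≡ unit (proj₁ (edge k)) ⊕ unit (proj₂ (edge k))
    lookup-columns k = lookup∘tabulate _ k

  lookup-cut : ∀ κ k → lookup (cut columns κ) k ≡ lookup κ (proj₁ (edge k)) xor lookup κ (proj₂ (edge k))
  lookup-cut κ k = trans (lookup-map k (λ c → dot c κ) columns) (trans (cong (λ c → dot c κ) (lookup-columns k))
    (trans (dot-⊕ (unit (proj₁ (edge k))) (unit (proj₂ (edge k))) κ) (cong₂ _xor_ (dot-unit (proj₁ (edge k)) κ) (dot-unit (proj₂ (edge k)) κ))))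

  inc : Fin (N n) → Fin n → Bool
  inc k x = lookup (lookup columns k) x

  private
    inc≡ : ∀ k x → inc k x ≡ lookup (unit (proj₁ (edge k))) x xor lookup (unit (proj₂ (edge k))) x
    inc≡ k x = trans (cong (λ c → lookup c x) (lookup-columns k)) (lookup-zipWith _xor_ x (unit (proj₁ (edge k))) (unit (proj₂ (edge k))))

  inc-fst : ∀ k → inc k (proj₁ (edge k)) ≡ true
  inc-fst k = trans (inc≡ k (proj₁ (edge k))) (cong₂ _xor_ (lookup-unit (proj₁ (edge k))) (lookup-unit′ (edge-≢ k)))

  inc-snd : ∀ k → inc k (proj₂ (edge k)) ≡ true
  inc-snd k = trans (inc≡ k (proj₂ (edge k))) (cong₂ _xor_ (lookup-unit′ (edge-≢ k ∘ sym)) (lookup-unit (proj₂ (edge k))))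

  inc⁻ : ∀ k x → inc k x ≡ true → ∃ λ z → IsEdge k x z
  inc⁻ k x h with x Fin.≟ proj₁ (edge k) | x Fin.≟ proj₂ (edge k)
  ... | yes refl | _ = proj₂ (edge k) , inj₁ refl
  ... | no _ | yes refl = proj₁ (edge k) , inj₂ refl
  ... | no p | no q = ⊥-elim (t≢f (trans (sym h) (trans (inc≡ k x) (cong₂ _xor_ (lookup-unit′ p) (lookup-unit′ q)))))

  inc⁺ : ∀ {k x z} → IsEdge k x z → inc k x ≡ true
  inc⁺ {k} (inj₁ e) = subst (λ y → inc k y ≡ true) (cong proj₁ e) (inc-fst k)
  inc⁺ {k} (inj₂ e) = subst (λ y → inc k y ≡ true) (cong proj₂ e) (inc-snd k)

  inc-ends : ∀ {k x z w} → IsEdge k x z → inc k w ≡ true → w ≡ x ⊎ w ≡ z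
  inc-ends {k} {x} {z} {w} ie h with inc⁻ k w h
  inc-ends (inj₁ e) h | _ , inj₁ e′ = inj₁ (cong proj₁ (trans (sym e′) e))
  inc-ends (inj₁ e) h | _ , inj₂ e′ = inj₂ (cong proj₂ (trans (sym e′) e))
  inc-ends (inj₂ e) h | _ , inj₁ e′ = inj₂ (cong proj₁ (trans (sym e′) e))
  inc-ends (inj₂ e) h | _ , inj₂ e′ = inj₁ (cong proj₂ (trans (sym e′) e))

  IsEdge-from-inc : ∀ {k x z} → x ≢ z → inc k x ≡ true → inc k z ≡ true → IsEdge k x z
  IsEdge-from-inc {k} {x} {z} x≢z hx hz with inc⁻ k x hx
  ... | y , ie with inc-ends ie hz
  ... | inj₁ e = ⊥-elim (x≢z (sym e))
  ... | inj₂ refl = ie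

  columns-simple : Simple columns
  columns-simple S le e = go (wt S) refl le
    where
    col = columns
    single : ∀ k → lookup col k ≢ 𝟘
    single k h = t≢f (trans (sym (inc-fst k)) (trans (cong (λ c → lookup c (proj₁ (edge k))) h) (lookup-𝟘 (proj₁ (edge k)))))
    go : ∀ i → wt S ≡ i → i ℕ.≤ 2 → S ≡ 𝟘
    go 0 w _ = wt≡0⇒𝟘 S w
    go 1 w _ with wt≡1⇒unit S w
    ... | k , refl = ⊥-elim (single k (trans (sym (comb-unit k col)) e))
    go 2 w _ with peel S w
    ... | k , S′ , refl , w′ , l′ with wt≡1⇒unit S′ w′
    ... | l , refl = ⊥-elim (t≢f (trans (sym (lookup-unit l)) (trans (cong (lookup (unit l)) (sym k≡l)) l′)))
      where
      same : lookup col k ≡ lookup col l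
      same = ⊕-zero⇒≡ (trans (sym (cong₂ _⊕_ (comb-unit k col) (comb-unit l col))) (trans (sym (comb-⊕ (unit k) (unit l) col)) e))
      k≡l : k ≡ l
      k≡l = IsEdge-unique {k} {l} {proj₁ (edge k)} {proj₂ (edge k)} (inj₁ refl) (IsEdge-from-inc (edge-≢ k)
        (trans (cong (λ c → lookup c (proj₁ (edge k))) (sym same)) (inc-fst k)) (trans (cong (λ c → lookup c (proj₂ (edge k))) (sym same)) (inc-snd k)))
    go (suc (suc (suc i))) w (s≤s (s≤s ()))

  -- Each vertex lies on an even number of the three edges. So an end x of edge i lies on exactly
  -- one of j and l; the far end of that edge and the other end of i must then both lie on the
  -- remaining edge.
  triangle-vertices : ∀ {i j l} → i ≢ j → j ≢ l → i ≢ l → lookup columns i ⊕ (lookup columns j ⊕ lookup columns l) ≡ 𝟘 →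
    ∃ λ a → ∃ λ b → ∃ λ c → IsTriangle a b c × IsEdge i a b × IsEdge j b c × IsEdge l a c
  triangle-vertices {i} {j} {l} i≢j j≢l i≢l cyc = go (inc j x) (inc l x) refl refl (trans (cong (_xor (inc j x xor inc l x)) (sym (inc-fst i))) (parity x))
    where
    x = proj₁ (edge i)
    y = proj₂ (edge i)
    parity : ∀ v → inc i v xor (inc j v xor inc l v) ≡ false
    parity v = trans (sym (trans (lookup-zipWith _xor_ v (lookup columns i) (lookup columns j ⊕ lookup columns l))
      (cong (inc i v xor_) (lookup-zipWith _xor_ v (lookup columns j) (lookup columns l))))) (trans (cong (λ c → lookup c v) cyc) (lookup-𝟘 v))
    x≢y = edge-≢ i
    third : ∀ p q r → p xor (q xor r) ≡ false → p ≡ true → q ≡ false → r ≡ true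
    third true false true _ _ _ = refl
    third′ : ∀ p q r → p xor (q xor r) ≡ false → p ≡ false → q ≡ true → r ≡ true
    third′ false true true _ _ _ = refl
    not-inc : ∀ {k u v w} → IsEdge k u v → w ≢ u → w ≢ v → inc k w ≡ false
    not-inc {k} {u} {v} {w} ie p q with inc k w in e
    ... | false = refl
    ... | true with inc-ends ie e
    ... | inj₁ r = ⊥-elim (p r)
    ... | inj₂ r = ⊥-elim (q r)
    complete : ∀ {j l z} → i ≢ j → (∀ v → inc i v xor (inc j v xor inc l v) ≡ false) → IsEdge j x z → y ≢ z × IsEdge l y z
    complete {j} {l} {z} i≢j par ie = y≢z , IsEdge-from-inc y≢z
        (third (inc i y) (inc j y) (inc l y) (par y) (inc-snd i) (not-inc ie (x≢y ∘ sym) y≢z))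
        (third′ (inc i z) (inc j z) (inc l z) (par z) (not-inc {i} {x} {y} (inj₁ refl) (IsEdge-≢ ie ∘ sym) (y≢z ∘ sym)) (inc⁺ (IsEdge-sym ie)))
      where
      y≢z : y ≢ z
      y≢z refl = i≢j (IsEdge-unique {i} {j} {x} {y} (inj₁ refl) ie)
    go : ∀ p q → inc j x ≡ p → inc l x ≡ q → true xor (inc j x xor inc l x) ≡ false →
      ∃ λ a → ∃ λ b → ∃ λ c → IsTriangle a b c × IsEdge i a b × IsEdge j b c × IsEdge l a c
    -- Edges i and j meet at x, so x has to be the middle vertex b and edge i is read backwards.
    go true q e _ _ with inc⁻ j x e
    ... | z , ie with complete {j} {l} i≢j parity ie
    ... | y≢z , ie′ = y , x , z , (x≢y ∘ sym , IsEdge-≢ ie , y≢z) , inj₂ refl , ie , ie′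
    go false true _ e _ with inc⁻ l x e
    ... | z , ie with complete {l} {j} i≢l (λ v → trans (cong (inc i v xor_) (xor-comm (inc l v) (inc j v))) (parity v)) ie
    ... | y≢z , ie′ = x , y , z , (x≢y , y≢z , IsEdge-≢ ie) , inj₁ refl , ie′ , ie
    go false false p q h rewrite p | q = ⊥-elim (t≢f h)

  -- If the complement of G ⊕ H lies in a cut then it is bipartite.
  agreeing : ∀ (F : Family n) → OddCycleAgreeing F → ∀ κ B x → F (mkGraph x) ≡ true → F (mkGraph (x ⊕ ∼ (B ∩ cut columns κ))) ≡ true → ⊥
  agreeing F agr κ B x h h′ = no-odd-cycle {n} (mkGraph (∼ (x ⊕ (x ⊕ ∼ Y)))) κ bip (agr (mkGraph x) (mkGraph (x ⊕ ∼ Y)) h h′)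
    where
    Y = B ∩ cut columns κ
    Y≡ : ∀ k → lookup (∼ (x ⊕ (x ⊕ ∼ Y))) k ≡ lookup Y k
    Y≡ k = trans (cong (λ z → lookup (∼ z) k) (⊕-cancel x (∼ Y))) (trans (lookup-∼ (∼ Y) k) (trans (cong not (lookup-∼ Y k)) (not-involutive (lookup Y k))))
    crossing : ∀ k → lookup Y k ≡ true → lookup κ (proj₁ (edge k)) xor lookup κ (proj₂ (edge k)) ≡ true
    crossing k e = trans (sym (lookup-cut κ k)) (proj₂ (∧-true {lookup B k} (trans (sym (lookup-zipWith _∧_ k B (cut columns κ))) e)))
    bip : ∀ {u v} → HasEdge {n} (mkGraph (∼ (x ⊕ (x ⊕ ∼ Y)))) u v → lookup κ u xor lookup κ v ≡ true
    bip {u} {v} he with HasEdge⁻ (mkGraph (∼ (x ⊕ (x ⊕ ∼ Y)))) he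
    ... | k , inj₁ ie , e = subst (λ z → lookup κ (proj₁ z) xor lookup κ (proj₂ z) ≡ true) ie (crossing k (trans (sym (Y≡ k)) e))
    ... | k , inj₂ ie , e = trans (xor-comm (lookup κ u) (lookup κ v)) (subst (λ z → lookup κ (proj₁ z) xor lookup κ (proj₂ z) ≡ true) ie (crossing k (trans (sym (Y≡ k)) e)))

-- Biased measures and up-closures

sumℚ-++ : ∀ xs ys → sumℚ (xs ++ ys) ≡ sumℚ xs + sumℚ ys
sumℚ-++ [] ys = sym (+-identityˡ (sumℚ ys))
sumℚ-++ (x ∷ xs) ys = trans (cong (λ z → x + z) (sumℚ-++ xs ys)) (sym (+-assoc x (sumℚ xs) (sumℚ ys)))

sumℚ-* : ∀ {A : Set} c (g : A → ℚ) xs → sumℚ (List.map (λ x → c * g x) xs) ≡ c * sumℚ (List.map g xs)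
sumℚ-* c g [] = sym (*-zeroʳ c)
sumℚ-* c g (x ∷ xs) = trans (cong (λ z → c * g x + z) (sumℚ-* c g xs)) (sym (*-distribˡ-+ c (g x) (sumℚ (List.map g xs))))

count≤ : ∀ {k} (x : Vec Bool k) → countᵇ (λ b → b) x ℕ.≤ k
count≤ [] = z≤n
count≤ (true ∷ x) = s≤s (count≤ x)
count≤ (false ∷ x) = ℕₚ.m≤n⇒m≤1+n (count≤ x)

module _ (p q : ℚ) where

  mass : ∀ {k} → Vec Bool k → ℚ
  mass {k} x = (p ^ countᵇ (λ b → b) x) * (q ^ (k ∸ countᵇ (λ b → b) x))

  private
    mass-true : ∀ {k} (x : Vec Bool k) → mass (true ∷ x) ≡ p * mass x
    mass-true {k} x = *-assoc p (p ^ countᵇ (λ b → b) x) (q ^ (k ∸ countᵇ (λ b → b) x))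

    mass-false : ∀ {k} (x : Vec Bool k) → mass (false ∷ x) ≡ q * mass x
    mass-false {k} x = trans (cong (λ e → (p ^ countᵇ (λ b → b) x) * (q ^ e)) (ℕₚ.+-∸-assoc 1 (count≤ x))) (lem (p ^ countᵇ (λ b → b) x) q (q ^ (k ∸ countᵇ (λ b → b) x)))
      where
      lem : ∀ u q v → u * (q * v) ≡ q * (u * v)
      lem = solve-∀ ℚ-ring

    if-* : ∀ b c r → (if b then c * r else 0ℚ) ≡ c * (if b then r else 0ℚ)
    if-* true c r = refl
    if-* false c r = sym (*-zeroʳ c)

  sum-mass : ∀ k (P : Vec Bool k → Bool) → sumℚ (List.map (λ x → if P x then mass x else 0ℚ) (allVecs k)) ≡ ∫ p q k (λ x → ⟦ P x ⟧)
  sum-mass zero P with P []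
  ... | true = refl
  ... | false = refl
  sum-mass (suc k) P = begin
    sumℚ (List.map g (List.map (true ∷_) (allVecs k) ++ List.map (false ∷_) (allVecs k)))
      ≡⟨ trans (cong sumℚ (map-++ g (List.map (true ∷_) (allVecs k)) (List.map (false ∷_) (allVecs k)))) (sumℚ-++ (List.map g (List.map (true ∷_) (allVecs k))) (List.map g (List.map (false ∷_) (allVecs k)))) ⟩
    sumℚ (List.map g (List.map (true ∷_) (allVecs k))) + sumℚ (List.map g (List.map (false ∷_) (allVecs k)))
      ≡⟨ cong₂ _+_ (half true p mass-true) (half false q mass-false) ⟩
    ∫ p q (suc k) (λ x → ⟦ P x ⟧) ∎
    where
    open ≡-Reasoning
    g : Vec Bool (suc k) → ℚ
    g x = if P x then mass x else 0ℚ
    half : ∀ b c → (∀ x → mass {suc k} (b ∷ x) ≡ c * mass x) → sumℚ (List.map g (List.map (b ∷_) (allVecs k))) ≡ c * ∫ p q k (λ x → ⟦ P (b ∷ x) ⟧)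
    half b c m = trans (cong sumℚ (trans (sym (map-∘ (allVecs k))) (map-cong (λ x → trans (cong (λ z → if P (b ∷ x) then z else 0ℚ) (m x)) (if-* (P (b ∷ x)) c (mass x))) (allVecs k))))
      (trans (sumℚ-* c (λ x → if P (b ∷ x) then mass x else 0ℚ) (allVecs k)) (cong (c *_) (sum-mass k (λ x → P (b ∷ x)))))

μF≡∫ : ∀ {n} p (F : Family n) → μF p F ≡ ∫ p (1ℚ - p) (N n) (λ x → ⟦ F (mkGraph x) ⟧)
μF≡∫ {n} p F = trans (cong sumℚ (sym (map-∘ (allVecs (N n))))) (sum-mass p (1ℚ - p) (N n) (λ x → F (mkGraph x)))

-- Every point has positive mass, so a null event is empty. This turns stability at ε = 0 into
-- uniqueness of the extremal families.
∫-pos : ∀ {a b} → 0ℚ < a → 0ℚ < b → ∀ {k} (P : Vec Bool k → Bool) → ∫ a b k (λ x → ⟦ P x ⟧) ≤ 0ℚ → ∀ x → P x ≡ false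
∫-pos 0<a 0<b P h [] with P []
... | false = refl
... | true = ⊥-elim (<-irrefl refl (<-≤-trans (positive⁻¹ 1ℚ) h))
∫-pos {a} {b} 0<a 0<b {suc k} P h (true ∷ x) = ∫-pos 0<a 0<b (λ x → P (true ∷ x)) (*-cancelˡ-≤ {a} 0<a (subst (a * T ≤_) (sym (*-zeroʳ a)) (≤-trans (≤-by {a * T} (b * U) (0≤* (<⇒≤ 0<b) U≥) refl) h))) x
  where
  T = ∫ a b k (λ x → ⟦ P (true ∷ x) ⟧)
  U = ∫ a b k (λ x → ⟦ P (false ∷ x) ⟧)
  U≥ : 0ℚ ≤ U
  U≥ = ∫-nonneg (<⇒≤ 0<a) (<⇒≤ 0<b) k (λ x → 0≤⟦⟧ (P (false ∷ x)))
∫-pos {a} {b} 0<a 0<b {suc k} P h (false ∷ x) = ∫-pos 0<a 0<b (λ x → P (false ∷ x)) (*-cancelˡ-≤ {b} 0<b (subst (b * U ≤_) (sym (*-zeroʳ b)) (≤-trans (≤-by {b * U} (a * T) (0≤* (<⇒≤ 0<a) T≥) (+-comm (b * U) (a * T))) h))) x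
  where
  T = ∫ a b k (λ x → ⟦ P (true ∷ x) ⟧)
  U = ∫ a b k (λ x → ⟦ P (false ∷ x) ⟧)
  T≥ : 0ℚ ≤ T
  T≥ = ∫-nonneg (<⇒≤ 0<a) (<⇒≤ 0<b) k (λ x → 0≤⟦⟧ (P (true ∷ x)))

_⊑_ : ∀ {k} → Vec Bool k → Vec Bool k → Set
x ⊑ y = x ∩ y ≡ x

Increasing : ∀ {k} → (Vec Bool k → Bool) → Set
Increasing A = ∀ x y → x ⊑ y → A x ≡ true → A y ≡ true

⊑-refl : ∀ {k} (x : Vec Bool k) → x ⊑ x
⊑-refl [] = refl
⊑-refl (b ∷ x) = cong₂ _∷_ (∧-idem b) (⊑-refl x)

Increasing-∷ : ∀ {k} {A : Vec Bool (suc k) → Bool} → Increasing A → ∀ b → Increasing (λ x → A (b ∷ x))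
Increasing-∷ inc b x y h = inc (b ∷ x) (b ∷ y) (cong₂ _∷_ (∧-idem b) h)

Increasing-⟦⟧ : ∀ {k} {A : Vec Bool (suc k) → Bool} → Increasing A → ∀ x → ⟦ A (false ∷ x) ⟧ ≤ ⟦ A (true ∷ x) ⟧
Increasing-⟦⟧ {A = A} inc x with A (false ∷ x) in e
... | false = 0≤⟦⟧ (A (true ∷ x))
... | true rewrite inc (false ∷ x) (true ∷ x) (cong (false ∷_) (⊑-refl x)) e = ≤-refl

module UpClosure {k} (F : Vec Bool k → Bool) where

  private
    below : Vec Bool k → Vec Bool k → Bool
    below x y = F y ∧ eqv (y ∩ x) y

    found : ∀ {x} → (∃ λ y → below x y ≡ true) ⊎ (∀ y → below x y ≡ false) → Bool
    found (inj₁ _) = true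
    found (inj₂ _) = false

  up : Vec Bool k → Bool
  up x = found (search (below x))

  up⁻ : ∀ x → up x ≡ true → ∃ λ y → F y ≡ true × y ⊑ x
  up⁻ x h = go (search (below x)) h
    where
    go : (s : (∃ λ y → below x y ≡ true) ⊎ (∀ y → below x y ≡ false)) → found s ≡ true → ∃ λ y → F y ≡ true × y ⊑ x
    go (inj₁ (y , e)) _ = y , proj₁ (∧-true e) , eqv⇒≡ (y ∩ x) y (proj₂ (∧-true {F y} e))

  up⁺ : ∀ x y → F y ≡ true → y ⊑ x → up x ≡ true
  up⁺ x y Fy y⊑x = go (search (below x))
    where
    go : (s : (∃ λ y → below x y ≡ true) ⊎ (∀ y → below x y ≡ false)) → found s ≡ true
    go (inj₁ _) = refl
    go (inj₂ none) = ⊥-elim (t≢f (trans (sym (cong₂ _∧_ Fy (trans (cong (λ z → eqv z y) y⊑x) (eqv-refl y)))) (none y)))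

  ⊑-trans : ∀ {j} {x y z : Vec Bool j} → x ⊑ y → y ⊑ z → x ⊑ z
  ⊑-trans {x = []} {[]} {[]} _ _ = refl
  ⊑-trans {x = a ∷ x} {b ∷ y} {c ∷ z} p q = cong₂ _∷_ (bits a b c (cong Vec.head p) (cong Vec.head q)) (⊑-trans (cong Vec.tail p) (cong Vec.tail q))
    where
    bits : ∀ a b c → a ∧ b ≡ a → b ∧ c ≡ b → a ∧ c ≡ a
    bits false b c _ _ = refl
    bits true true c _ h = h

  up-increasing : Increasing up
  up-increasing x y x⊑y h with up⁻ x h
  ... | z , Fz , z⊑x = up⁺ y z Fz (⊑-trans z⊑x x⊑y)

  F≤up : ∀ x → ⟦ F x ⟧ ≤ ⟦ up x ⟧
  F≤up x with F x in e
  ... | false = 0≤⟦⟧ (up x)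
  ... | true rewrite up⁺ x x e (⊑-refl x) = ≤-refl

-- Comparison of the biased with the uniform measure

module Biased (p : ℚ) (0≤p : 0ℚ ≤ p) (p≤½ : p ≤ ½) where

  q 2ℚ : ℚ
  q = 1ℚ - p
  2ℚ = + 2 / 1

  0≤1-2p : 0ℚ ≤ 1ℚ - 2ℚ * p
  0≤1-2p = subst (0ℚ ≤_) (lem p) (0≤* (decide≤ {0ℚ} {2ℚ}) (0≤- p≤½))
    where
    lem : ∀ p → (+ 2 / 1) * (½ - p) ≡ 1ℚ - (+ 2 / 1) * p
    lem = solve-∀ ℚ-ring

  0≤q : 0ℚ ≤ q
  0≤q = 0≤- (≤-trans p≤½ (decide≤ {½} {1ℚ}))

  private
    -- The line through (½, p) and (1, 1).
    last : ℚ → ℚ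
    last t = 1ℚ - 2ℚ * (q * (1ℚ - t))

    choose : ∀ {t} → Dec (t ≤ ½) → ℚ → ℚ → ℚ
    choose (yes _) u v = u
    choose (no _) u v = v

  -- Piecewise linear through (0,0), (2⁻ʲ,pʲ), …, (¼,p²), (½,p), (1,1).
  Ψ : ℕ → ℚ → ℚ
  Ψ zero t = t
  Ψ (suc j) t = choose (t ≤? ½) (p * Ψ j (2ℚ * t)) (last t)

  private
    double≤1 : ∀ {t} → t ≤ ½ → 2ℚ * t ≤ 1ℚ
    double≤1 h = *-monoˡ (decide≤ {0ℚ} {2ℚ}) h

    0≤double : ∀ {t} → 0ℚ ≤ t → 0ℚ ≤ 2ℚ * t
    0≤double = 0≤* (decide≤ {0ℚ} {2ℚ})

    last≤ : ∀ t → t ≤ 1ℚ → last t ≤ t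
    last≤ t t≤1 = ≤-by {last t} ((1ℚ - 2ℚ * p) * (1ℚ - t)) (0≤* 0≤1-2p (0≤- t≤1)) (lem p t)
      where
      lem : ∀ p t → (1ℚ - (+ 2 / 1) * ((1ℚ - p) * (1ℚ - t))) + (1ℚ - (+ 2 / 1) * p) * (1ℚ - t) ≡ t
      lem = solve-∀ ℚ-ring

    p-half : ∀ t → 0ℚ ≤ t → p * (2ℚ * t) ≤ t
    p-half t 0≤t = ≤-by {p * (2ℚ * t)} ((1ℚ - 2ℚ * p) * t) (0≤* 0≤1-2p 0≤t) (lem p t)
      where
      lem : ∀ p t → p * ((+ 2 / 1) * t) + (1ℚ - (+ 2 / 1) * p) * t ≡ t
      lem = solve-∀ ℚ-ring

    last-low : ∀ t → t ≤ ½ → last t ≤ p * last (2ℚ * t)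
    last-low t h = ≤-by {last t} ((q * (1ℚ - 2ℚ * p)) * (1ℚ - 2ℚ * t)) (0≤* (0≤* 0≤q 0≤1-2p) (0≤- (double≤1 h))) (lem p t)
      where
      lem : ∀ p t → (1ℚ - (+ 2 / 1) * ((1ℚ - p) * (1ℚ - t))) + ((1ℚ - p) * (1ℚ - (+ 2 / 1) * p)) * (1ℚ - (+ 2 / 1) * t)
        ≡ p * (1ℚ - (+ 2 / 1) * ((1ℚ - p) * (1ℚ - (+ 2 / 1) * t)))
      lem = solve-∀ ℚ-ring

  Ψ≤id : ∀ j t → 0ℚ ≤ t → t ≤ 1ℚ → Ψ j t ≤ t
  Ψ≤id zero t _ _ = ≤-refl
  Ψ≤id (suc j) t 0≤t t≤1 = go (t ≤? ½)
    where
    go : (d : Dec (t ≤ ½)) → choose d (p * Ψ j (2ℚ * t)) (last t) ≤ t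
    go (yes h) = ≤-trans (*-monoˡ 0≤p (Ψ≤id j (2ℚ * t) (0≤double 0≤t) (double≤1 h))) (p-half t 0≤t)
    go (no _) = last≤ t t≤1

  -- By convexity of Ψ the extension of its last segment stays below the graph. This and `Ψ≤id` are
  -- all that is needed when s and t lie on different sides of ½.
  last≤Ψ : ∀ j t → t ≤ 1ℚ → last t ≤ Ψ j t
  last≤Ψ zero t t≤1 = last≤ t t≤1
  last≤Ψ (suc j) t t≤1 = go (t ≤? ½)
    where
    go : (d : Dec (t ≤ ½)) → last t ≤ choose d (p * Ψ j (2ℚ * t)) (last t)
    go (yes h) = ≤-trans (last-low t h) (*-monoˡ 0≤p (last≤Ψ j (2ℚ * t) (double≤1 h)))
    go (no _) = ≤-refl

  -- The inductive step for `ν≤Ψ`: s and t stand for the uniform measures of the two sections of an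
  -- increasing set, whence s ≤ t. On one side of ½ it follows from self-similarity or linearity; in
  -- the mixed case replacing Ψ(2s) by 2s makes the left side linear.
  Ψ-two-point : ∀ j s t → 0ℚ ≤ s → s ≤ t → t ≤ 1ℚ → p * Ψ j t + q * Ψ j s ≤ Ψ j (½ * t + ½ * s)
  Ψ-two-point zero s t 0≤s s≤t t≤1 = ≤-by {p * t + q * s} ((½ - p) * (t - s)) (0≤* (0≤- p≤½) (0≤- s≤t)) (lem p s t)
    where
    lem : ∀ p s t → p * t + (1ℚ - p) * s + (½ - p) * (t - s) ≡ ½ * t + ½ * s
    lem = solve-∀ ℚ-ring
  Ψ-two-point (suc j) s t 0≤s s≤t t≤1 = go (t ≤? ½) (s ≤? ½) ((½ * t + ½ * s) ≤? ½)
    where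
    m = ½ * t + ½ * s
    low high : ℚ → ℚ
    low x = p * Ψ j (2ℚ * x)
    high = last
    m≤t : m ≤ t
    m≤t = ≤-by {m} (½ * (t - s)) (0≤* 0≤½ (0≤- s≤t)) (lem s t)
      where
      lem : ∀ s t → ½ * t + ½ * s + ½ * (t - s) ≡ t
      lem = solve-∀ ℚ-ring
    s≤m : s ≤ m
    s≤m = ≤-by {s} (½ * (t - s)) (0≤* 0≤½ (0≤- s≤t)) (lem s t)
      where
      lem : ∀ s t → s + ½ * (t - s) ≡ ½ * t + ½ * s
      lem = solve-∀ ℚ-ring
    go : (dₜ : Dec (t ≤ ½)) (dₛ : Dec (s ≤ ½)) (dₘ : Dec (m ≤ ½)) →
      p * choose dₜ (low t) (high t) + q * choose dₛ (low s) (high s) ≤ choose dₘ (low m) (high m)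
    go (yes t≤½) (no s≰½) _ = ⊥-elim (s≰½ (≤-trans s≤t t≤½))
    go (yes t≤½) (yes _) (no m≰½) = ⊥-elim (m≰½ (≤-trans m≤t t≤½))
    go (no _) (no s≰½) (yes m≤½) = ⊥-elim (s≰½ (≤-trans s≤m m≤½))
    go (yes t≤½) (yes _) (yes _) = subst₂ _≤_ (l₁ p (Ψ j (2ℚ * t)) (Ψ j (2ℚ * s))) (cong (λ z → p * Ψ j z) (l₂ s t))
        (*-monoˡ 0≤p (Ψ-two-point j (2ℚ * s) (2ℚ * t) (0≤double 0≤s) (*-monoˡ (decide≤ {0ℚ} {2ℚ}) s≤t) (double≤1 t≤½)))
      where
      l₁ : ∀ p u v → p * (p * u + (1ℚ - p) * v) ≡ p * (p * u) + (1ℚ - p) * (p * v)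
      l₁ = solve-∀ ℚ-ring
      l₂ : ∀ s t → ½ * ((+ 2 / 1) * t) + ½ * ((+ 2 / 1) * s) ≡ (+ 2 / 1) * (½ * t + ½ * s)
      l₂ = solve-∀ ℚ-ring
    go (no _) (no _) (no _) = ≤-by {p * last t + q * last s} ((q * (1ℚ - 2ℚ * p)) * (t - s)) (0≤* (0≤* 0≤q 0≤1-2p) (0≤- s≤t)) (lem p s t)
      where
      lem : ∀ p s t → p * (1ℚ - (+ 2 / 1) * ((1ℚ - p) * (1ℚ - t))) + (1ℚ - p) * (1ℚ - (+ 2 / 1) * ((1ℚ - p) * (1ℚ - s))) + ((1ℚ - p) * (1ℚ - (+ 2 / 1) * p)) * (t - s)
        ≡ 1ℚ - (+ 2 / 1) * ((1ℚ - p) * (1ℚ - (½ * t + ½ * s)))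
      lem = solve-∀ ℚ-ring
    go (no _) (yes s≤½) (no m≰½) = ≤-by {p * last t + q * low s} (q * (p * (2ℚ * s - Ψ j (2ℚ * s))) + (q * (1ℚ - 2ℚ * p)) * (2ℚ * (m - ½)))
        (0≤+ (0≤* 0≤q (0≤* 0≤p (0≤- (Ψ≤id j (2ℚ * s) (0≤double 0≤s) (double≤1 s≤½))))) (0≤* (0≤* 0≤q 0≤1-2p) (0≤* (decide≤ {0ℚ} {2ℚ}) (0≤- (<⇒≤ (≰⇒> m≰½))))))
        (lem p s t (Ψ j (2ℚ * s)))
      where
      lem : ∀ p s t v → p * (1ℚ - (+ 2 / 1) * ((1ℚ - p) * (1ℚ - t))) + (1ℚ - p) * (p * v)
        + ((1ℚ - p) * (p * ((+ 2 / 1) * s - v)) + ((1ℚ - p) * (1ℚ - (+ 2 / 1) * p)) * ((+ 2 / 1) * (½ * t + ½ * s - ½)))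
        ≡ 1ℚ - (+ 2 / 1) * ((1ℚ - p) * (1ℚ - (½ * t + ½ * s)))
      lem = solve-∀ ℚ-ring
    go (no _) (yes s≤½) (yes m≤½) = ≤-trans (≤-by {p * last t + q * low s} (q * (p * (2ℚ * s - Ψ j (2ℚ * s)))) (0≤* 0≤q (0≤* 0≤p (0≤- (Ψ≤id j (2ℚ * s) (0≤double 0≤s) (double≤1 s≤½)))))
          (lem p s t (Ψ j (2ℚ * s))))
        (*-monoˡ 0≤p (last≤Ψ j (2ℚ * m) (double≤1 m≤½)))
      where
      lem : ∀ p s t v → p * (1ℚ - (+ 2 / 1) * ((1ℚ - p) * (1ℚ - t))) + (1ℚ - p) * (p * v) + (1ℚ - p) * (p * ((+ 2 / 1) * s - v))
        ≡ p * (1ℚ - (+ 2 / 1) * ((1ℚ - p) * (1ℚ - (+ 2 / 1) * (½ * t + ½ * s))))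
      lem = solve-∀ ℚ-ring

  Ψ-0 : ∀ j → 0ℚ ≤ Ψ j 0ℚ
  Ψ-0 zero = ≤-refl
  Ψ-0 (suc j) = 0≤* 0≤p (Ψ-0 j)

  ν : ∀ {k} → (Vec Bool k → Bool) → ℚ
  ν {k} A = ∫ p q k (λ x → ⟦ A x ⟧)

  ν½ : ∀ {k} → (Vec Bool k → Bool) → ℚ
  ν½ A = 𝔼 (λ x → ⟦ A x ⟧)

  ν≤Ψ : ∀ j {k} (A : Vec Bool k → Bool) → Increasing A → ν A ≤ Ψ j (ν½ A)
  ν≤Ψ j {zero} A inc = go (A [])
    where
    go : ∀ b → ⟦ b ⟧ ≤ Ψ j ⟦ b ⟧
    go true = ≤-trans (≤-reflexive (lem q)) (last≤Ψ j 1ℚ ≤-refl)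
      where
      lem : ∀ q → 1ℚ ≡ 1ℚ - (+ 2 / 1) * (q * (1ℚ - 1ℚ))
      lem = solve-∀ ℚ-ring
    go false = Ψ-0 j
  ν≤Ψ j {suc k} A inc = ≤-trans (+-mono-≤ (*-monoˡ 0≤p (ν≤Ψ j (λ x → A (true ∷ x)) (Increasing-∷ inc true))) (*-monoˡ 0≤q (ν≤Ψ j (λ x → A (false ∷ x)) (Increasing-∷ inc false))))
    (Ψ-two-point j (ν½ (λ x → A (false ∷ x))) (ν½ (λ x → A (true ∷ x))) (𝔼-nonneg (λ x → 0≤⟦⟧ (A (false ∷ x)))) (𝔼-mono (Increasing-⟦⟧ inc))
      (subst (ν½ (λ x → A (true ∷ x)) ≤_) (∫-const {½} {½} refl k 1ℚ) (𝔼-mono (λ x → ⟦⟧≤1 (A (true ∷ x))))))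

  Ψ₃ : ∀ t → t ≤ ⅛ → Ψ 3 t ≡ (p ^ 3) * ((+ 8 / 1) * t)
  Ψ₃ t h = trans (first 2 t t≤½) (trans (cong (p *_) (first 1 (2ℚ * t) 2t≤½)) (trans (cong (λ z → p * (p * z)) (first 0 (2ℚ * (2ℚ * t)) 4t≤½)) (lem p t)))
    where
    first : ∀ j t → t ≤ ½ → Ψ (suc j) t ≡ p * Ψ j (2ℚ * t)
    first j t h = go (t ≤? ½)
      where
      go : (d : Dec (t ≤ ½)) → choose d (p * Ψ j (2ℚ * t)) (last t) ≡ p * Ψ j (2ℚ * t)
      go (yes _) = refl
      go (no ¬h) = ⊥-elim (¬h h)
    t≤½ : t ≤ ½
    t≤½ = ≤-trans h (decide≤ {⅛} {½})
    2t≤½ : 2ℚ * t ≤ ½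
    2t≤½ = ≤-trans (*-monoˡ (decide≤ {0ℚ} {2ℚ}) h) (decide≤ {2ℚ * ⅛} {½})
    4t≤½ : 2ℚ * (2ℚ * t) ≤ ½
    4t≤½ = ≤-trans (*-monoˡ (decide≤ {0ℚ} {2ℚ}) (*-monoˡ (decide≤ {0ℚ} {2ℚ}) h)) (decide≤ {2ℚ * (2ℚ * ⅛)} {½})
    lem : ∀ p t → p * (p * (p * ((+ 2 / 1) * ((+ 2 / 1) * ((+ 2 / 1) * t))))) ≡ (p * (p * (p * 1ℚ))) * ((+ 8 / 1) * t)
    lem = solve-∀ ℚ-ring

  -- The set need not be increasing, yet passing from ½ to p costs only a factor 2: coordinate i
  -- contributes q ≤ 1 against ½, and the section that remains is increasing, so `ν≤Ψ` with Ψ the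
  -- identity applies to it.
  ν-missing : ∀ {k} (A : Vec Bool k → Bool) → Increasing A → ∀ i →
    ν (λ x → A x ∧ not (lookup x i)) ≤ 2ℚ * ν½ (λ x → A x ∧ not (lookup x i))
  ν-missing {suc k} A inc zero = subst₂ _≤_ (sym (trans (cong₂ (λ u v → p * u + q * v) (trans (∫-cong k (λ x → cong ⟦_⟧ (∧-zeroʳ (A (true ∷ x))))) (∫-0 k)) (∫-cong k (λ x → cong ⟦_⟧ (∧-identityʳ (A (false ∷ x)))))) (l₁ p q (ν A₀))))
      (sym (trans (cong (2ℚ *_) (cong₂ (λ u v → ½ * u + ½ * v) (trans (∫-cong k (λ x → cong ⟦_⟧ (∧-zeroʳ (A (true ∷ x))))) (∫-0 k)) (∫-cong k (λ x → cong ⟦_⟧ (∧-identityʳ (A (false ∷ x))))))) (l₂ (ν½ A₀))))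
      (≤-trans (*-mono₂ 0≤q (𝔼-nonneg (λ x → 0≤⟦⟧ (A₀ x))) q≤1 (ν≤Ψ 0 A₀ (Increasing-∷ inc false))) (≤-reflexive (*-identityˡ (ν½ A₀))))
    where
    A₀ : Vec Bool k → Bool
    A₀ x = A (false ∷ x)
    l₁ : ∀ p q u → p * 0ℚ + q * u ≡ q * u
    l₁ = solve-∀ ℚ-ring
    l₂ : ∀ u → (+ 2 / 1) * (½ * 0ℚ + ½ * u) ≡ u
    l₂ = solve-∀ ℚ-ring
    q≤1 : q ≤ 1ℚ
    q≤1 = ≤-by {q} p 0≤p (lem p)
      where
      lem : ∀ p → 1ℚ - p + p ≡ 1ℚ
      lem = solve-∀ ℚ-ring
  ν-missing {suc k} A inc (suc i) = ≤-trans (+-mono-≤ (*-monoˡ 0≤p (ν-missing (λ x → A (true ∷ x)) (Increasing-∷ inc true) i)) (*-monoˡ 0≤q (ν-missing (λ x → A (false ∷ x)) (Increasing-∷ inc false) i)))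
    (≤-by {p * (2ℚ * t) + q * (2ℚ * s)} ((1ℚ - 2ℚ * p) * (t - s)) (0≤* 0≤1-2p (0≤- s≤t)) (lem p s t))
    where
    s = ν½ (λ x → A (false ∷ x) ∧ not (lookup x i))
    t = ν½ (λ x → A (true ∷ x) ∧ not (lookup x i))
    s≤t : s ≤ t
    s≤t = 𝔼-mono (λ x → subst₂ _≤_ (sym (⟦∧⟧ (A (false ∷ x)) (not (lookup x i)))) (sym (⟦∧⟧ (A (true ∷ x)) (not (lookup x i)))) (*-monoʳ (0≤⟦⟧ (not (lookup x i))) (Increasing-⟦⟧ inc x)))
    lem : ∀ p s t → p * ((+ 2 / 1) * t) + (1ℚ - p) * ((+ 2 / 1) * s) + (1ℚ - (+ 2 / 1) * p) * (t - s) ≡ (+ 2 / 1) * (½ * t + ½ * s)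
    lem = solve-∀ ℚ-ring

missing≤present : ∀ {k} (A : Vec Bool k → Bool) → Increasing A → ∀ i →
  𝔼 (λ x → ⟦ A x ∧ not (lookup x i) ⟧) ≤ 𝔼 (λ x → ⟦ A x ∧ lookup x i ⟧)
missing≤present {suc k} A inc zero = subst₂ _≤_
    (sym (trans (cong₂ (λ u v → ½ * u + ½ * v) (z (λ x → A (true ∷ x))) (o (λ x → A (false ∷ x)))) (l₁ (𝔼 (λ x → ⟦ A (false ∷ x) ⟧)))))
    (sym (trans (cong₂ (λ u v → ½ * u + ½ * v) (o (λ x → A (true ∷ x))) (z (λ x → A (false ∷ x)))) (l₂ (𝔼 (λ x → ⟦ A (true ∷ x) ⟧)))))
    (*-monoˡ 0≤½ (𝔼-mono (Increasing-⟦⟧ inc)))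
  where
  z : ∀ (B : Vec Bool k → Bool) → 𝔼 (λ x → ⟦ B x ∧ false ⟧) ≡ 0ℚ
  z B = trans (∫-cong k (λ x → cong ⟦_⟧ (∧-zeroʳ (B x)))) (∫-0 k)
  o : ∀ (B : Vec Bool k → Bool) → 𝔼 (λ x → ⟦ B x ∧ true ⟧) ≡ 𝔼 (λ x → ⟦ B x ⟧)
  o B = ∫-cong k (λ x → cong ⟦_⟧ (∧-identityʳ (B x)))
  l₁ : ∀ u → ½ * 0ℚ + ½ * u ≡ ½ * u
  l₁ = solve-∀ ℚ-ring
  l₂ : ∀ u → ½ * u + ½ * 0ℚ ≡ ½ * u
  l₂ = solve-∀ ℚ-ring
missing≤present {suc k} A inc (suc i) = +-mono-≤ (*-monoˡ 0≤½ (missing≤present (λ x → A (true ∷ x)) (Increasing-∷ inc true) i)) (*-monoˡ 0≤½ (missing≤present (λ x → A (false ∷ x)) (Increasing-∷ inc false) i))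

-- Graph families

pattern₃ : ∀ {k} → Fin k → Fin k → Fin k → Bool → Bool → Bool → Vec Bool k → Bool
pattern₃ i j l s t u x = (lookup x i ≐ s) ∧ (lookup x j ≐ t) ∧ (lookup x l ≐ u)

xor-false⇒≡ : ∀ {a b} → a xor b ≡ false → b ≡ a
xor-false⇒≡ {true} {true} _ = refl
xor-false⇒≡ {false} {false} _ = refl

module _ {n : ℕ} where
  open EdgeSpace n

  record Triangle : Set where
    constructor mkTriangle
    field
      {a b c} : Fin n
      isTri : IsTriangle a b c
      {i j l} : Fin (N n)
      ab : IsEdge i a b
      bc : IsEdge j b c
      ac : IsEdge l a c

    private
      IsEdge-other : ∀ {k x y z} → IsEdge k x y → IsEdge k x z → y ≡ z
      IsEdge-other ie ie′ with inc-ends ie′ (inc⁺ (IsEdge-sym ie))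
      ... | inj₁ e = ⊥-elim (IsEdge-≢ ie (sym e))
      ... | inj₂ e = e

    i≢j : i ≢ j
    i≢j e = proj₂ (proj₂ isTri) (IsEdge-other (IsEdge-sym ab) (subst (λ k → IsEdge k b c) (sym e) bc))

    j≢l : j ≢ l
    j≢l e = proj₁ isTri (sym (IsEdge-other (IsEdge-sym bc) (subst (λ k → IsEdge k c a) (sym e) (IsEdge-sym ac))))

    i≢l : i ≢ l
    i≢l e = proj₁ (proj₂ isTri) (IsEdge-other ab (subst (λ k → IsEdge k a c) (sym e) ac))

    junta≡ : ∀ s t u x → junta a b c s t u (mkGraph x) ≡ pattern₃ i j l s t u x
    junta≡ s t u x = cong₂ _∧_ (cong (_≐ s) (edgeB≡lookup (mkGraph x) i ab)) (cong₂ _∧_ (cong (_≐ t) (edgeB≡lookup (mkGraph x) j bc)) (cong (_≐ u) (edgeB≡lookup (mkGraph x) l ac)))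

    umvirate≡ : ∀ x → umvirate a b c (mkGraph x) ≡ pattern₃ i j l true true true x
    umvirate≡ x = cong₂ _∧_ (side ab) (cong₂ _∧_ (side bc) (side ac))
      where
      bits : ∀ b → b ≡ (b ≐ true)
      bits true = refl
      bits false = refl
      side : ∀ {k u v} → IsEdge k u v → edgeB (mkGraph x) u v ≡ (lookup x k ≐ true)
      side {k} ie = trans (edgeB≡lookup (mkGraph x) k ie) (bits (lookup x k))

    𝔼-junta : ∀ s t u → 𝔼 (λ x → ⟦ pattern₃ i j l s t u x ⟧) ≡ ⅛
    𝔼-junta s t u = trans (∫-coord₃ {½} {½} refl i≢j j≢l i≢l s t u) (cong₂ _*_ (half s) (cong₂ _*_ (half t) (half u)))
      where
      half : ∀ s → weight {½} {½} refl s ≡ ½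
      half true = refl
      half false = refl

    ∫-umvirate : ∀ p → ∫ p (1ℚ - p) (N n) (λ x → ⟦ pattern₃ i j l true true true x ⟧) ≡ p ^ 3
    ∫-umvirate p = trans (∫-coord₃ {p} {1ℚ - p} (l₁ p) i≢j j≢l i≢l true true true) (l₂ p)
      where
      l₁ : ∀ p → p + (1ℚ - p) ≡ 1ℚ
      l₁ = solve-∀ ℚ-ring
      l₂ : ∀ p → p * (p * p) ≡ p * (p * (p * 1ℚ))
      l₂ = solve-∀ ℚ-ring

  triangle-from : ∀ {a b c : Fin n} → IsTriangle a b c → Triangle
  triangle-from {a} {b} {c} (a≢b , b≢c , a≢c) = mkTriangle {a} {b} {c} (a≢b , b≢c , a≢c) (proj₂ (find-edge a≢b)) (proj₂ (find-edge b≢c)) (proj₂ (find-edge a≢c))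

  record NearTriangle (F : Vec Bool (N n) → Bool) (ε : ℚ) : Set where
    constructor nearTriangle
    field
      T : Triangle
      s t u : Bool
      close : 𝔼 (λ x → ⟦ pattern₃ (Triangle.i T) (Triangle.j T) (Triangle.l T) s t u x xor F x ⟧) ≤ C₀ * ε

  module Half (3≤n : 3 ℕ.≤ n) (F : Family n) (agr : OddCycleAgreeing F) where
    open Agreeing columns columns-simple (λ x → F (mkGraph x)) (agreeing F agr) using (α; α≤⅛; stability; NearJunta) public

    some-triangle : Triangle
    some-triangle = go 3≤n
      where
      go : 3 ℕ.≤ n → Triangle
      go (s≤s (s≤s (s≤s _))) = triangle-from {zero} {suc zero} {suc (suc zero)} ((λ ()) , (λ ()) , (λ ()))

    near : ∀ ε → 0ℚ ≤ ε → ⅛ - ε ≤ α → NearTriangle (λ x → F (mkGraph x)) ε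
    near ε 0≤ε ε≥ = go (((+ 2097280 / 1) * ε) ≤? 1ℚ)
      where
      from-junta : NearJunta ε → NearTriangle (λ x → F (mkGraph x)) ε
      from-junta J = convert (triangle-vertices J.i≢j J.j≢l J.i≢l J.cycle)
        where
        module J = NearJunta J
        convert : (∃ λ a → ∃ λ b → ∃ λ c → IsTriangle a b c × IsEdge J.i a b × IsEdge J.j b c × IsEdge J.l a c) → NearTriangle (λ x → F (mkGraph x)) ε
        convert (a , b , c , tri , ab , bc , ac) = nearTriangle (mkTriangle {a} {b} {c} tri {J.i} {J.j} {J.l} ab bc ac) J.s J.t J.u J.close
      go : Dec ((+ 2097280 / 1) * ε ≤ 1ℚ) → NearTriangle (λ x → F (mkGraph x)) ε
      go (yes small) = from-junta (stability ε 0≤ε small ε≥)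
      -- For such ε the claimed bound exceeds 1, so any triangle will do.
      go (no large) = nearTriangle some-triangle true true true (≤-trans
        (subst (𝔼 (λ x → ⟦ J x xor F (mkGraph x) ⟧) ≤_) (∫-const {½} {½} refl (N n) 1ℚ) (𝔼-mono (λ x → ⟦⟧≤1 (J x xor F (mkGraph x)))))
        (≤-trans (<⇒≤ (≰⇒> large)) (*-monoʳ 0≤ε C₀-large)))
        where
        J : Vec Bool (N n) → Bool
        J = pattern₃ (Triangle.i some-triangle) (Triangle.j some-triangle) (Triangle.l some-triangle) true true true

  μ½≡𝔼 : ∀ (F : Family n) → μF ½ F ≡ 𝔼 (λ x → ⟦ F (mkGraph x) ⟧)
  μ½≡𝔼 F = μF≡∫ ½ F

  agreeing-stability : 3 ℕ.≤ n → ∀ ε → 0ℚ ≤ ε → (F : Family n) → OddCycleAgreeing F → ⅛ - ε ≤ μF ½ F →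
    Σ Triangle λ T → Σ Bool λ s → Σ Bool λ t → Σ Bool λ u → μF ½ (junta (Triangle.a T) (Triangle.b T) (Triangle.c T) s t u ΔF F) ≤ C₀ * ε
  agreeing-stability 3≤n ε 0≤ε F agr h = T , s , t , u ,
      subst (_≤ C₀ * ε) (sym (trans (μ½≡𝔼 (junta (Triangle.a T) (Triangle.b T) (Triangle.c T) s t u ΔF F)) (∫-cong (N n) (λ x → cong (λ z → ⟦ z xor F (mkGraph x) ⟧) (Triangle.junta≡ T s t u x))))) close
    where open NearTriangle (Half.near 3≤n F agr ε 0≤ε (subst (⅛ - ε ≤_) (μ½≡𝔼 F) h))

  agreeing-extremal : 3 ℕ.≤ n → (F : Family n) → OddCycleAgreeing F → (μF ½ F ≤ ⅛) × ((μF ½ F ≡ ⅛) ⇔ IsTriangleJunta F)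
  agreeing-extremal 3≤n F agr = subst (_≤ ⅛) (sym (μ½≡𝔼 F)) (Half.α≤⅛ 3≤n F agr) , mk⇔ to from
    where
    to : μF ½ F ≡ ⅛ → IsTriangleJunta F
    to e = Triangle.a T , Triangle.b T , Triangle.c T , s , t , u , Triangle.isTri T , λ G →
        trans (xor-false⇒≡ (∫-pos {½} {½} (positive⁻¹ ½) (positive⁻¹ ½) (λ x → pattern₃ (Triangle.i T) (Triangle.j T) (Triangle.l T) s t u x xor F (mkGraph x))
          (subst (𝔼 (λ x → ⟦ pattern₃ (Triangle.i T) (Triangle.j T) (Triangle.l T) s t u x xor F (mkGraph x) ⟧) ≤_) (*-zeroʳ C₀) close) (edgeVec G))) (sym (Triangle.junta≡ T s t u (edgeVec G)))
      where
      open NearTriangle (Half.near 3≤n F agr 0ℚ ≤-refl (≤-reflexive (trans (sym e) (μ½≡𝔼 F))))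
    from : IsTriangleJunta F → μF ½ F ≡ ⅛
    from (a , b , c , s , t , u , tri , eq) = trans (μ½≡𝔼 F) (trans (∫-cong (N n) (λ x → cong ⟦_⟧ (trans (eq (mkGraph x)) (Triangle.junta≡ T s t u x)))) (Triangle.𝔼-junta T s t u))
      where T = triangle-from {a} {b} {c} tri

-- The stability constant

inv : ℚ → ℚ
inv p = go (p ≟ 0ℚ)
  where
  go : Dec (p ≡ 0ℚ) → ℚ
  go (yes _) = 0ℚ
  go (no p≢0) = (1/ p) {{≢-nonZero p≢0}}

inv-* : ∀ p → 0ℚ < p → inv p * p ≡ 1ℚ
inv-* p 0<p with p ≟ 0ℚ
... | yes refl = ⊥-elim (<-irrefl refl 0<p)
... | no p≢0 = *-inverseˡ p {{≢-nonZero p≢0}}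

inv-nonneg : ∀ p → 0ℚ < p → 0ℚ ≤ inv p
inv-nonneg p 0<p = *-cancelˡ-≤ {p} 0<p (subst₂ _≤_ (sym (*-zeroʳ p)) (sym (trans (*-comm p (inv p)) (inv-* p 0<p))) 0≤1)

inv-antitone : ∀ δ p → 0ℚ < δ → δ ≤ p → inv p ≤ inv δ
inv-antitone δ p 0<δ δ≤p = subst₂ _≤_ (trans (cong (inv p *_) (inv-* δ 0<δ)) (*-identityʳ (inv p)))
    (trans (l (inv p) (inv δ) p) (trans (cong (_* inv δ) (inv-* p 0<p)) (*-identityˡ (inv δ))))
    (*-monoˡ (inv-nonneg p 0<p) (*-monoˡ (inv-nonneg δ 0<δ) δ≤p))
  where
  0<p = <-≤-trans 0<δ δ≤p
  l : ∀ u v p → u * (v * p) ≡ (u * p) * v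
  l = solve-∀ ℚ-ring

R : ℚ → ℚ
R p = inv p * (inv p * inv p)

-- For p > 0 this is 1 + 2C₀/p³. A deficit ε at p becomes ε/(8p³) at ½; three missing edges at 2 · 2
-- · C₀ε/(8p³) each make 3/2 · C₀ε/p³, rounded up to 2, and p³ - μ_p(F) ≤ ε supplies the 1.
constant : ℚ → ℚ
constant p = 1ℚ + (+ 2 / 1) * (C₀ * R p)

0≤C₀ : 0ℚ ≤ C₀
0≤C₀ = ≤-trans (decide≤ {0ℚ} {+ 2097280 / 1}) C₀-large

constant-bounded : (δ : ℚ) → 0ℚ < δ → ∃ λ M → (p : ℚ) → δ ≤ p → p ≤ ½ → constant p ≤ M
constant-bounded δ 0<δ = constant δ , λ p δ≤p _ → +-monoʳ-≤ 1ℚ (*-monoˡ (decide≤ {0ℚ} {+ 2 / 1}) (*-monoˡ 0≤C₀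
  (let i≤ = inv-antitone δ p 0<δ δ≤p ; 0≤i = inv-nonneg p (<-≤-trans 0<δ δ≤p) ; 0≤j = inv-nonneg δ 0<δ in
    *-mono₂ 0≤i (0≤* 0≤j 0≤j) i≤ (*-mono₂ 0≤i 0≤j i≤ i≤))))

C₀≤constant½ : C₀ ≤ constant ½
C₀≤constant½ = ≤-by {C₀} (1ℚ + (+ 15 / 1) * C₀) (0≤+ 0≤1 (0≤* (decide≤ {0ℚ} {+ 15 / 1}) 0≤C₀)) (lem C₀)
  where
  lem : ∀ c → c + (1ℚ + (+ 15 / 1) * c) ≡ 1ℚ + (+ 2 / 1) * (c * (+ 8 / 1))
  lem = solve-∀ ℚ-ring

lookup-⊑ : ∀ {k} {x y : Vec Bool k} → x ⊑ y → ∀ i → lookup x i ≡ true → lookup y i ≡ true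
lookup-⊑ {x = x} {y} h i e = bits (lookup x i) (lookup y i) (trans (sym (lookup-zipWith _∧_ i x y)) (cong (λ z → lookup z i) h)) e
  where
  bits : ∀ a b → a ∧ b ≡ a → a ≡ true → b ≡ true
  bits true true _ _ = refl

-- A junta with a zero on the triangle misses the larger half of an increasing family.
wrong-sign : ∀ {k} (A J : Vec Bool k → Bool) → Increasing A → ∀ e → (∀ x → J x ≡ true → lookup x e ≡ false) →
  𝔼 (λ x → ⟦ J x ⟧) ≤ 𝔼 (λ x → ⟦ J x xor A x ⟧)
wrong-sign {k} A J inc e h = ≤-trans (≤-by {j} (pr - mi) (0≤- (missing≤present A inc e)) eq) (𝔼-mono (λ x → pointwise (J x) (A x) (lookup x e) (h x)))
  where
  j = 𝔼 (λ x → ⟦ J x ⟧)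
  pr = 𝔼 (λ x → ⟦ A x ∧ lookup x e ⟧)
  mi = 𝔼 (λ x → ⟦ A x ∧ not (lookup x e) ⟧)
  eq : j + (pr - mi) ≡ 𝔼 (λ x → ⟦ J x ⟧ + (⟦ A x ∧ lookup x e ⟧ - ⟦ A x ∧ not (lookup x e) ⟧))
  eq = sym (trans (∫-+ k (λ x → ⟦ J x ⟧) (λ x → ⟦ A x ∧ lookup x e ⟧ - ⟦ A x ∧ not (lookup x e) ⟧)) (cong (λ z → j + z) (∫-- k (λ x → ⟦ A x ∧ lookup x e ⟧) (λ x → ⟦ A x ∧ not (lookup x e) ⟧))))
  pointwise : ∀ J A x → (J ≡ true → x ≡ false) → ⟦ J ⟧ + (⟦ A ∧ x ⟧ - ⟦ A ∧ not x ⟧) ≤ ⟦ J xor A ⟧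
  pointwise true A true h = ⊥-elim (t≢f (h refl))
  pointwise true true false h = decide≤
  pointwise true false false h = decide≤
  pointwise false true true h = decide≤
  pointwise false true false h = decide≤
  pointwise false false x h = decide≤

-- Intersecting families through their up-closure

module Intersecting {n : ℕ} (3≤n : 3 ℕ.≤ n) (p : ℚ) (0<p : 0ℚ < p) (p≤½ : p ≤ ½) (F : Family n) (int : OddCycleIntersecting F) where
  open Biased p (<⇒≤ 0<p) p≤½
  open UpClosure (λ x → F (mkGraph x))

  upward : Family n
  upward G = up (edgeVec G)

  -- Members below G and H share an odd cycle, whose edges lie in both G and H.
  upward-agreeing : OddCycleAgreeing upward
  upward-agreeing G H hG hH = combine (up⁻ (edgeVec G) hG) (up⁻ (edgeVec H) hH)
    where
    open EdgeSpace n
    combine : (∃ λ y → F (mkGraph y) ≡ true × y ⊑ edgeVec G) → (∃ λ y → F (mkGraph y) ≡ true × y ⊑ edgeVec H) → HasOddCycle (complement (G ⊕G H))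
    combine (y , Fy , y⊑) (z , Fz , z⊑) = HasOddCycle-mono (mkGraph y ∩G mkGraph z) (complement (G ⊕G H)) sub (int (mkGraph y) (mkGraph z) Fy Fz)
      where
      sub : ∀ k → lookup (y ∩ z) k ≡ true → lookup (∼ (edgeVec G ⊕ edgeVec H)) k ≡ true
      sub k e = trans (lookup-∼ (edgeVec G ⊕ edgeVec H) k) (cong not (trans (lookup-zipWith _xor_ k (edgeVec G) (edgeVec H))
          (cong₂ _xor_ (lookup-⊑ y⊑ k (proj₁ yz)) (lookup-⊑ z⊑ k (proj₂ yz)))))
        where yz = ∧-true {lookup y k} {lookup z k} (trans (sym (lookup-zipWith _∧_ k y z)) e)

  open Half {n} 3≤n upward upward-agreeing

  0≤p³ : 0ℚ ≤ p ^ 3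
  0≤p³ = 0≤* (<⇒≤ 0<p) (0≤* (<⇒≤ 0<p) (0≤* (<⇒≤ 0<p) 0≤1))

  νF : ℚ
  νF = ν (λ x → F (mkGraph x))

  νF≤ : νF ≤ (p ^ 3) * ((+ 8 / 1) * α)
  νF≤ = ≤-trans (∫-mono (<⇒≤ 0<p) 0≤q (N n) F≤up) (≤-trans (ν≤Ψ 3 up up-increasing) (≤-reflexive (Ψ₃ α α≤⅛)))

  bound : νF ≤ p ^ 3
  bound = ≤-trans νF≤ (subst ((p ^ 3) * ((+ 8 / 1) * α) ≤_) (*-identityʳ (p ^ 3)) (*-monoˡ 0≤p³ (*-monoˡ (decide≤ {0ℚ} {+ 8 / 1}) α≤⅛)))

  module _ (ε : ℚ) (0≤ε : 0ℚ ≤ ε) (ε≥ : p ^ 3 - ε ≤ νF) where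

    private
      0≤R : 0ℚ ≤ R p
      0≤R = 0≤* 0≤i (0≤* 0≤i 0≤i)
        where 0≤i = inv-nonneg p 0<p
      Rp³ : R p * p ^ 3 ≡ 1ℚ
      Rp³ = trans (l (inv p) p) (cong (λ z → z * (z * z)) (inv-* p 0<p))
        where
        l : ∀ i p → (i * (i * i)) * (p * (p * (p * 1ℚ))) ≡ (i * p) * ((i * p) * (i * p))
        l = solve-∀ ℚ-ring

      ε₁ δ : ℚ
      ε₁ = (⅛ * R p) * ε
      δ = C₀ * ε₁

      0≤ε₁ : 0ℚ ≤ ε₁
      0≤ε₁ = 0≤* (0≤* (decide≤ {0ℚ} {⅛}) 0≤R) 0≤ε

      -- Divide p³ - ε ≤ 8p³α by 8p³.
      α≥ : ⅛ - ε₁ ≤ α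
      α≥ = subst₂ _≤_ (trans (l₁ (R p) (p ^ 3) ε) (cong (λ z → ⅛ * z - ε₁) Rp³)) (trans (l₂ (R p) (p ^ 3) α) (trans (cong (_* α) Rp³) (*-identityˡ α)))
          (*-monoˡ (decide≤ {0ℚ} {⅛}) (*-monoˡ 0≤R (≤-trans ε≥ νF≤)))
        where
        l₁ : ∀ r q ε → (+ 1 / 8) * (r * (q - ε)) ≡ (+ 1 / 8) * (r * q) - ((+ 1 / 8) * r) * ε
        l₁ = solve-∀ ℚ-ring
        l₂ : ∀ r q α → (+ 1 / 8) * (r * (q * ((+ 8 / 1) * α))) ≡ (r * q) * α
        l₂ = solve-∀ ℚ-ring

      nt : NearTriangle up ε₁
      nt = near ε₁ 0≤ε₁ α≥

    nearby : Triangle {n}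
    nearby = NearTriangle.T nt

    private module T = Triangle nearby

    private
      U : Vec Bool (N n) → Bool
      U = pattern₃ T.i T.j T.l true true true

      J : Bool → Bool → Bool → Vec Bool (N n) → Bool
      J s t u = pattern₃ T.i T.j T.l s t u

      -- Here 8δ = C₀ε/p³ is at least 1 and the claim is trivial. This also disposes of juntas with
      -- a wrong sign pattern.
      large : ⅛ ≤ δ → ν (λ x → U x xor F (mkGraph x)) ≤ constant p * ε
      large h = ≤-trans (subst (ν (λ x → U x xor F (mkGraph x)) ≤_) (∫-const {p} {q} (l₀ p) (N n) 1ℚ) (∫-mono (<⇒≤ 0<p) 0≤q (N n) (λ x → ⟦⟧≤1 (U x xor F (mkGraph x)))))
          (≤-trans (*-monoˡ (decide≤ {0ℚ} {+ 8 / 1}) h) (≤-by {(+ 8 / 1) * δ} (ε + C₀ * (R p * ε)) (0≤+ 0≤ε (0≤* 0≤C₀ (0≤* 0≤R 0≤ε))) (l₁ C₀ (R p) ε)))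
        where
        l₀ : ∀ p → p + (1ℚ - p) ≡ 1ℚ
        l₀ = solve-∀ ℚ-ring
        l₁ : ∀ c r ε → (+ 8 / 1) * (c * (((+ 1 / 8) * r) * ε)) + (ε + c * (r * ε)) ≡ (1ℚ + (+ 2 / 1) * (c * r)) * ε
        l₁ = solve-∀ ℚ-ring

      ≐-false : ∀ {b} → (b ≐ false) ≡ true → b ≡ false
      ≐-false {false} _ = refl

      wrong : ∀ s t u e → (∀ x → J s t u x ≡ true → lookup x e ≡ false) → 𝔼 (λ x → ⟦ J s t u x xor up x ⟧) ≤ δ → ν (λ x → U x xor F (mkGraph x)) ≤ constant p * ε
      wrong s t u e h c = large (≤-trans (≤-reflexive (sym (T.𝔼-junta s t u))) (≤-trans (wrong-sign up (J s t u) up-increasing e h) c))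

      -- F minus the umvirate is covered by the members of the up-closure that miss an edge of the
      -- triangle. They are rare at ½, being outside U, and hence rare at p by `ν-missing`.
      main : 𝔼 (λ x → ⟦ U x xor up x ⟧) ≤ δ → ν (λ x → U x xor F (mkGraph x)) ≤ constant p * ε
      main c = ≤-trans (subst (ν (λ x → U x xor F (mkGraph x)) ≤_) eq (∫-mono (<⇒≤ 0<p) 0≤q (N n) (λ x → pointwise (F (mkGraph x)) (up x) (lookup x T.i) (lookup x T.j) (lookup x T.l) (F≤up x))))
          (fin C₀ (R p) ε (p ^ 3) νF mi mj ml 0≤ε 0≤R 0≤C₀ ε≥
            (missing-bound T.i (λ x e → cong (λ z → (z ≐ true) ∧ (lookup x T.j ≐ true) ∧ (lookup x T.l ≐ true)) e))
            (missing-bound T.j (λ x e → trans (cong (λ z → (lookup x T.i ≐ true) ∧ (z ≐ true) ∧ (lookup x T.l ≐ true)) e) (∧-zeroʳ (lookup x T.i ≐ true))))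
            (missing-bound T.l (λ x e → trans (cong (λ z → (lookup x T.i ≐ true) ∧ (lookup x T.j ≐ true) ∧ (z ≐ true)) e) (trans (cong ((lookup x T.i ≐ true) ∧_) (∧-zeroʳ (lookup x T.j ≐ true))) (∧-zeroʳ (lookup x T.i ≐ true))))))
        where
        miss : Fin (N n) → Vec Bool (N n) → Bool
        miss e x = up x ∧ not (lookup x e)
        mi mj ml : ℚ
        mi = ν (miss T.i)
        mj = ν (miss T.j)
        ml = ν (miss T.l)
        missing-bound : ∀ e → (∀ x → lookup x e ≡ false → U x ≡ false) → ν (miss e) ≤ 2ℚ * δ
        missing-bound e hU = ≤-trans (ν-missing up up-increasing e) (*-monoˡ (decide≤ {0ℚ} {2ℚ}) (≤-trans (𝔼-mono (λ x → le (up x) (lookup x e) (U x) (hU x))) c))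
          where
          le : ∀ A x U → (x ≡ false → U ≡ false) → ⟦ A ∧ not x ⟧ ≤ ⟦ U xor A ⟧
          le true true U h = 0≤⟦⟧ (U xor true)
          le true false U h = subst (λ U → 1ℚ ≤ ⟦ U xor true ⟧) (sym (h refl)) ≤-refl
          le false x U h = 0≤⟦⟧ (U xor false)
        eq : ∫ p q (N n) (λ x → (⟦ U x ⟧ - ⟦ F (mkGraph x) ⟧) + (2ℚ * ⟦ miss T.i x ⟧ + 2ℚ * ⟦ miss T.j x ⟧ + 2ℚ * ⟦ miss T.l x ⟧)) ≡ (p ^ 3 - νF) + (2ℚ * mi + 2ℚ * mj + 2ℚ * ml)
        eq = trans (∫-+ (N n) (λ x → ⟦ U x ⟧ - ⟦ F (mkGraph x) ⟧) (λ x → 2ℚ * ⟦ miss T.i x ⟧ + 2ℚ * ⟦ miss T.j x ⟧ + 2ℚ * ⟦ miss T.l x ⟧))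
          (cong₂ _+_ (trans (∫-- (N n) (λ x → ⟦ U x ⟧) (λ x → ⟦ F (mkGraph x) ⟧)) (cong (_- νF) (T.∫-umvirate p)))
            (∫-lin₃ (N n) 2ℚ 2ℚ 2ℚ (λ x → ⟦ miss T.i x ⟧) (λ x → ⟦ miss T.j x ⟧) (λ x → ⟦ miss T.l x ⟧)))
        pointwise : ∀ F A a b c → ⟦ F ⟧ ≤ ⟦ A ⟧ → ⟦ ((a ≐ true) ∧ (b ≐ true) ∧ (c ≐ true)) xor F ⟧ ≤ (⟦ (a ≐ true) ∧ (b ≐ true) ∧ (c ≐ true) ⟧ - ⟦ F ⟧) + ((+ 2 / 1) * ⟦ A ∧ not a ⟧ + (+ 2 / 1) * ⟦ A ∧ not b ⟧ + (+ 2 / 1) * ⟦ A ∧ not c ⟧)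
        pointwise true false a b c h = ⊥-elim (<-irrefl refl (<-≤-trans (positive⁻¹ 1ℚ) h))
        pointwise false true true true true _ = decide≤
        pointwise false true true true false _ = decide≤
        pointwise false true true false true _ = decide≤
        pointwise false true true false false _ = decide≤
        pointwise false true false true true _ = decide≤
        pointwise false true false true false _ = decide≤
        pointwise false true false false true _ = decide≤
        pointwise false true false false false _ = decide≤
        pointwise false false true true true _ = decide≤
        pointwise false false true true false _ = decide≤
        pointwise false false true false true _ = decide≤
        pointwise false false true false false _ = decide≤
        pointwise false false false true true _ = decide≤
        pointwise false false false true false _ = decide≤
        pointwise false false false false true _ = decide≤
        pointwise false false false false false _ = decide≤
        pointwise true true true true true _ = decide≤
        pointwise true true true true false _ = decide≤
        pointwise true true true false true _ = decide≤
        pointwise true true true false false _ = decide≤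
        pointwise true true false true true _ = decide≤
        pointwise true true false true false _ = decide≤
        pointwise true true false false true _ = decide≤
        pointwise true true false false false _ = decide≤
        fin : ∀ C R ε q νF mi mj ml → 0ℚ ≤ ε → 0ℚ ≤ R → 0ℚ ≤ C → q - ε ≤ νF → mi ≤ (+ 2 / 1) * (C * ((⅛ * R) * ε)) → mj ≤ (+ 2 / 1) * (C * ((⅛ * R) * ε)) → ml ≤ (+ 2 / 1) * (C * ((⅛ * R) * ε)) →
          (q - νF) + ((+ 2 / 1) * mi + (+ 2 / 1) * mj + (+ 2 / 1) * ml) ≤ (1ℚ + (+ 2 / 1) * (C * R)) * ε
        fin C R ε q νF mi mj ml 0≤ε 0≤R 0≤C h hi hj hl = ≤-by {(q - νF) + ((+ 2 / 1) * mi + (+ 2 / 1) * mj + (+ 2 / 1) * ml)}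
            ((νF - (q - ε)) + (+ 2 / 1) * (((+ 2 / 1) * (C * ((⅛ * R) * ε)) - mi) + ((+ 2 / 1) * (C * ((⅛ * R) * ε)) - mj) + ((+ 2 / 1) * (C * ((⅛ * R) * ε)) - ml)) + ½ * (C * (R * ε)))
            (0≤+ (0≤+ (0≤- h) (0≤* (decide≤ {0ℚ} {+ 2 / 1}) (0≤+ (0≤+ (0≤- hi) (0≤- hj)) (0≤- hl)))) (0≤* 0≤½ (0≤* 0≤C (0≤* 0≤R 0≤ε)))) (lem C R ε q νF mi mj ml)
          where
          lem : ∀ C R ε q νF mi mj ml → (q - νF) + ((+ 2 / 1) * mi + (+ 2 / 1) * mj + (+ 2 / 1) * ml)
            + ((νF - (q - ε)) + (+ 2 / 1) * (((+ 2 / 1) * (C * (((+ 1 / 8) * R) * ε)) - mi) + ((+ 2 / 1) * (C * (((+ 1 / 8) * R) * ε)) - mj) + ((+ 2 / 1) * (C * (((+ 1 / 8) * R) * ε)) - ml)) + ½ * (C * (R * ε)))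
            ≡ (1ℚ + (+ 2 / 1) * (C * R)) * ε
          lem = solve-∀ ℚ-ring

      decide-signs : ∀ s t u → 𝔼 (λ x → ⟦ J s t u x xor up x ⟧) ≤ δ → ν (λ x → U x xor F (mkGraph x)) ≤ constant p * ε
      decide-signs true true true = main
      decide-signs false t u = wrong false t u T.i (λ x e → ≐-false (proj₁ (∧-true {lookup x T.i ≐ false} e)))
      decide-signs true false u = wrong true false u T.j (λ x e → ≐-false (proj₁ (∧-true {lookup x T.j ≐ false} (proj₂ (∧-true {lookup x T.i ≐ true} e)))))
      decide-signs true true false = wrong true true false T.l (λ x e → ≐-false (proj₂ (∧-true {lookup x T.j ≐ true} (proj₂ (∧-true {lookup x T.i ≐ true} e)))))

    close-umvirate : ν (λ x → U x xor F (mkGraph x)) ≤ constant p * ε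
    close-umvirate = decide-signs (NearTriangle.s nt) (NearTriangle.t nt) (NearTriangle.u nt) (NearTriangle.close nt)

    umvirate-close : μF p (umvirate (Triangle.a nearby) (Triangle.b nearby) (Triangle.c nearby) ΔF F) ≤ constant p * ε
    umvirate-close = subst (_≤ constant p * ε) (sym (trans (μF≡∫ p (umvirate T.a T.b T.c ΔF F)) (∫-cong (N n) (λ x → cong (λ z → ⟦ z xor F (mkGraph x) ⟧) (T.umvirate≡ x))))) close-umvirate

  extremal : (μF p F ≤ p ^ 3) × ((μF p F ≡ p ^ 3) ⇔ IsUmvirate F)
  extremal = subst (_≤ p ^ 3) (sym (μF≡∫ p F)) bound , mk⇔ to from
    where
    0<q : 0ℚ < 1ℚ - p
    0<q = 0<- (≤-<-trans p≤½ ½<1)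
      where
      ½<1 : ½ < 1ℚ
      ½<1 = -‿0< (positive⁻¹ ½)
    to : μF p F ≡ p ^ 3 → IsUmvirate F
    to e = T.a , T.b , T.c , T.isTri , λ G →
        trans (xor-false⇒≡ (∫-pos {p} {1ℚ - p} 0<p 0<q (λ x → pattern₃ T.i T.j T.l true true true x xor F (mkGraph x))
          (subst (ν (λ x → pattern₃ T.i T.j T.l true true true x xor F (mkGraph x)) ≤_) (*-zeroʳ (constant p)) (close-umvirate 0ℚ ≤-refl ε≥)) (edgeVec G))) (sym (T.umvirate≡ (edgeVec G)))
      where
      ε≥ : p ^ 3 - 0ℚ ≤ νF
      ε≥ = ≤-reflexive (trans (+-identityʳ (p ^ 3)) (trans (sym e) (μF≡∫ p F)))
      module T = Triangle (nearby 0ℚ ≤-refl ε≥)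
    from : IsUmvirate F → μF p F ≡ p ^ 3
    from (a , b , c , tri , eq) = trans (μF≡∫ p F) (trans (∫-cong (N n) (λ x → cong ⟦_⟧ (trans (eq (mkGraph x)) (Triangle.umvirate≡ Tri x)))) (Triangle.∫-umvirate Tri p))
      where Tri = triangle-from {n} {a} {b} {c} tri

theorem1p2 : ((n : ℕ) → 3 ℕ.≤ n → (p : ℚ) → 0ℚ < p → p ≤ ½ → (F : Family n) →
    OddCycleIntersecting F →
    (μF p F ≤ p ^ 3) × ((μF p F ≡ p ^ 3) ⇔ IsUmvirate F))
    ×
    ((n : ℕ) → 3 ℕ.≤ n → (F : Family n) → OddCycleAgreeing F →
    (μF ½ F ≤ ⅛) × ((μF ½ F ≡ ⅛) ⇔ IsTriangleJunta F))
    ×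
    (Σ (ℚ → ℚ) λ c →
    ((δ : ℚ) → 0ℚ < δ → ∃ λ M → (p : ℚ) → δ ≤ p → p ≤ ½ → c p ≤ M)
    ×
    ((n : ℕ) → 3 ℕ.≤ n → (p : ℚ) → 0ℚ < p → p ≤ ½ → (ε : ℚ) → 0ℚ ≤ ε →
    (F : Family n) → OddCycleIntersecting F → p ^ 3 - ε ≤ μF p F →
    Σ (Fin n) λ a → Σ (Fin n) λ b → Σ (Fin n) λ d →
    IsTriangle a b d × (μF p (umvirate a b d ΔF F) ≤ c p * ε))
    ×
    ((n : ℕ) → 3 ℕ.≤ n → (ε : ℚ) → 0ℚ ≤ ε →
    (F : Family n) → OddCycleAgreeing F → ⅛ - ε ≤ μF ½ F →
    Σ (Fin n) λ a → Σ (Fin n) λ b → Σ (Fin n) λ d →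
    Σ _ λ sab → Σ _ λ sbc → Σ _ λ sad →
    IsTriangle a b d × (μF ½ (junta a b d sab sbc sad ΔF F) ≤ c ½ * ε)))
theorem1p2 =
    (λ n 3≤n p 0<p p≤½ F int → Intersecting.extremal 3≤n p 0<p p≤½ F int)
  , (λ n 3≤n F agr → agreeing-extremal 3≤n F agr)
  , constant
  , constant-bounded
  , intersecting-stability
  , agreeing-stability′
  where
  intersecting-stability : (n : ℕ) → 3 ℕ.≤ n → (p : ℚ) → 0ℚ < p → p ≤ ½ → (ε : ℚ) → 0ℚ ≤ ε →
    (F : Family n) → OddCycleIntersecting F → p ^ 3 - ε ≤ μF p F →
    Σ (Fin n) λ a → Σ (Fin n) λ b → Σ (Fin n) λ d → IsTriangle a b d × (μF p (umvirate a b d ΔF F) ≤ constant p * ε)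
  intersecting-stability n 3≤n p 0<p p≤½ ε 0≤ε F int h = Triangle.a T , Triangle.b T , Triangle.c T , Triangle.isTri T , I.umvirate-close ε 0≤ε h′
    where
    module I = Intersecting 3≤n p 0<p p≤½ F int
    h′ : p ^ 3 - ε ≤ I.νF
    h′ = subst (p ^ 3 - ε ≤_) (μF≡∫ p F) h
    T = I.nearby ε 0≤ε h′
  agreeing-stability′ : (n : ℕ) → 3 ℕ.≤ n → (ε : ℚ) → 0ℚ ≤ ε →
    (F : Family n) → OddCycleAgreeing F → ⅛ - ε ≤ μF ½ F →
    Σ (Fin n) λ a → Σ (Fin n) λ b → Σ (Fin n) λ d → Σ _ λ sab → Σ _ λ sbc → Σ _ λ sad →
    IsTriangle a b d × (μF ½ (junta a b d sab sbc sad ΔF F) ≤ constant ½ * ε)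
  agreeing-stability′ n 3≤n ε 0≤ε F agr h = finish (agreeing-stability 3≤n ε 0≤ε F agr h)
    where
    finish : (Σ Triangle λ T → Σ Bool λ s → Σ Bool λ t → Σ Bool λ u → μF ½ (junta (Triangle.a T) (Triangle.b T) (Triangle.c T) s t u ΔF F) ≤ C₀ * ε) →
      Σ (Fin n) λ a → Σ (Fin n) λ b → Σ (Fin n) λ d → Σ _ λ sab → Σ _ λ sbc → Σ _ λ sad →
      IsTriangle a b d × (μF ½ (junta a b d sab sbc sad ΔF F) ≤ constant ½ * ε)
    finish (T , s , t , u , le) = Triangle.a T , Triangle.b T , Triangle.c T , s , t , u , Triangle.isTri T , ≤-trans le (*-monoʳ 0≤ε C₀≤constant½)
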